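{- Let $q$ be a prime power and let $M$ be a simple $\mathrm{GF}(q)$-representable matroid. The catenary data of a $q$-cone $M'$ of $M$ can be calculated from the catenary data of $M$. Thus, the $\mathcal{G}$-invariant of a $q$-cone $M'$ of $M$ depends only on $\mathcal{G}(M)$ (and $q$), not on $M$ or on the representation. That is: if $M$ and $N$ are simple $\mathrm{GF}(q)$-representable matroids with the same catenary data (equivalently, with $\mathcal{G}(M)=\mathcal{G}(N)$), $M'$ is any $q$-cone of $M$, and $N'$ is any $q$-cone of $N$, then $M'$ and $N'$ have the same catenary data and $\mathcal{G}(M')=\mathcal{G}(N')$.
   Context: $q$-cones: let $M$ be a simple $\mathrm{GF}(q)$-representable rank-$r$ matroid. Choose a representation of $M$ in the rank-$(r+1)$ projective geometry $\mathrm{PG}(r,q)$, i.e., a set $E$ of points of $\mathrm{PG}(r,q)$ such that the restriction $\mathrm{PG}(r,q)|E$ is isomorphic to $M$. Let $A\mapsto\overline{A}$ be the closure operator of $\mathrm{PG}(r,q)$. Choose a point $a$ of $\mathrm{PG}(r,q)$ not in the hyperplane $\overline{E}$, and let $E'=\bigcup_{p\in E}\overline{\{a,p\}}$. The matroid $\mathrm{PG}(r,q)|E'$ is the $q$-cone of $M$ with base $E$ and apex $a$. (Different choices of $E$ may yield non-isomorphic $q$-cones.) Catenary data: for a rank-$r$ matroid $M$ on an $n$-element set $E$, an $(n,r)$-composition is an integer sequence $(a_0,\ldots,a_r)$ with $a_0\ge0$, $a_j>0$ for $1\le j\le r$, and sum $n$. A flag is a chain $X_0\subset X_1\subset\cdots\subset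 X_r=E$ of flats with $r(X_j)=j$; its composition is $(|X_0|,|X_1-X_0|,\ldots,|X_r-X_{r-1}|)$. $\nu(M;a_0,\ldots,a_r)$ is the number of flags with composition $(a_0,\ldots,a_r)$; the catenary data of $M$ is the vector of these numbers indexed by $(n,r)$-compositions. $\mathcal{G}$-invariant: $\mathcal{G}(n,r)$ is the vector space over a field of characteristic zero with basis the formal symbols $[\underline{r}]$, one for each $0,1$-sequence of length $n$ with exactly $r$ ones. For a permutation (linear ordering) $\pi$ of $E$, the rank sequence $\underline{r}(\pi)=r_1\ldots r_n$ has $r_j=r(\{\pi(1),\ldots,\pi(j)\})-r(\{\pi(1),\ldots,\pi(j-1)\})$. Then $\mathcal{G}(M)=\sum_\pi[\underline{r}(\pi)]\in\mathcal{G}(n,r)$ over all $n!$ permutations of $E$. Two matroids have the same $\mathcal{G}$-invariant if and only if they have the same catenary data. -}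

module Defs where

open import Algebra.Apartness.Bundles using (HeytingField; module HeytingCommutativeRing)
open import Algebra.Apartness.Structures using (IsHeytingField)
import Algebra.Definitions.RawMonoid as RawMonoidOps
open import Algebra.Bundles using (CommutativeRing)
open import Data.Bool.Base using (true; false; if_then_else_)
import Data.Bool.Properties as Bool
open import Data.Fin.Base using (Fin; zero; suc; toℕ; fromℕ; inject₁)
import Data.Fin.Properties as Fin
open import Data.Fin.Subset using (Subset; _∈_; _∉_; _⊆_; _⊂_; _∩_; _∪_; _─_; ⁅_⁆; ∣_∣; ⋃) renaming (⊤ to full)
open import Data.Fin.Subset.Properties using (_∈?_; _⊂?_)
open import Data.List.Base as List using (List)
open import Data.Nat.Base using (ℕ; zero; suc; _+_; _∸_; _^_; _≤_; _<_)
import Data.Nat.Properties as ℕ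
open import Data.Nat.Primality using (Prime)
open import Data.Product.Base using (Σ; ∃; ∃₂; _×_; _,_; proj₁; proj₂)
open import Data.Sum.Base using (_⊎_)
open import Data.Vec.Base as Vec using (Vec; []; _∷_; lookup)
import Data.Vec.Functional as VecF
import Data.Vec.Properties as Vec
open import Data.Vec.Relation.Unary.AllPairs using (allPairs?)
open import Function.Bundles using (_⇔_)
open import Level using (Level; 0ℓ; _⊔_)
open import Relation.Binary.PropositionalEquality using (_≡_; _≢_)
open import Relation.Nullary using (¬_; Dec; does; ¬?)
open import Relation.Nullary.Decidable using (_×-dec_; _→-dec_)
open import Relation.Unary using (Pred)

private
  variable
    n n′ r r′ d q k : ℕ
    c ℓ₁ ℓ₂ : Level

-- A rank-r matroid on the n-element ground set Fin n.
record Matroid (n r : ℕ) : Set where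
  field
    rank       : Subset n → ℕ
    rank≤size  : ∀ X → rank X ≤ ∣ X ∣
    monotone   : ∀ X Y → X ⊆ Y → rank X ≤ rank Y
    submodular : ∀ X Y → rank (X ∪ Y) + rank (X ∩ Y) ≤ rank X + rank Y
    rank-full  : rank full ≡ r

open Matroid public

record Simple (M : Matroid n r) : Set where
  field
    noLoops    : ∀ x → rank M ⁅ x ⁆ ≡ 1
    noParallel : ∀ x y → x ≢ y → rank M (⁅ x ⁆ ∪ ⁅ y ⁆) ≡ 2

IsFlat : Matroid n r → Subset n → Set
IsFlat M X = ∀ x → x ∉ X → rank M X < rank M (X ∪ ⁅ x ⁆)

isFlat? : (M : Matroid n r) (X : Subset n) → Dec (IsFlat M X)
isFlat? M X = Fin.all? λ x → ¬? (x ∈? X) →-dec (rank M X ℕ.<? rank M (X ∪ ⁅ x ⁆))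

-- Each vector with entries from xs occurs exactly once, provided that
-- xs has no repetitions.
vectors : {A : Set} → List A → ∀ k → List (Vec A k)
vectors xs zero    = List.[ [] ]
vectors xs (suc k) = List.cartesianProductWith _∷_ xs (vectors xs k)

subsets : ∀ n → List (Subset n)
subsets = vectors (true List.∷ false List.∷ List.[])

record Composition (n r : ℕ) : Set where
  field
    parts    : Vec ℕ (suc r)
    positive : ∀ (j : Fin r) → 0 < lookup parts (suc j)
    total    : Vec.sum parts ≡ n

open Composition public

IsFlag : Matroid n r → Vec (Subset n) (suc r) → Set
IsFlag {r = r} M X =
    (∀ j → IsFlat M (lookup X j))
  × (∀ j → rank M (lookup X j) ≡ toℕ j)
  × (∀ (j : Fin r) → lookup X (inject₁ j) ⊂ lookup X (suc j))
  × lookup X (fromℕ r) ≡ full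

isFlag? : (M : Matroid n r) (X : Vec (Subset n) (suc r)) → Dec (IsFlag M X)
isFlag? {r = r} M X =
        (Fin.all? λ j → isFlat? M (lookup X j))
  ×-dec (Fin.all? λ j → rank M (lookup X j) ℕ.≟ toℕ j)
  ×-dec (Fin.all? λ j → lookup X (inject₁ j) ⊂? lookup X (suc j))
  ×-dec Vec.≡-dec Bool._≟_ (lookup X (fromℕ r)) full

increments : Subset n → Vec (Subset n) k → Vec ℕ k
increments X []       = []
increments X (Y ∷ Ys) = ∣ Y ─ X ∣ ∷ increments Y Ys

-- (|X₀| , |X₁ − X₀| , … , |X_r − X_{r−1}|)
flagComposition : Vec (Subset n) (suc r) → Vec ℕ (suc r)
flagComposition (X ∷ Xs) = ∣ X ∣ ∷ increments X Xs

ν : Matroid n r → Vec ℕ (suc r) → ℕ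
ν {n} {r} M a = List.length (List.filter
  (λ X → isFlag? M X ×-dec Vec.≡-dec ℕ._≟_ (flagComposition X) a)
  (vectors (subsets n) (suc r)))

CatenaryData : ℕ → ℕ → Set
CatenaryData n r = Composition n r → ℕ

catenaryData : Matroid n r → CatenaryData n r
catenaryData M a = ν M (parts a)

infix 4 _≈ᶜ_

-- Equality of vectors indexed by compositions. Vectors can only be
-- equal if they have the same index set, so the constructor forces n
-- and r to agree.
data _≈ᶜ_ {n r} (v : CatenaryData n r) : ∀ {n′ r′} → CatenaryData n′ r′ → Set where
  pointwise : {w : CatenaryData n r} → (∀ a → v a ≡ w a) → v ≈ᶜ w

CharacteristicZero : HeytingField c ℓ₁ ℓ₂ → Set ℓ₁
CharacteristicZero K = ∀ m → ¬ (suc m · 1# ≈ 0#)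
  where
  open HeytingField K
  open CommutativeRing (HeytingCommutativeRing.commutativeRing heytingCommutativeRing)
    using (+-rawMonoid)
  open RawMonoidOps +-rawMonoid using () renaming (_×_ to _·_)

Symbol : ℕ → ℕ → Set
Symbol n r = Σ (Vec (Fin 2) n) λ s → Vec.count (Fin._≟ suc zero) s ≡ r

-- Linear orderings (π(1) , … , π(n)) of the ground set
orderings : ∀ n → List (Vec (Fin n) n)
orderings n = List.filter (allPairs? λ x y → ¬? (x Fin.≟ y)) (vectors (List.allFin n) n)

-- {π(1) , … , π(j)}
initial : Vec (Fin n) n → ℕ → Subset n
initial π j = ⋃ (List.map ⁅_⁆ (List.take j (Vec.toList π)))

-- Truncated subtraction is subtraction here, since rank is monotone.
rankSequence : Matroid n r → Vec (Fin n) n → Vec ℕ n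
rankSequence M π = Vec.tabulate λ j →
  rank M (initial π (suc (toℕ j))) ∸ rank M (initial π (toℕ j))

module _ (K : HeytingField c ℓ₁ ℓ₂) where
  private module K = HeytingField K

  -- The vector space with basis Symbol n r, in coordinates.
  𝒢 : ℕ → ℕ → Set c
  𝒢 n r = Symbol n r → K.Carrier

  -- The basis vector of the symbol with entries s; a rank sequence
  -- always consists of the entries of some symbol.
  basis : Vec ℕ n → 𝒢 n r
  basis s t = if does (Vec.≡-dec ℕ._≟_ s (Vec.map toℕ (proj₁ t))) then K.1# else K.0#

  𝒢-invariant : Matroid n r → 𝒢 n r
  𝒢-invariant {n} M = List.foldr (λ π v t → basis (rankSequence M π) t K.+ v t) (λ _ → K.0#) (orderings n)

  -- Equality of vectors, forcing the ambient spaces to be the same.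
  data SameVector {n r} (v : 𝒢 n r) : ∀ {n′ r′} → 𝒢 n′ r′ → Set (c ⊔ ℓ₁) where
    pointwise : {w : 𝒢 n r} → (∀ t → v t K.≈ w t) → SameVector v w

IsPrimePower : ℕ → Set
IsPrimePower q = ∃₂ λ p k → Prime p × 0 < k × q ≡ p ^ k

-- A field with exactly q elements, labelled by Fin q. With _≢_ as its
-- apartness relation a Heyting field is a field in the usual sense.
record GF (q : ℕ) : Set where
  infixl 7 _*_
  infixl 6 _⊕_
  field
    _⊕_ _*_ : Fin q → Fin q → Fin q
    ⊖_      : Fin q → Fin q
    0# 1#   : Fin q
    isField : IsHeytingField _≡_ _≢_ _⊕_ _*_ ⊖_ 0# 1#

module _ (F : GF q) where
  private module F = GF F

  Space : ℕ → Set
  Space d = Vec (Fin q) d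

  0ᵛ : Space d
  0ᵛ = Vec.replicate _ F.0#

  infixl 6 _+ᵛ_
  infixl 7 _·ᵛ_

  _+ᵛ_ : Space d → Space d → Space d
  _+ᵛ_ = Vec.zipWith F._⊕_

  _·ᵛ_ : Fin q → Space d → Space d
  a ·ᵛ v = Vec.map (a F.*_) v

  linearCombination : (Fin n → Fin q) → (Fin n → Space d) → Space d
  linearCombination a v = VecF.foldr _+ᵛ_ 0ᵛ λ i → a i ·ᵛ v i

  Independent : (Fin n → Space d) → Subset n → Set
  Independent v X = ∀ a → (∀ i → i ∉ X → a i ≡ F.0#) →
    linearCombination a v ≡ 0ᵛ → ∀ i → a i ≡ F.0#

  -- k is the rank of the subfamily (vᵢ) with i ∈ X, that is, the
  -- largest size of an independent subfamily.
  HasRank : (Fin n → Space d) → Subset n → ℕ → Set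
  HasRank v X k =
      (∃ λ B → B ⊆ X × Independent v B × ∣ B ∣ ≡ k)
    × (∀ B → B ⊆ X → Independent v B → ∣ B ∣ ≤ k)

  Representable : Matroid n r → Set
  Representable {n} M = ∃ λ d → Σ (Fin n → Space d) λ v → ∀ X → HasRank v X (rank M X)

  -- Points of the rank-d projective geometry PG(d−1 , q): nonzero
  -- vectors, compared up to nonzero scalars by _∼_.
  record Point (d : ℕ) : Set where
    field
      vec     : Space d
      nonzero : vec ≢ 0ᵛ

  open Point public

  infix 4 _∼_

  _∼_ : Point d → Point d → Set
  x ∼ y = ∃ λ a → a ≢ F.0# × vec y ≡ a ·ᵛ vec x

  data Span (A : Pred (Point d) 0ℓ) : Space d → Set where
    0∈  : Span A 0ᵛ
    add : ∀ {x v} a → A x → Span A v → Span A (a ·ᵛ vec x +ᵛ v)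

  Closure : Pred (Point d) 0ℓ → Pred (Point d) 0ℓ
  Closure A x = Span A (vec x)

  -- M is isomorphic to the restriction PG(d−1 , q) | E, where E is a
  -- set of points; in particular, E is closed under _∼_.
  record IsRestriction (E : Pred (Point d) 0ℓ) (M : Matroid n r) : Set where
    field
      point     : Fin n → Point d
      injective : ∀ i j → point i ∼ point j → i ≡ j
      image     : ∀ x → E x ⇔ ∃ λ i → point i ∼ x
      ranks     : ∀ X → HasRank (λ i → vec (point i)) X (rank M X)

  Pair : Point d → Point d → Pred (Point d) 0ℓ
  Pair x y z = x ∼ z ⊎ y ∼ z

  Cone : Pred (Point d) 0ℓ → Point d → Pred (Point d) 0ℓ
  Cone E a x = ∃ λ p → E p × Closure (Pair a p) x

  -- M′ is (up to isomorphism) a q-cone of the rank-r matroid M, with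
  -- base E and apex a in PG(r , q).
  record IsQCone (M : Matroid n r) (M′ : Matroid n′ r′) : Set₁ where
    field
      E      : Pred (Point (suc r)) 0ℓ
      base   : IsRestriction E M
      a      : Point (suc r)
      apex   : ¬ Closure E a
      cone   : IsRestriction (Cone E a) M′

{-# OPTIONS --safe #-}
module Submission where

-- Let α be the apex of the q-cone M′. The flats of M′ containing α are the cones over the
-- flats Y of M, with q|Y| + 1 elements. A flat X avoiding α meets each line through α and a
-- point of its projection Y exactly once, so |X| = |Y|; and if Y′ covers Y, then X has q
-- covers that avoid α and project onto Y′, because these partition the q(|Y′| − |Y|) points
-- in which the cones over Y′ and Y differ. Every flag of M′ avoids α up to some step, passes
-- from X to the cone over Y there, and consists of cones from then on; so it projects onto a
-- flag of M that determines its composition, and each such pair of a flag and a step arises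
-- q^i times, where i is the rank reached.
--
-- The number of orderings with a given rank sequence s is the sum, over the flags, of a
-- product that depends only on s and the composition of the flag. For s = 0^{a₀} 1 0^{a₁−1}
-- 1 0^{a₂−1} … this product is positive at (a₀, a₁, …) and vanishes unless the composition
-- dominates (a₀, a₁, …); hence the 𝒢-invariant and the catenary data determine each other.

open import Defs
open import Algebra.Apartness.Bundles using (HeytingField; module HeytingCommutativeRing)
open import Algebra.Apartness.Structures using (IsHeytingField)
open import Algebra.Bundles using (CommutativeRing)
import Algebra.Properties.CommutativeSemigroup as CommutativeSemigroupProperties
import Algebra.Properties.Group as GroupProperties
import Algebra.Properties.Monoid.Mult as MonoidMult
import Algebra.Properties.Ring as RingProperties
open import Data.Bool.Base using (true; false; if_then_else_)
import Data.Bool.Properties as Bool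
open import Data.Empty using (⊥-elim)
open import Data.Fin.Base using (Fin; zero; suc; toℕ; fromℕ<; fromℕ; inject₁)
import Data.Fin.Properties as Fin
open import Data.Fin.Subset
  using (Subset; _∈_; _∉_; _⊆_; _⊂_; _∪_; _∩_; _─_; ⁅_⁆; ∣_∣; ⊥; ⋃; outside; inside) renaming (⊤
    to full)
open import Data.Fin.Subset.Properties
  using (_∈?_; _⊆?_; drop-there; x∈⁅x⁆; x∈⁅y⁆⇒x≡y; x∈p∪q⁻; x∈p∪q⁺; p⊆p∪q; q⊆p∪q; x∈p∩q⁺;
    ⊆-antisym; _⊂?_; p⊂q⇒∣p∣<∣q∣; ∣p∣≤n; ∣p∣≡n⇒p≡⊤; ∪-identityˡ; ⊆-min; ∪-assoc; ∪-identityʳ;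
    ∣⊥∣≡0; ∣⊤∣≡n; ∣⁅x⁆∣≡1; ∉⊥; ∈⊤; x∈p∧x∉q⇒x∈p─q; p─q⊆p)
open import Data.List.Base as List using (List; []; _∷_; _++_)
import Data.List.Properties as List
open import Data.Nat.Base using (ℕ; zero; suc; _+_; _*_; _∸_; _<_; _≤_; z≤n; s≤s; s<s⁻¹; >-nonZero)
import Data.Nat.Properties as ℕ
open import Data.Product.Base using (_×_; _,_; proj₁; proj₂; Σ; ∃; ∃₂)
open import Data.Sum.Base using (_⊎_; inj₁; inj₂; [_,_]′)
open import Data.Unit.Base using (tt) renaming (⊤ to Unit)
open import Data.Vec.Base as Vec using (Vec; []; _∷_; lookup; here; there)
import Data.Vec.Properties as Vec
open import Data.Vec.Relation.Unary.All as All using (All; []; _∷_)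
open import Data.Vec.Relation.Unary.AllPairs using (AllPairs; []; _∷_; allPairs?)
open import Function.Base using (_∘_; id; case_of_)
open import Function.Bundles using (Equivalence)
open import Level using (0ℓ)
open import Relation.Binary.Definitions using (DecidableEquality)
open import Relation.Binary.PropositionalEquality
open import Relation.Nullary using (¬_; Dec; yes; no; does)
open import Relation.Nullary.Decidable using (_×-dec_; _⊎-dec_; ¬?; decidable-stable)
open import Relation.Unary using (Pred; Decidable)

open CommutativeSemigroupProperties ℕ.+-commutativeSemigroup using () renaming (interchange to +-interchange)
open CommutativeSemigroupProperties ℕ.*-commutativeSemigroup using (x∙yz≈y∙xz)

-- Two inductions run along a chain of flats, one for orderings and one for cones, and in both the
-- increments already met change what has to be counted further up. Chains are therefore summed
-- against an arbitrary weight of their increments; a single composition is singled out only at the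
-- end, by an indicator weight. Bijections and partitions become exchanges of sums over exhaustive
-- lists without repetitions. The geometry is confined to the incidence facts of `ConeStructure`.
-- They are proved with one normalised vector, a base vector plus `c` times the apex vector, for
-- each scalar `c`; this is where the `q` points on a line come from. Rank 0 stands apart. A cone is
-- a union of lines joining the apex to base points, so without base points it does not even contain
-- its apex, and the general formula, which would predict one element and rank 1, does not apply.

private
  variable
    A B : Set
    n r n′ r′ n″ r″ dim q k t l : ℕ

-- Sums over lists

∑ : List A → (A → ℕ) → ℕ
∑ []       f = 0
∑ (x ∷ xs) f = f x + ∑ xs f

infix 5 ∑
syntax ∑ xs (λ x → e) = ∑[ x ← xs ] e

𝟙 : ∀ {p} {P : Set p} → Dec P → ℕ
𝟙 d = if does d then 1 else 0

∑-cong : (xs : List A) {f g : A → ℕ} → (∀ x → f x ≡ g x) → ∑ xs f ≡ ∑ xs g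
∑-cong []       eq = refl
∑-cong (x ∷ xs) eq = cong₂ _+_ (eq x) (∑-cong xs eq)

∑-zero : (xs : List A) {f : A → ℕ} → (∀ x → f x ≡ 0) → ∑ xs f ≡ 0
∑-zero []       eq = refl
∑-zero (x ∷ xs) eq = cong₂ _+_ (eq x) (∑-zero xs eq)

∑-+ : (xs : List A) (f g : A → ℕ) → (∑[ x ← xs ] (f x + g x)) ≡ ∑ xs f + ∑ xs g
∑-+ []       f g = refl
∑-+ (x ∷ xs) f g = trans (cong (f x + g x +_) (∑-+ xs f g)) (+-interchange (f x) (g x) (∑ xs f) (∑ xs g))

∑-*ˡ : (xs : List A) (c : ℕ) (f : A → ℕ) → (∑[ x ← xs ] (c * f x)) ≡ c * ∑ xs f
∑-*ˡ []       c f = sym (ℕ.*-zeroʳ c)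
∑-*ˡ (x ∷ xs) c f = trans (cong (c * f x +_) (∑-*ˡ xs c f)) (sym (ℕ.*-distribˡ-+ c (f x) (∑ xs f)))

∑-*ʳ : (xs : List A) (c : ℕ) (f : A → ℕ) → (∑[ x ← xs ] (f x * c)) ≡ ∑ xs f * c
∑-*ʳ []       c f = refl
∑-*ʳ (x ∷ xs) c f = trans (cong (f x * c +_) (∑-*ʳ xs c f)) (sym (ℕ.*-distribʳ-+ c (f x) (∑ xs f)))

∑-swap : (xs : List A) (ys : List B) (f : A → B → ℕ) →
  (∑[ x ← xs ] ∑[ y ← ys ] f x y) ≡ (∑[ y ← ys ] ∑[ x ← xs ] f x y)
∑-swap []       ys f = sym (∑-zero ys λ _ → refl)
∑-swap (x ∷ xs) ys f = trans (cong (∑ ys (f x) +_) (∑-swap xs ys f)) (sym (∑-+ ys (f x) λ y → ∑[ x′ ← xs ] f x′ y))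

∑-++ : (xs ys : List A) (f : A → ℕ) → ∑ (xs ++ ys) f ≡ ∑ xs f + ∑ ys f
∑-++ []       ys f = refl
∑-++ (x ∷ xs) ys f = trans (cong (f x +_) (∑-++ xs ys f)) (sym (ℕ.+-assoc (f x) _ _))

∑-map : (g : A → B) (xs : List A) (f : B → ℕ) → ∑ (List.map g xs) f ≡ ∑ xs (f ∘ g)
∑-map g []       f = refl
∑-map g (x ∷ xs) f = cong (f (g x) +_) (∑-map g xs f)

∑-filter : {P : Pred A 0ℓ} (P? : Decidable P) (xs : List A) (f : A → ℕ) →
  ∑ (List.filter P? xs) f ≡ ∑[ x ← xs ] 𝟙 (P? x) * f x
∑-filter P? []       f = refl
∑-filter P? (x ∷ xs) f with does (P? x)
... | true  = cong₂ _+_ (sym (ℕ.+-identityʳ (f x))) (∑-filter P? xs f)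
... | false = ∑-filter P? xs f

length≡∑ : (xs : List A) → List.length xs ≡ ∑[ _ ← xs ] 1
length≡∑ []       = refl
length≡∑ (x ∷ xs) = cong suc (length≡∑ xs)

∑-vectors : (xs : List A) (k : ℕ) (f : Vec A (suc k) → ℕ) →
  ∑ (vectors xs (suc k)) f ≡ ∑[ x ← xs ] ∑[ v ← vectors xs k ] f (x ∷ v)
∑-vectors {A = A} xs k f = go xs
  where
  go : (ys : List A) → ∑ (List.cartesianProductWith _∷_ ys (vectors xs k)) f ≡
    ∑[ y ← ys ] ∑[ v ← vectors xs k ] f (y ∷ v)
  go []       = refl
  go (y ∷ ys) = trans (∑-++ (List.map (y ∷_) (vectors xs k)) _ f)
    (cong₂ _+_ (∑-map (y ∷_) (vectors xs k) f) (go ys))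

∑-allFin : ∀ n (f : Fin (suc n) → ℕ) → ∑ (List.allFin (suc n)) f ≡ f zero + ∑ (List.allFin n) (f ∘ suc)
∑-allFin n f = cong (f zero +_) (trans (cong (λ xs → ∑ xs f) (sym (List.map-tabulate id suc)))
  (∑-map suc (List.allFin n) f))

-- Indicator functions and lists without repetitions

module _ {p q} {P : Set p} {Q : Set q} where

  𝟙-cong : (P? : Dec P) (Q? : Dec Q) → (P → Q) → (Q → P) → 𝟙 P? ≡ 𝟙 Q?
  𝟙-cong (yes p) (yes q) f g = refl
  𝟙-cong (yes p) (no ¬q) f g = ⊥-elim (¬q (f p))
  𝟙-cong (no ¬p) (yes q) f g = ⊥-elim (¬p (g q))
  𝟙-cong (no ¬p) (no ¬q) f g = refl

  𝟙-× : (P? : Dec P) (Q? : Dec Q) → 𝟙 (P? ×-dec Q?) ≡ 𝟙 P? * 𝟙 Q?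
  𝟙-× P? Q? with does P? | does Q?
  ... | true  | true  = refl
  ... | true  | false = refl
  ... | false | _     = refl

  𝟙-×-* : (P? : Dec P) (Q? : Dec Q) (x : ℕ) → 𝟙 P? * (𝟙 Q? * x) ≡ 𝟙 (P? ×-dec Q?) * x
  𝟙-×-* P? Q? x = trans (sym (ℕ.*-assoc (𝟙 P?) (𝟙 Q?) x)) (cong (_* x) (sym (𝟙-× P? Q?)))

module _ {p} {P : Set p} where

  𝟙-yes : (P? : Dec P) → P → 𝟙 P? ≡ 1
  𝟙-yes (yes _) p = refl
  𝟙-yes (no ¬p) p = ⊥-elim (¬p p)

  𝟙-no : (P? : Dec P) → ¬ P → 𝟙 P? ≡ 0
  𝟙-no (yes p) ¬p = ⊥-elim (¬p p)
  𝟙-no (no _)  ¬p = refl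

  𝟙-guard : (P? : Dec P) {x y : ℕ} → (P → x ≡ y) → 𝟙 P? * x ≡ 𝟙 P? * y
  𝟙-guard (yes p) eq = cong (1 *_) (eq p)
  𝟙-guard (no _)  eq = refl

  𝟙-¬ : (P? : Dec P) → 𝟙 P? + 𝟙 (¬? P?) ≡ 1
  𝟙-¬ P? with does P?
  ... | true  = refl
  ... | false = refl

  𝟙-split : (P? : Dec P) (x : ℕ) → x ≡ 𝟙 P? * x + 𝟙 (¬? P?) * x
  𝟙-split P? x = trans (sym (ℕ.*-identityˡ x))
    (trans (cong (_* x) (sym (𝟙-¬ P?))) (ℕ.*-distribʳ-+ x (𝟙 P?) _))

module _ {p q} {P : Set p} {Q : Set q} where

  𝟙-cong-* : (P? : Dec P) (Q? : Dec Q) {x y : ℕ} → (P → Q) → (Q → P) → (P → x ≡ y) → 𝟙 P? * x ≡ 𝟙 Q? * y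
  𝟙-cong-* P? Q? f g eq = trans (𝟙-guard P? eq) (cong (_* _) (𝟙-cong P? Q? f g))

OccursOnce : DecidableEquality A → List A → A → Set
OccursOnce _≟_ xs y = ∑[ x ← xs ] 𝟙 (x ≟ y) ≡ 1

-- Besides evaluating a sum, this is read from right to left: it inserts a sum over a determined
-- object, such as a closure or a composition, which can then be exchanged with the outer sum.
∑-only : (_≟_ : DecidableEquality A) (xs : List A) {y : A} → OccursOnce _≟_ xs y →
  {P : Pred A 0ℓ} (P? : Decidable P) → P y → (∀ x → P x → x ≡ y) → (f : A → ℕ) →
  (∑[ x ← xs ] 𝟙 (P? x) * f x) ≡ f y
∑-only _≟_ xs {y} once {P} P? py unique f = begin
  (∑[ x ← xs ] 𝟙 (P? x) * f x) ≡⟨ ∑-cong xs (λ x → 𝟙-cong-* (P? x) (x ≟ y) (unique x)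
                                   (λ eq → subst P (sym eq) py) (λ px → cong f (unique x px))) ⟩
  (∑[ x ← xs ] 𝟙 (x ≟ y) * f y) ≡⟨ ∑-*ʳ xs (f y) (λ x → 𝟙 (x ≟ y)) ⟩
  (∑[ x ← xs ] 𝟙 (x ≟ y)) * f y ≡⟨ cong (_* f y) once ⟩
  1 * f y                       ≡⟨ ℕ.*-identityˡ (f y) ⟩
  f y                           ∎
  where open ≡-Reasoning

∑-count-one : (_≟_ : DecidableEquality A) (xs : List A) {y : A} → OccursOnce _≟_ xs y →
  {P : Pred A 0ℓ} (P? : Decidable P) → P y → (∀ x → P x → x ≡ y) → ∑[ x ← xs ] 𝟙 (P? x) ≡ 1
∑-count-one _≟_ xs once P? py unique =
  trans (∑-cong xs λ x → sym (ℕ.*-identityʳ (𝟙 (P? x)))) (∑-only _≟_ xs once P? py unique (λ _ → 1))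

allFin-once : ∀ n (i : Fin n) → OccursOnce Fin._≟_ (List.allFin n) i
allFin-once (suc n) zero = trans (∑-allFin n λ i → 𝟙 (i Fin.≟ zero))
  (cong suc (∑-zero (List.allFin n) λ i → 𝟙-no (suc i Fin.≟ zero) λ ()))
allFin-once (suc n) (suc i) = trans (∑-allFin n λ j → 𝟙 (j Fin.≟ suc i))
  (trans (∑-cong (List.allFin n) λ j → 𝟙-cong (suc j Fin.≟ suc i) (j Fin.≟ i) Fin.suc-injective (cong suc))
    (allFin-once n i))

vectors-once : (_≟_ : DecidableEquality A) (xs : List A) (v : Vec A k) →
  (∀ i → OccursOnce _≟_ xs (lookup v i)) → OccursOnce (Vec.≡-dec _≟_) (vectors xs k) v
vectors-once _≟_ xs []      once = refl
vectors-once {k = suc k} _≟_ xs (y ∷ v) once = begin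
  ∑ (vectors xs (suc k)) (λ w → 𝟙 (Vec.≡-dec _≟_ w (y ∷ v)))
    ≡⟨ ∑-vectors xs k _ ⟩
  (∑[ x ← xs ] ∑[ w ← vectors xs k ] 𝟙 (Vec.≡-dec _≟_ (x ∷ w) (y ∷ v)))
    ≡⟨ (∑-cong xs λ x → ∑-cong (vectors xs k) λ w →
        trans (𝟙-cong (Vec.≡-dec _≟_ (x ∷ w) (y ∷ v)) ((x ≟ y) ×-dec Vec.≡-dec _≟_ w v)
                 Vec.∷-injective (λ (p , q) → cong₂ _∷_ p q))
              (𝟙-× (x ≟ y) (Vec.≡-dec _≟_ w v))) ⟩
  (∑[ x ← xs ] ∑[ w ← vectors xs k ] 𝟙 (x ≟ y) * 𝟙 (Vec.≡-dec _≟_ w v))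
    ≡⟨ (∑-cong xs λ x → trans (∑-*ˡ (vectors xs k) (𝟙 (x ≟ y)) _)
        (cong (𝟙 (x ≟ y) *_) (vectors-once _≟_ xs v (once ∘ suc)))) ⟩
  (∑[ x ← xs ] 𝟙 (x ≟ y) * 1)
    ≡⟨ ∑-*ʳ xs 1 (λ x → 𝟙 (x ≟ y)) ⟩
  (∑[ x ← xs ] 𝟙 (x ≟ y)) * 1
    ≡⟨ cong (_* 1) (once zero) ⟩
  1 ∎
  where open ≡-Reasoning

infix 4 _≟ˢ_
_≟ˢ_ : DecidableEquality (Subset n)
_≟ˢ_ = Vec.≡-dec Bool._≟_

subsets-once : (X : Subset n) → OccursOnce _≟ˢ_ (subsets n) X
subsets-once X = vectors-once Bool._≟_ _ X λ i → bools (lookup X i)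
  where
  bools : ∀ b → OccursOnce Bool._≟_ (true ∷ false ∷ []) b
  bools true  = refl
  bools false = refl

∣X∣≡∑ : (X : Subset n) → ∣ X ∣ ≡ ∑[ x ← List.allFin n ] 𝟙 (x ∈? X)
∣X∣≡∑ []              = refl
∣X∣≡∑ {suc n} (b ∷ X) = trans (lemma b) (sym (∑-allFin n _))
  where
  tail : ∀ b → ∣ X ∣ ≡ ∑[ x ← List.allFin n ] 𝟙 (suc x ∈? (b ∷ X))
  tail b = trans (∣X∣≡∑ X)
    (∑-cong (List.allFin n) λ x → 𝟙-cong (x ∈? X) (suc x ∈? (b ∷ X)) there drop-there)
  lemma : ∀ b → ∣ b ∷ X ∣ ≡ 𝟙 (zero ∈? (b ∷ X)) + (∑[ x ← List.allFin n ] 𝟙 (suc x ∈? (b ∷ X)))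
  lemma outside = tail outside
  lemma inside  = cong suc (tail inside)

-- Closure and covers in a matroid

⟪_⟫ : {P : Pred (Fin n) 0ℓ} → Decidable P → Subset n
⟪ P? ⟫ = Vec.tabulate (does ∘ P?)

module _ {P : Pred (Fin n) 0ℓ} (P? : Decidable P) where

  ∈⟪⟫⁺ : ∀ {x} → P x → x ∈ ⟪ P? ⟫
  ∈⟪⟫⁺ {x} p with P? x in eq
  ... | yes _ = Vec.lookup⇒[]= x _ (trans (Vec.lookup∘tabulate _ x) (cong does eq))
  ... | no ¬p = ⊥-elim (¬p p)

  ∈⟪⟫⁻ : ∀ {x} → x ∈ ⟪ P? ⟫ → P x
  ∈⟪⟫⁻ {x} x∈ with P? x in eq
  ... | yes p = p
  ... | no ¬p with trans (sym (cong does eq)) (trans (sym (Vec.lookup∘tabulate _ x)) (Vec.[]=⇒lookup x∈))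
  ... | ()

∈─⁻ : ∀ (X Y : Subset n) {x} → x ∈ X ─ Y → x ∉ Y
∈─⁻ (b ∷ X) (outside ∷ Y) (there x∈) (there x∈Y) = ∈─⁻ X Y x∈ x∈Y
∈─⁻ (b ∷ X) (inside  ∷ Y) (there x∈) (there x∈Y) = ∈─⁻ X Y x∈ x∈Y

∪⁅⁆-least : ∀ {X Y : Subset n} {x} → X ⊆ Y → x ∈ Y → X ∪ ⁅ x ⁆ ⊆ Y
∪⁅⁆-least {X = X} {x = x} X⊆Y x∈Y y∈ with x∈p∪q⁻ X ⁅ x ⁆ y∈
... | inj₁ y∈X = X⊆Y y∈X
... | inj₂ y∈x = subst (_∈ _) (sym (x∈⁅y⁆⇒x≡y x y∈x)) x∈Y

x∈X∪⁅x⁆ : (X : Subset n) (x : Fin n) → x ∈ X ∪ ⁅ x ⁆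
x∈X∪⁅x⁆ X x = x∈p∪q⁺ (inj₂ (x∈⁅x⁆ x))

subset-induction : (P : Subset n → Set) → P ⊥ → (∀ X x → x ∉ X → P X → P (X ∪ ⁅ x ⁆)) → ∀ X → P X
subset-induction {zero}  P P⊥ step []            = P⊥
subset-induction {suc n} P P⊥ step (outside ∷ X) = subset-induction (P ∘ (outside ∷_)) P⊥
  (λ Y y y∉Y → step (outside ∷ Y) (suc y) (y∉Y ∘ drop-there)) X
subset-induction {suc n} P P⊥ step (inside ∷ X)  = subset-induction (P ∘ (inside ∷_))
  -- The first element is adjoined to `⊥` before all others; the tail of `⊥ ∪ ⁅ zero ⁆` is `⊥ ∪ ⊥`,
  -- whence the rewriting.
  (subst (P ∘ (inside ∷_)) (∪-identityʳ ⊥) (step ⊥ zero (λ ()) P⊥))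
  (λ Y y y∉Y → step (inside ∷ Y) (suc y) (y∉Y ∘ drop-there)) X

∣X∪⁅x⁆∣ : (X : Subset n) (x : Fin n) → x ∉ X → ∣ X ∪ ⁅ x ⁆ ∣ ≡ suc ∣ X ∣
∣X∪⁅x⁆∣ (inside  ∷ X) zero    x∉ = ⊥-elim (x∉ here)
∣X∪⁅x⁆∣ (outside ∷ X) zero    x∉ = cong (suc ∘ ∣_∣) (∪-identityʳ X)
∣X∪⁅x⁆∣ (inside  ∷ X) (suc x) x∉ = cong suc (∣X∪⁅x⁆∣ X x (x∉ ∘ there))
∣X∪⁅x⁆∣ (outside ∷ X) (suc x) x∉ = ∣X∪⁅x⁆∣ X x (x∉ ∘ there)

∣Y∣+∣X─Y∣ : {X Y : Subset n} → Y ⊆ X → ∣ Y ∣ + ∣ X ─ Y ∣ ≡ ∣ X ∣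
∣Y∣+∣X─Y∣ {X = []}          {[]}          Y⊆X = refl
∣Y∣+∣X─Y∣ {X = inside ∷ X}  {inside ∷ Y}  Y⊆X = cong suc (∣Y∣+∣X─Y∣ (drop-there ∘ Y⊆X ∘ there))
∣Y∣+∣X─Y∣ {X = inside ∷ X}  {outside ∷ Y} Y⊆X = trans (ℕ.+-suc _ _) (cong suc (∣Y∣+∣X─Y∣ (drop-there ∘ Y⊆X ∘ there)))
∣Y∣+∣X─Y∣ {X = outside ∷ X} {inside ∷ Y}  Y⊆X with Y⊆X here
... | ()
∣Y∣+∣X─Y∣ {X = outside ∷ X} {outside ∷ Y} Y⊆X = ∣Y∣+∣X─Y∣ (drop-there ∘ Y⊆X ∘ there)

module MatroidProperties {n r : ℕ} (M : Matroid n r) where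

  private
    ρ : Subset n → ℕ
    ρ = rank M

  infixl 6 _▹_
  _▹_ : Subset n → Fin n → Subset n
  X ▹ x = X ∪ ⁅ x ⁆

  rank-mono : ∀ {X Y} → X ⊆ Y → ρ X ≤ ρ Y
  rank-mono {X} {Y} = monotone M X Y

  rank-⊥ : ρ ⊥ ≡ 0
  rank-⊥ = ℕ.n≤0⇒n≡0 (subst (ρ ⊥ ≤_) (∣⊥∣≡0 n) (rank≤size M ⊥))

  rank≤r : ∀ X → ρ X ≤ r
  rank≤r X = subst (ρ X ≤_) (rank-full M) (rank-mono X⊆full)
    where
    X⊆full : X ⊆ full
    X⊆full _ = ∈⊤

  submodular-≤ : ∀ X Y Z W → Z ⊆ X → Z ⊆ Y → W ⊆ X ∪ Y → ρ W + ρ Z ≤ ρ X + ρ Y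
  submodular-≤ X Y Z W Z⊆X Z⊆Y W⊆ = ℕ.≤-trans
    (ℕ.+-mono-≤ (rank-mono W⊆) (rank-mono λ z∈ → x∈p∩q⁺ (Z⊆X z∈ , Z⊆Y z∈))) (submodular M X Y)

  rank-▹≤ : ∀ X x → ρ (X ▹ x) ≤ suc (ρ X)
  rank-▹≤ X x = begin
    ρ (X ▹ x)            ≤⟨ ℕ.m≤m+n _ _ ⟩
    ρ (X ▹ x) + ρ (X ∩ ⁅ x ⁆) ≤⟨ submodular M X ⁅ x ⁆ ⟩
    ρ X + ρ ⁅ x ⁆        ≤⟨ ℕ.+-monoʳ-≤ (ρ X) (subst (ρ ⁅ x ⁆ ≤_) (∣⁅x⁆∣≡1 x) (rank≤size M ⁅ x ⁆)) ⟩
    ρ X + 1              ≡⟨ ℕ.+-comm (ρ X) 1 ⟩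
    suc (ρ X)            ∎
    where open ℕ.≤-Reasoning

  rank-▹-dichotomy : ∀ X x → ρ (X ▹ x) ≡ ρ X ⊎ ρ (X ▹ x) ≡ suc (ρ X)
  rank-▹-dichotomy X x with ρ (X ▹ x) ℕ.≟ ρ X
  ... | yes eq = inj₁ eq
  ... | no neq = inj₂ (ℕ.≤-antisym (rank-▹≤ X x) (ℕ.≤∧≢⇒< (rank-mono (p⊆p∪q ⁅ x ⁆)) (neq ∘ sym)))

  cl? : ∀ X x → Dec (ρ (X ▹ x) ≡ ρ X)
  cl? X x = ρ (X ▹ x) ℕ.≟ ρ X

  cl : Subset n → Subset n
  cl X = ⟪ cl? X ⟫

  ∈cl⁺ : ∀ {X x} → ρ (X ▹ x) ≡ ρ X → x ∈ cl X
  ∈cl⁺ {X} = ∈⟪⟫⁺ (cl? X)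

  ∈cl⁻ : ∀ {X x} → x ∈ cl X → ρ (X ▹ x) ≡ ρ X
  ∈cl⁻ {X} = ∈⟪⟫⁻ (cl? X)

  rank-▹-∉cl : ∀ {X x} → x ∉ cl X → ρ (X ▹ x) ≡ suc (ρ X)
  rank-▹-∉cl {X} {x} x∉ = [ ⊥-elim ∘ x∉ ∘ ∈cl⁺ , id ]′ (rank-▹-dichotomy X x)

  ⊆cl : ∀ X → X ⊆ cl X
  ⊆cl X {x} x∈X = ∈cl⁺ (ℕ.≤-antisym (rank-mono (∪⁅⁆-least id x∈X)) (rank-mono (p⊆p∪q ⁅ x ⁆)))

  -- Elements of `cl X` are adjoined one at a time: `X ∪ V` and `X ▹ x` both contain `X` and have
  -- its rank, so by submodularity their union has that rank too.
  rank-∪-⊆cl : ∀ X V → V ⊆ cl X → ρ (X ∪ V) ≡ ρ X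
  rank-∪-⊆cl X = subset-induction (λ V → V ⊆ cl X → ρ (X ∪ V) ≡ ρ X)
    (λ _ → cong ρ (∪-identityʳ X))
    λ V x _ IH Vx⊆ → ℕ.≤-antisym (step V x (IH (Vx⊆ ∘ p⊆p∪q ⁅ x ⁆)) (∈cl⁻ (Vx⊆ (x∈X∪⁅x⁆ V x)))) (rank-mono (p⊆p∪q _))
    where
    step : ∀ V x → ρ (X ∪ V) ≡ ρ X → ρ (X ▹ x) ≡ ρ X → ρ (X ∪ (V ▹ x)) ≤ ρ X
    step V x eqV eqx = ℕ.+-cancelʳ-≤ (ρ X) _ _ (begin
      ρ (X ∪ (V ▹ x)) + ρ X   ≤⟨ submodular-≤ (X ∪ V) (X ▹ x) X _ (p⊆p∪q V) (p⊆p∪q ⁅ x ⁆) incl ⟩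
      ρ (X ∪ V) + ρ (X ▹ x)   ≡⟨ cong₂ _+_ eqV eqx ⟩
      ρ X + ρ X               ∎)
      where
      open ℕ.≤-Reasoning
      incl : X ∪ (V ▹ x) ⊆ (X ∪ V) ∪ (X ▹ x)
      incl y∈ with x∈p∪q⁻ X _ y∈
      ... | inj₁ y∈X  = p⊆p∪q _ (p⊆p∪q V y∈X)
      ... | inj₂ y∈Vx with x∈p∪q⁻ V _ y∈Vx
      ... | inj₁ y∈V = p⊆p∪q _ (q⊆p∪q X V y∈V)
      ... | inj₂ y∈x = q⊆p∪q (X ∪ V) _ (q⊆p∪q X _ y∈x)

  rank-cl : ∀ X → ρ (cl X) ≡ ρ X
  rank-cl X = ℕ.≤-antisym
    (ℕ.≤-trans (rank-mono (q⊆p∪q X _)) (ℕ.≤-reflexive (rank-∪-⊆cl X (cl X) id)))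
    (rank-mono (⊆cl X))

  cl-flat : ∀ X → IsFlat M (cl X)
  cl-flat X x x∉ = begin-strict
    ρ (cl X)     ≡⟨ rank-cl X ⟩
    ρ X          <⟨ ℕ.n<1+n (ρ X) ⟩
    suc (ρ X)    ≡⟨ rank-▹-∉cl x∉ ⟨
    ρ (X ▹ x)    ≤⟨ rank-mono (∪⁅⁆-least (p⊆p∪q ⁅ x ⁆ ∘ ⊆cl X) (x∈X∪⁅x⁆ (cl X) x)) ⟩
    ρ (cl X ▹ x) ∎
    where open ℕ.≤-Reasoning

  -- By submodularity an element raises the rank of `Y` by no more than that of its subset `X`,
  -- whereas an element outside a flat does raise its rank.
  cl-least : ∀ {X Y} → IsFlat M Y → X ⊆ Y → cl X ⊆ Y
  cl-least {X} {Y} flat X⊆Y {x} x∈cl = decidable-stable (x ∈? Y) λ x∉Y →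
    ℕ.<⇒≱ (flat x x∉Y) (ℕ.+-cancelʳ-≤ (ρ X) _ _ (begin
      ρ (Y ▹ x) + ρ X ≤⟨ submodular-≤ Y (X ▹ x) X _ X⊆Y (p⊆p∪q ⁅ x ⁆)
                          (∪⁅⁆-least (p⊆p∪q _) (q⊆p∪q Y _ (x∈X∪⁅x⁆ X x))) ⟩
      ρ Y + ρ (X ▹ x) ≡⟨ cong (ρ Y +_) (∈cl⁻ x∈cl) ⟩
      ρ Y + ρ X       ∎))
    where open ℕ.≤-Reasoning

  flat-rank-≤⇒⊇ : ∀ {X Y} → IsFlat M X → X ⊆ Y → ρ Y ≤ ρ X → Y ⊆ X
  flat-rank-≤⇒⊇ {X} {Y} flat X⊆Y ρY≤ {y} y∈Y = decidable-stable (y ∈? X) λ y∉X →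
    ℕ.<⇒≱ (flat y y∉X) (ℕ.≤-trans (rank-mono (∪⁅⁆-least X⊆Y y∈Y)) ρY≤)

  flat-⊆-rank≡⇒≡ : ∀ {X Y} → IsFlat M X → X ⊆ Y → ρ X ≡ ρ Y → X ≡ Y
  flat-⊆-rank≡⇒≡ flat X⊆Y eq = ⊆-antisym X⊆Y (flat-rank-≤⇒⊇ flat X⊆Y (ℕ.≤-reflexive (sym eq)))

  cl-of-flat : ∀ {X Y} → IsFlat M Y → X ⊆ Y → ρ X ≡ ρ Y → cl X ≡ Y
  cl-of-flat {X} flat X⊆Y eq = flat-⊆-rank≡⇒≡ (cl-flat X) (cl-least flat X⊆Y) (trans (rank-cl X) eq)

  flat-of-rank-r : ∀ {X} → IsFlat M X → ρ X ≡ r → X ≡ full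
  flat-of-rank-r flat eq = flat-⊆-rank≡⇒≡ flat (λ _ → ∈⊤) (trans eq (sym (rank-full M)))

  Covers : Subset n → Subset n → Set
  Covers X Y = IsFlat M Y × ρ Y ≡ suc (ρ X) × X ⊆ Y

  covers? : ∀ X Y → Dec (Covers X Y)
  covers? X Y = isFlat? M Y ×-dec (ρ Y ℕ.≟ suc (ρ X)) ×-dec (X ⊆? Y)

  covers-cl : ∀ {X x} → IsFlat M X → x ∉ X → Covers X (cl (X ▹ x))
  covers-cl {X} {x} flat x∉X = cl-flat _ ,
    trans (rank-cl _) (ℕ.≤-antisym (rank-▹≤ X x) (flat x x∉X)) , ⊆cl _ ∘ p⊆p∪q ⁅ x ⁆

  covers-unique : ∀ {X Y x} → IsFlat M X → Covers X Y → x ∈ Y → x ∉ X → Y ≡ cl (X ▹ x)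
  covers-unique {X} {Y} {x} flat (flatY , ρY , X⊆Y) x∈Y x∉X =
    sym (cl-of-flat flatY (∪⁅⁆-least X⊆Y x∈Y)
      (trans (ℕ.≤-antisym (rank-▹≤ X x) (flat x x∉X)) (sym ρY)))

  -- The sets Y ─ X, for Y covering the flat X, partition the complement of X.
  covers-partition : ∀ {X} → IsFlat M X → (h : Subset n → ℕ) →
    (∑[ x ← List.allFin n ] 𝟙 (¬? (x ∈? X)) * h (cl (X ▹ x))) ≡
    (∑[ Y ← subsets n ] 𝟙 (covers? X Y) * (∣ Y ─ X ∣ * h Y))
  covers-partition {X} flat h = begin
    (∑[ x ← xs ] 𝟙 (¬? (x ∈? X)) * h (cl (X ▹ x)))
      ≡⟨ (∑-cong xs λ x → 𝟙-guard (¬? (x ∈? X)) λ x∉X → sym (∑-only _≟ˢ_ (subsets n) (subsets-once (cl (X ▹ x)))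
          (λ Y → covers? X Y ×-dec (x ∈? (Y ─ X)))
          (covers-cl flat x∉X , x∈p∧x∉q⇒x∈p─q (⊆cl _ (x∈X∪⁅x⁆ X x)) x∉X)
          (λ Y (c , x∈) → covers-unique flat c (p─q⊆p Y X x∈) x∉X) h)) ⟩
    (∑[ x ← xs ] 𝟙 (¬? (x ∈? X)) * (∑[ Y ← subsets n ] 𝟙 (covers? X Y ×-dec (x ∈? (Y ─ X))) * h Y))
      ≡⟨ (∑-cong xs λ x → sym (∑-*ˡ (subsets n) (𝟙 (¬? (x ∈? X))) _)) ⟩
    (∑[ x ← xs ] ∑[ Y ← subsets n ] 𝟙 (¬? (x ∈? X)) * (𝟙 (covers? X Y ×-dec (x ∈? (Y ─ X))) * h Y))
      ≡⟨ (∑-cong xs λ x → ∑-cong (subsets n) (summand x)) ⟩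
    (∑[ x ← xs ] ∑[ Y ← subsets n ] 𝟙 (x ∈? (Y ─ X)) * (𝟙 (covers? X Y) * h Y))
      ≡⟨ ∑-swap xs (subsets n) _ ⟩
    (∑[ Y ← subsets n ] ∑[ x ← xs ] 𝟙 (x ∈? (Y ─ X)) * (𝟙 (covers? X Y) * h Y))
      ≡⟨ (∑-cong (subsets n) λ Y → trans (∑-*ʳ xs (𝟙 (covers? X Y) * h Y) _) (trans (cong (_* (𝟙 (covers? X Y) * h Y)) (sym (∣X∣≡∑ (Y ─ X))))
          (x∙yz≈y∙xz ∣ Y ─ X ∣ (𝟙 (covers? X Y)) (h Y)))) ⟩
    (∑[ Y ← subsets n ] 𝟙 (covers? X Y) * (∣ Y ─ X ∣ * h Y)) ∎
    where
    open ≡-Reasoning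
    xs = List.allFin n
    summand : ∀ x Y → 𝟙 (¬? (x ∈? X)) * (𝟙 (covers? X Y ×-dec (x ∈? (Y ─ X))) * h Y) ≡
      𝟙 (x ∈? (Y ─ X)) * (𝟙 (covers? X Y) * h Y)
    summand x Y with x ∈? (Y ─ X)
    ... | no x∉   = trans (cong (λ z → 𝟙 (¬? (x ∈? X)) * (z * h Y)) (trans (𝟙-× (covers? X Y) (no x∉)) (ℕ.*-zeroʳ (𝟙 (covers? X Y)))))
      (ℕ.*-zeroʳ (𝟙 (¬? (x ∈? X))))
    ... | yes x∈  = cong₂ _*_ (𝟙-yes (¬? (x ∈? X)) (∈─⁻ Y X x∈)) (cong (_* h Y) (trans (𝟙-× (covers? X Y) (yes x∈)) (ℕ.*-identityʳ (𝟙 (covers? X Y)))))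

-- Flags and catenary data

module Chains {n r : ℕ} (M : Matroid n r) where
  open MatroidProperties M

  -- The weight is arbitrary because the recursion absorbs each increment into it. The same sum then
  -- serves for flags, for orderings and for cones.
  chainSum : Subset n → (t : ℕ) → (Vec ℕ t → ℕ) → ℕ
  chainSum X zero    h = h []
  chainSum X (suc t) h = ∑[ Y ← subsets n ] 𝟙 (covers? X Y) * chainSum Y t (λ v → h (∣ Y ─ X ∣ ∷ v))

  chainSum-cong : ∀ X t {h h′} → (∀ v → h v ≡ h′ v) → chainSum X t h ≡ chainSum X t h′
  chainSum-cong X zero    eq = eq []
  chainSum-cong X (suc t) eq = ∑-cong (subsets n) λ Y →
    cong (𝟙 (covers? X Y) *_) (chainSum-cong Y t λ v → eq _)

  chainSum-*ˡ : ∀ X t c h → chainSum X t (λ v → c * h v) ≡ c * chainSum X t h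
  chainSum-*ˡ X zero    c h = refl
  chainSum-*ˡ X (suc t) c h = trans
    (∑-cong (subsets n) λ Y → trans
      (cong (𝟙 (covers? X Y) *_) (chainSum-*ˡ Y t c λ v → h (∣ Y ─ X ∣ ∷ v)))
      (x∙yz≈y∙xz (𝟙 (covers? X Y)) c _))
    (∑-*ˡ (subsets n) c λ Y → 𝟙 (covers? X Y) * chainSum Y t λ v → h (∣ Y ─ X ∣ ∷ v))

  chainSum-+ : ∀ X t h h′ → chainSum X t (λ v → h v + h′ v) ≡ chainSum X t h + chainSum X t h′
  chainSum-+ X zero    h h′ = refl
  chainSum-+ X (suc t) h h′ = trans
    (∑-cong (subsets n) λ Y → trans
      (cong (𝟙 (covers? X Y) *_) (chainSum-+ Y t (λ v → h (∣ Y ─ X ∣ ∷ v)) (λ v → h′ (∣ Y ─ X ∣ ∷ v))))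
      (ℕ.*-distribˡ-+ (𝟙 (covers? X Y)) _ _))
    (∑-+ (subsets n) (λ Y → 𝟙 (covers? X Y) * chainSum Y t λ v → h (∣ Y ─ X ∣ ∷ v)) _)

  Chain : Subset n → Vec (Subset n) t → Set
  Chain X []       = Unit
  Chain X (Y ∷ Ys) = Covers X Y × Chain Y Ys

  chain? : ∀ X (Ys : Vec (Subset n) t) → Dec (Chain X Ys)
  chain? X []       = yes tt
  chain? X (Y ∷ Ys) = covers? X Y ×-dec chain? Y Ys

  chainSum≡∑ : ∀ X t h →
    (∑[ Ys ← vectors (subsets n) t ] 𝟙 (chain? X Ys) * h (increments X Ys)) ≡ chainSum X t h
  chainSum≡∑ X zero    h = trans (ℕ.+-identityʳ _) (ℕ.*-identityˡ _)
  chainSum≡∑ X (suc t) h = begin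
    (∑[ Ys ← vectors (subsets n) (suc t) ] 𝟙 (chain? X Ys) * h (increments X Ys))
      ≡⟨ ∑-vectors (subsets n) t _ ⟩
    (∑[ Y ← subsets n ] ∑[ Ys ← vectors (subsets n) t ]
      𝟙 (covers? X Y ×-dec chain? Y Ys) * h (∣ Y ─ X ∣ ∷ increments Y Ys))
      ≡⟨ (∑-cong (subsets n) λ Y → trans
           (∑-cong (vectors (subsets n) t) λ Ys → trans
             (cong (_* h (∣ Y ─ X ∣ ∷ increments Y Ys)) (𝟙-× (covers? X Y) (chain? Y Ys)))
             (ℕ.*-assoc (𝟙 (covers? X Y)) (𝟙 (chain? Y Ys)) _))
           (trans (∑-*ˡ (vectors (subsets n) t) (𝟙 (covers? X Y)) _)
             (cong (𝟙 (covers? X Y) *_) (chainSum≡∑ Y t (λ v → h (∣ Y ─ X ∣ ∷ v)))))) ⟩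
    chainSum X (suc t) h ∎
    where open ≡-Reasoning

  covers⇒⊂ : ∀ {X Y} → Covers X Y → X ⊂ Y
  covers⇒⊂ {X} {Y} (_ , ρY , X⊆Y) = decidable-stable (X ⊂? Y) λ X⊄Y →
    ℕ.<⇒≱ (ℕ.≤-reflexive (sym ρY)) (rank-mono λ {y} y∈Y →
      decidable-stable (y ∈? X) λ y∉X → X⊄Y (X⊆Y , y , y∈Y , y∉X))

  Levels : ℕ → Subset n → Vec (Subset n) t → Set
  Levels {t} k X Xs =
      (∀ j → IsFlat M (lookup (X ∷ Xs) j))
    × (∀ j → rank M (lookup (X ∷ Xs) j) ≡ k + toℕ j)
    × (∀ (j : Fin t) → lookup (X ∷ Xs) (inject₁ j) ⊂ lookup Xs j)

  levels⇒chain : ∀ k X (Xs : Vec (Subset n) t) → Levels k X Xs → Chain X Xs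
  levels⇒chain k X []       _ = tt
  levels⇒chain k X (Y ∷ Ys) (flats , ranks , incl) =
    (flats (suc zero) , trans (ranks (suc zero)) (trans (ℕ.+-suc k 0) (cong suc (sym (ranks zero)))) , proj₁ (incl zero)) ,
    levels⇒chain (suc k) Y Ys
      ((flats ∘ suc) , (λ j → trans (ranks (suc j)) (ℕ.+-suc k (toℕ j))) , (incl ∘ suc))

  chain⇒levels : ∀ k X (Xs : Vec (Subset n) t) → IsFlat M X → rank M X ≡ k → Chain X Xs → Levels k X Xs
  chain⇒levels k X []       flat eq _ =
    (λ { zero → flat }) , (λ { zero → trans eq (sym (ℕ.+-identityʳ k)) }) , λ ()
  chain⇒levels k X (Y ∷ Ys) flat eq (c@(flatY , ρY , _) , chain) =
    let flats , ranks , incl = chain⇒levels (suc k) Y Ys flatY (trans ρY (cong suc eq)) chain in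
    (λ { zero → flat ; (suc j) → flats j }) ,
    (λ { zero → trans eq (sym (ℕ.+-identityʳ k)) ; (suc j) → trans (ranks j) (sym (ℕ.+-suc k (toℕ j))) }) ,
    (λ { zero → covers⇒⊂ c ; (suc j) → incl j })

  -- The bottom of a flag is forced, a flat of rank 0 being the closure of `⊥`. In the converse the
  -- top comes for free, a flat of rank `r` being full.
  flag⇒chain : ∀ X (Xs : Vec (Subset n) r) → IsFlag M (X ∷ Xs) → X ≡ cl ⊥ × Chain X Xs
  flag⇒chain X Xs (flats , ranks , incl , _) =
    sym (cl-of-flat (flats zero) (⊆-min X) (trans rank-⊥ (sym (ranks zero)))) ,
    levels⇒chain 0 X Xs (flats , ranks , incl)

  chain⇒flag : ∀ X (Xs : Vec (Subset n) r) → X ≡ cl ⊥ × Chain X Xs → IsFlag M (X ∷ Xs)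
  chain⇒flag X Xs (refl , chain) =
    let flats , ranks , incl = chain⇒levels 0 X Xs (cl-flat ⊥) (trans (rank-cl ⊥) rank-⊥) chain in
    flats , ranks , incl , flat-of-rank-r (flats (fromℕ r)) (trans (ranks (fromℕ r)) (Fin.toℕ-fromℕ r))

flagSum : Matroid n r → (Vec ℕ (suc r) → ℕ) → ℕ
flagSum {n} {r} M h = ∑[ X ← vectors (subsets n) (suc r) ] 𝟙 (isFlag? M X) * h (flagComposition X)

flagSum≡chainSum : (M : Matroid n r) (h : Vec ℕ (suc r) → ℕ) →
  let open MatroidProperties M; open Chains M in
  flagSum M h ≡ chainSum (cl ⊥) r (λ v → h (∣ cl ⊥ ∣ ∷ v))
flagSum≡chainSum {n} {r} M h = begin
  flagSum M h
    ≡⟨ ∑-vectors (subsets n) r _ ⟩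
  (∑[ X ← subsets n ] ∑[ Xs ← vectors (subsets n) r ] 𝟙 (isFlag? M (X ∷ Xs)) * h (∣ X ∣ ∷ increments X Xs))
    ≡⟨ (∑-cong (subsets n) λ X → trans
         (∑-cong (vectors (subsets n) r) λ Xs → trans
           (cong (_* h (∣ X ∣ ∷ increments X Xs)) (trans
             (𝟙-cong (isFlag? M (X ∷ Xs)) ((X ≟ˢ cl ⊥) ×-dec chain? X Xs) (flag⇒chain X Xs) (chain⇒flag X Xs))
             (𝟙-× (X ≟ˢ cl ⊥) (chain? X Xs))))
           (ℕ.*-assoc (𝟙 (X ≟ˢ cl ⊥)) (𝟙 (chain? X Xs)) _))
         (trans (∑-*ˡ (vectors (subsets n) r) (𝟙 (X ≟ˢ cl ⊥)) _)
           (cong (𝟙 (X ≟ˢ cl ⊥) *_) (chainSum≡∑ X r (λ v → h (∣ X ∣ ∷ v)))))) ⟩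
  (∑[ X ← subsets n ] 𝟙 (X ≟ˢ cl ⊥) * chainSum X r (λ v → h (∣ X ∣ ∷ v)))
    ≡⟨ ∑-only _≟ˢ_ (subsets n) (subsets-once (cl ⊥)) (_≟ˢ cl ⊥) refl (λ _ eq → eq) _ ⟩
  chainSum (cl ⊥) r (λ v → h (∣ cl ⊥ ∣ ∷ v)) ∎
  where
  open ≡-Reasoning
  open MatroidProperties M
  open Chains M

IsComposition : ∀ n → Vec ℕ (suc r) → Set
IsComposition {r} n a = (∀ (j : Fin r) → 0 < lookup a (suc j)) × Vec.sum a ≡ n

isComposition? : ∀ n (a : Vec ℕ (suc r)) → Dec (IsComposition n a)
isComposition? n a = (Fin.all? λ j → 0 ℕ.<? lookup a (suc j)) ×-dec (Vec.sum a ℕ.≟ n)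

⊂⇒∣─∣-positive : {X Y : Subset n} → X ⊂ Y → 0 < ∣ Y ─ X ∣
⊂⇒∣─∣-positive {X = X} {Y} X⊂Y = ℕ.+-cancelˡ-< (∣ X ∣) 0 _
  (subst₂ _<_ (sym (ℕ.+-identityʳ ∣ X ∣)) (sym (∣Y∣+∣X─Y∣ (proj₁ X⊂Y))) (p⊂q⇒∣p∣<∣q∣ X⊂Y))

increments-positive : ∀ X (Xs : Vec (Subset n) t) →
  (∀ (j : Fin t) → lookup (X ∷ Xs) (inject₁ j) ⊂ lookup Xs j) → ∀ j → 0 < lookup (increments X Xs) j
increments-positive X (Y ∷ Ys) incl zero    = ⊂⇒∣─∣-positive (incl zero)
increments-positive X (Y ∷ Ys) incl (suc j) = increments-positive Y Ys (incl ∘ suc) j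

sum-increments : ∀ X (Xs : Vec (Subset n) t) →
  (∀ (j : Fin t) → lookup (X ∷ Xs) (inject₁ j) ⊂ lookup Xs j) →
  ∣ X ∣ + Vec.sum (increments X Xs) ≡ ∣ lookup (X ∷ Xs) (fromℕ t) ∣
sum-increments X []       incl = ℕ.+-identityʳ ∣ X ∣
sum-increments X (Y ∷ Ys) incl = trans (sym (ℕ.+-assoc (∣ X ∣) (∣ Y ─ X ∣) _))
  (trans (cong (_+ Vec.sum (increments Y Ys)) (∣Y∣+∣X─Y∣ (proj₁ (incl zero)))) (sum-increments Y Ys (incl ∘ suc)))

flagComposition-isComposition : (M : Matroid n r) (X : Vec (Subset n) (suc r)) → IsFlag M X →
  IsComposition n (flagComposition X)
flagComposition-isComposition {n} M (X ∷ Xs) (_ , _ , incl , last) =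
  increments-positive X Xs incl , trans (sum-increments X Xs incl) (trans (cong ∣_∣ last) (∣⊤∣≡n n))

flagComposition≤n : (X : Vec (Subset n) (suc r)) → ∀ j → lookup (flagComposition X) j < suc n
flagComposition≤n (X ∷ Xs) zero    = s≤s (∣p∣≤n X)
flagComposition≤n (X ∷ Xs) (suc j) = increments≤n X Xs j
  where
  increments≤n : ∀ X (Xs : Vec (Subset n) t) j → lookup (increments X Xs) j < suc n
  increments≤n X (Y ∷ Ys) zero    = s≤s (∣p∣≤n (Y ─ X))
  increments≤n X (Y ∷ Ys) (suc j) = increments≤n Y Ys j

numbers : ℕ → List ℕ
numbers n = List.map toℕ (List.allFin n)

numbers-once : ∀ {i n} → i < n → OccursOnce ℕ._≟_ (numbers n) i
numbers-once {i} {n} i<n = trans (∑-map toℕ (List.allFin n) (λ j → 𝟙 (j ℕ.≟ i)))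
  (∑-count-one Fin._≟_ (List.allFin n) (allFin-once n (fromℕ< i<n)) (λ j → toℕ j ℕ.≟ i)
    (Fin.toℕ-fromℕ< i<n) (λ j eq → Fin.toℕ-injective (trans eq (sym (Fin.toℕ-fromℕ< i<n)))))

-- A finite box containing the composition of every flag; `ν` vanishes at the vectors in it that are
-- not compositions.
candidates : ∀ n r → List (Vec ℕ (suc r))
candidates n r = vectors (numbers (suc n)) (suc r)

infix 4 _≟ᵛ_
_≟ᵛ_ : DecidableEquality (Vec ℕ k)
_≟ᵛ_ = Vec.≡-dec ℕ._≟_

ν≡∑ : (M : Matroid n r) (a : Vec ℕ (suc r)) →
  ν M a ≡ ∑[ X ← vectors (subsets n) (suc r) ] 𝟙 (isFlag? M X ×-dec (flagComposition X ≟ᵛ a))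
ν≡∑ {n} {r} M a = trans (length≡∑ (List.filter P? Xs)) (trans (∑-filter P? Xs (λ _ → 1))
  (∑-cong Xs λ X → ℕ.*-identityʳ (𝟙 (P? X))))
  where
  Xs = vectors (subsets n) (suc r)
  P? : ∀ X → Dec (IsFlag M X × flagComposition X ≡ a)
  P? X = isFlag? M X ×-dec (flagComposition X ≟ᵛ a)

-- Grouping the flags by composition shows that a weighted sum over flags depends on the matroid
-- through its catenary data alone. The cone formula and the count of orderings both rest on this.
flagSum-expand : (M : Matroid n r) (h : Vec ℕ (suc r) → ℕ) →
  flagSum M h ≡ ∑[ a ← candidates n r ] ν M a * h a
flagSum-expand {n} {r} M h = begin
  flagSum M h
    ≡⟨ (∑-cong Xs λ X → cong (𝟙 (isFlag? M X) *_) (sym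
         (∑-only _≟ᵛ_ as (vectors-once ℕ._≟_ (numbers (suc n)) (flagComposition X)
             (λ j → numbers-once (flagComposition≤n X j)))
           (λ a → flagComposition X ≟ᵛ a) refl (λ _ eq → sym eq) h))) ⟩
  (∑[ X ← Xs ] 𝟙 (isFlag? M X) * (∑[ a ← as ] 𝟙 (flagComposition X ≟ᵛ a) * h a))
    ≡⟨ (∑-cong Xs λ X → trans (sym (∑-*ˡ as (𝟙 (isFlag? M X)) _)) (∑-cong as λ a → trans
         (sym (ℕ.*-assoc (𝟙 (isFlag? M X)) (𝟙 (flagComposition X ≟ᵛ a)) (h a)))
         (cong (_* h a) (sym (𝟙-× (isFlag? M X) (flagComposition X ≟ᵛ a)))))) ⟩
  (∑[ X ← Xs ] ∑[ a ← as ] 𝟙 (isFlag? M X ×-dec (flagComposition X ≟ᵛ a)) * h a)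
    ≡⟨ ∑-swap Xs as _ ⟩
  (∑[ a ← as ] ∑[ X ← Xs ] 𝟙 (isFlag? M X ×-dec (flagComposition X ≟ᵛ a)) * h a)
    ≡⟨ (∑-cong as λ a → trans (∑-*ʳ Xs (h a) _) (cong (_* h a) (sym (ν≡∑ M a)))) ⟩
  (∑[ a ← as ] ν M a * h a) ∎
  where
  open ≡-Reasoning
  Xs = vectors (subsets n) (suc r)
  as = candidates n r

ν-nonComposition : (M : Matroid n r) (a : Vec ℕ (suc r)) → ¬ IsComposition n a → ν M a ≡ 0
ν-nonComposition {n} {r} M a ¬comp = trans (ν≡∑ M a) (∑-zero (vectors (subsets n) (suc r)) λ X →
  𝟙-no (isFlag? M X ×-dec (flagComposition X ≟ᵛ a))
    λ (flag , eq) → ¬comp (subst (IsComposition n) eq (flagComposition-isComposition M X flag)))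

-- A `Composition` carries proofs, so the data are extended to plain vectors before being summed
-- over `candidates`. The default 0 is the value of `ν` at a vector that is not a composition.
extend : CatenaryData n r → Vec ℕ (suc r) → ℕ
extend {n} v a with isComposition? n a
... | yes (pos , tot) = v record { parts = a ; positive = pos ; total = tot }
... | no _            = 0

extend-catenaryData : (M : Matroid n r) (a : Vec ℕ (suc r)) → extend (catenaryData M) a ≡ ν M a
extend-catenaryData {n} M a with isComposition? n a
... | yes _     = refl
... | no ¬comp = sym (ν-nonComposition M a ¬comp)

extend-cong : {v w : CatenaryData n r} → (∀ a → v a ≡ w a) → ∀ a → extend v a ≡ extend w a
extend-cong {n} eq a with isComposition? n a
... | yes _ = eq _
... | no _  = refl

-- Orderings and rank sequences

-- Number of ways to extend an ordering of m elements of a flat of size z by a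
-- sequence with rank sequence s, along a chain of flats with increments v.
completions : (z m : ℕ) → Vec ℕ t → Vec (Fin 2) l → ℕ
completions z m v       (zero ∷ s)     = (z ∸ m) * completions z (suc m) v s
completions z m []      []             = 1
completions z m (_ ∷ _) []             = 0
completions z m []      (suc zero ∷ s) = 0
completions z m (c ∷ v) (suc zero ∷ s) = c * completions (z + c) (suc m) v s

module Orderings {n r : ℕ} (M : Matroid n r) where
  open MatroidProperties M
  open Chains M

  -- Distinctness and the prescribed rank steps are both tested against the set `U` already placed,
  -- so that an ordering is built one element at a time.
  Extends : Subset n → Vec (Fin n) l → Vec (Fin 2) l → Set
  Extends U []      []      = Unit
  Extends U (x ∷ π) (b ∷ s) = (x ∉ U × rank M (U ▹ x) ≡ toℕ b + rank M U) × Extends (U ▹ x) π s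

  extends? : ∀ U (π : Vec (Fin n) l) s → Dec (Extends U π s)
  extends? U []      []      = yes tt
  extends? U (x ∷ π) (b ∷ s) =
    (¬? (x ∈? U) ×-dec (rank M (U ▹ x) ℕ.≟ toℕ b + rank M U)) ×-dec extends? (U ▹ x) π s

  extensionCount : Subset n → Vec (Fin 2) l → ℕ
  extensionCount {l} U s = ∑[ π ← vectors (List.allFin n) l ] 𝟙 (extends? U π s)

  extensionCount-∷ : ∀ U b (s : Vec (Fin 2) l) {P : Fin n → Set} (P? : Decidable P) (f : Fin n → ℕ) →
    (∀ {x} → x ∉ U × rank M (U ▹ x) ≡ toℕ b + rank M U → P x) →
    (∀ {x} → P x → x ∉ U × rank M (U ▹ x) ≡ toℕ b + rank M U) →
    (∀ {x} → P x → extensionCount (U ▹ x) s ≡ f x) →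
    extensionCount U (b ∷ s) ≡ ∑[ x ← List.allFin n ] 𝟙 (P? x) * f x
  extensionCount-∷ {l} U b s P? f to from eq = trans (∑-vectors (List.allFin n) l _)
    (∑-cong (List.allFin n) λ x → trans
      (trans
        (∑-cong (vectors (List.allFin n) l) λ π → 𝟙-× (step? x) (extends? (U ▹ x) π s))
        (∑-*ˡ (vectors (List.allFin n) l) (𝟙 (step? x)) _))
      (𝟙-cong-* (step? x) (P? x) to from (eq ∘ to)))
    where
    step? : ∀ x → Dec (x ∉ U × rank M (U ▹ x) ≡ toℕ b + rank M U)
    step? x = ¬? (x ∈? U) ×-dec (rank M (U ▹ x) ℕ.≟ toℕ b + rank M U)

  extensionCount≡chainSum : ∀ Y U (s : Vec (Fin 2) l) → IsFlat M Y → U ⊆ Y → rank M U ≡ rank M Y →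
    rank M Y + t ≡ r → ∣ U ∣ + l ≡ n →
    extensionCount U s ≡ chainSum Y t (λ v → completions (∣ Y ∣) (∣ U ∣) v s)
  extensionCount≡chainSum {t = t} Y U [] flat U⊆Y eq rank+t size = lemma t rank+t
    where
    -- With no elements left `U` is the whole ground set, so `Y` has rank `r` and `t` must be 0.
    rank≡r : rank M Y ≡ r
    rank≡r = trans (cong (rank M) (⊆-antisym (λ _ → ∈⊤)
      (subst (_⊆ Y) (∣p∣≡n⇒p≡⊤ (trans (sym (ℕ.+-identityʳ _)) size)) U⊆Y))) (rank-full M)
    lemma : ∀ t → rank M Y + t ≡ r → extensionCount U [] ≡ chainSum Y t (λ v → completions (∣ Y ∣) (∣ U ∣) v [])
    lemma zero    _  = refl
    lemma (suc t) eq with ℕ.+-cancelˡ-≡ (rank M Y) (suc t) 0 (trans eq (trans (sym rank≡r) (sym (ℕ.+-identityʳ _))))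
    ... | ()
  extensionCount≡chainSum {suc l} {t} Y U (zero ∷ s) flat U⊆Y eq rank+t size = begin
    extensionCount U (zero ∷ s)
      ≡⟨ extensionCount-∷ U zero s (_∈? (Y ─ U)) (λ _ → rest)
           (λ (x∉U , eqx) → x∈p∧x∉q⇒x∈p─q (cl-least flat U⊆Y (∈cl⁺ eqx)) x∉U)
           (λ x∈ → ∈─⁻ Y U x∈ , inY (p─q⊆p Y U x∈))
           (λ {x} x∈ → trans
             (extensionCount≡chainSum Y (U ▹ x) s flat (∪⁅⁆-least U⊆Y (p─q⊆p Y U x∈))
               (trans (inY (p─q⊆p Y U x∈)) eq) rank+t
               (trans (cong (_+ l) (∣X∪⁅x⁆∣ U x (∈─⁻ Y U x∈))) (trans (sym (ℕ.+-suc (∣ U ∣) l)) size)))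
             (chainSum-cong Y t λ v → cong (λ m → completions (∣ Y ∣) m v s) (∣X∪⁅x⁆∣ U x (∈─⁻ Y U x∈)))) ⟩
    (∑[ x ← List.allFin n ] 𝟙 (x ∈? (Y ─ U)) * rest)
      ≡⟨ ∑-*ʳ (List.allFin n) rest _ ⟩
    (∑[ x ← List.allFin n ] 𝟙 (x ∈? (Y ─ U))) * rest
      ≡⟨ cong (_* rest) (trans (sym (∣X∣≡∑ (Y ─ U))) (trans (sym (ℕ.m+n∸m≡n (∣ U ∣) (∣ Y ─ U ∣)))
           (cong (_∸ ∣ U ∣) (∣Y∣+∣X─Y∣ U⊆Y)))) ⟩
    (∣ Y ∣ ∸ ∣ U ∣) * rest
      ≡⟨ chainSum-*ˡ Y t (∣ Y ∣ ∸ ∣ U ∣) _ ⟨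
    chainSum Y t (λ v → completions (∣ Y ∣) (∣ U ∣) v (zero ∷ s)) ∎
    where
    open ≡-Reasoning
    rest = chainSum Y t (λ v → completions (∣ Y ∣) (suc (∣ U ∣)) v s)
    inY : ∀ {x} → x ∈ Y → rank M (U ▹ x) ≡ rank M U
    inY {x} x∈Y = ℕ.≤-antisym (ℕ.≤-trans (rank-mono (∪⁅⁆-least U⊆Y x∈Y)) (ℕ.≤-reflexive (sym eq)))
      (rank-mono (p⊆p∪q ⁅ x ⁆))
  extensionCount≡chainSum {suc l} {t} Y U (suc zero ∷ s) flat U⊆Y eq rank+t size = lemma t rank+t
    where
    open ≡-Reasoning
    to : ∀ {x} → x ∉ U × rank M (U ▹ x) ≡ suc (rank M U) → x ∉ Y
    to (_ , eqx) x∈Y = ℕ.<⇒≱ (ℕ.≤-reflexive (sym eqx))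
      (ℕ.≤-trans (rank-mono (∪⁅⁆-least U⊆Y x∈Y)) (ℕ.≤-reflexive (sym eq)))
    from : ∀ {x} → x ∉ Y → x ∉ U × rank M (U ▹ x) ≡ suc (rank M U)
    from x∉Y = x∉Y ∘ U⊆Y , rank-▹-∉cl (x∉Y ∘ cl-least flat U⊆Y)
    lemma : ∀ t → rank M Y + t ≡ r →
      extensionCount U (suc zero ∷ s) ≡ chainSum Y t (λ v → completions (∣ Y ∣) (∣ U ∣) v (suc zero ∷ s))
    -- Here `Y` is the full set, so no element can raise the rank; `completions` is 0 in this case
    -- as well.
    lemma zero eq₀ = trans
      (extensionCount-∷ U (suc zero) s (λ x → ¬? (x ∈? Y)) (λ _ → 0) to from (λ x∉Y → ⊥-elim (noneLeft x∉Y)))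
      (∑-zero (List.allFin n) λ x → ℕ.*-zeroʳ (𝟙 (¬? (x ∈? Y))))
      where
      noneLeft : ∀ {x} → ¬ (x ∉ Y)
      noneLeft {x} x∉Y = x∉Y (subst (x ∈_) (sym (flat-of-rank-r flat (trans (sym (ℕ.+-identityʳ _)) eq₀))) ∈⊤)
    lemma (suc t) eq₁ = begin
      extensionCount U (suc zero ∷ s)
        ≡⟨ extensionCount-∷ U (suc zero) s (λ x → ¬? (x ∈? Y)) (λ x → h (cl (Y ▹ x))) to from (λ {x} → IH x) ⟩
      (∑[ x ← List.allFin n ] 𝟙 (¬? (x ∈? Y)) * h (cl (Y ▹ x)))
        ≡⟨ covers-partition flat h ⟩
      (∑[ Y′ ← subsets n ] 𝟙 (covers? Y Y′) * (∣ Y′ ─ Y ∣ * h Y′))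
        ≡⟨ (∑-cong (subsets n) λ Y′ → 𝟙-guard (covers? Y Y′) λ (_ , _ , Y⊆Y′) → trans
             (sym (chainSum-*ˡ Y′ t (∣ Y′ ─ Y ∣) _))
             (chainSum-cong Y′ t λ v → cong (λ z → ∣ Y′ ─ Y ∣ * completions z (suc (∣ U ∣)) v s)
               (sym (∣Y∣+∣X─Y∣ Y⊆Y′)))) ⟩
      chainSum Y (suc t) (λ v → completions (∣ Y ∣) (∣ U ∣) v (suc zero ∷ s)) ∎
      where
      h : Subset n → ℕ
      h Y′ = chainSum Y′ t (λ v → completions (∣ Y′ ∣) (suc (∣ U ∣)) v s)
      IH : ∀ x → x ∉ Y → extensionCount (U ▹ x) s ≡ h (cl (Y ▹ x))
      IH x x∉Y = let flat′ , rank′ , Y⊆ = covers-cl flat x∉Y in trans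
        (extensionCount≡chainSum (cl (Y ▹ x)) (U ▹ x) s flat′
          (∪⁅⁆-least (Y⊆ ∘ U⊆Y) (⊆cl _ (x∈X∪⁅x⁆ Y x)))
          (trans (proj₂ (from x∉Y)) (trans (cong suc eq) (sym rank′)))
          (trans (cong (_+ t) rank′) (trans (sym (ℕ.+-suc _ t)) eq₁))
          (trans (cong (_+ l) (∣X∪⁅x⁆∣ U x (x∉Y ∘ U⊆Y))) (trans (sym (ℕ.+-suc (∣ U ∣) l)) size)))
        (chainSum-cong (cl (Y ▹ x)) t λ v → cong (λ m → completions (∣ cl (Y ▹ x) ∣) m v s) (∣X∪⁅x⁆∣ U x (x∉Y ∘ U⊆Y)))

  initialSet : Vec (Fin n) l → ℕ → Subset n
  initialSet π j = ⋃ (List.map ⁅_⁆ (List.take j (Vec.toList π)))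

  -- Relative to a set `U` already placed, dropping the first entry of an ordering amounts to
  -- enlarging `U`.
  rankSequenceFrom : Subset n → Vec (Fin n) l → Vec ℕ l
  rankSequenceFrom U π = Vec.tabulate λ j →
    rank M (U ∪ initialSet π (suc (toℕ j))) ∸ rank M (U ∪ initialSet π (toℕ j))

  rankSequenceFrom-∷ : ∀ U x (π : Vec (Fin n) l) →
    rankSequenceFrom U (x ∷ π) ≡ (rank M (U ▹ x) ∸ rank M U) ∷ rankSequenceFrom (U ▹ x) π
  rankSequenceFrom-∷ U x π = cong₂ _∷_
    (cong₂ (λ X Y → rank M X ∸ rank M Y) (cong (U ∪_) (∪-identityʳ ⁅ x ⁆)) (∪-identityʳ U))
    (Vec.tabulate-cong λ j → cong₂ (λ X Y → rank M X ∸ rank M Y)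
      (sym (∪-assoc U ⁅ x ⁆ (initialSet π (suc (toℕ j))))) (sym (∪-assoc U ⁅ x ⁆ (initialSet π (toℕ j)))))

  rankSequence≡ : ∀ π → rankSequence M π ≡ rankSequenceFrom ⊥ π
  rankSequence≡ π = Vec.tabulate-cong λ j → cong₂ (λ X Y → rank M X ∸ rank M Y)
    (sym (∪-identityˡ (initialSet π (suc (toℕ j))))) (sym (∪-identityˡ (initialSet π (toℕ j))))

  extends⇒ : ∀ U (π : Vec (Fin n) l) s → Extends U π s →
    All (_∉ U) π × AllPairs _≢_ π × rankSequenceFrom U π ≡ Vec.map toℕ s
  extends⇒ U []      []      _ = [] , [] , refl
  extends⇒ U (x ∷ π) (b ∷ s) ((x∉U , eq) , ext) =
    let avoid , distinct , eqs = extends⇒ (U ▹ x) π s ext in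
    x∉U ∷ All.map (λ y∉ y∈U → y∉ (p⊆p∪q ⁅ x ⁆ y∈U)) avoid ,
    All.map (λ { y∉ refl → y∉ (x∈X∪⁅x⁆ U x) }) avoid ∷ distinct ,
    trans (rankSequenceFrom-∷ U x π)
      (cong₂ _∷_ (trans (cong (_∸ rank M U) eq) (ℕ.m+n∸n≡m (toℕ b) (rank M U))) eqs)

  ⇒extends : ∀ U (π : Vec (Fin n) l) s →
    All (_∉ U) π × AllPairs _≢_ π × rankSequenceFrom U π ≡ Vec.map toℕ s → Extends U π s
  ⇒extends U []      []      _ = tt
  ⇒extends U (x ∷ π) (b ∷ s) (x∉U ∷ avoid , x≢ ∷ distinct , eqs) =
    let eq , eqs′ = Vec.∷-injective (trans (sym (rankSequenceFrom-∷ U x π)) eqs) in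
    (x∉U , trans (sym (ℕ.m∸n+n≡m (rank-mono (p⊆p∪q ⁅ x ⁆)))) (cong (_+ rank M U) eq)) ,
    ⇒extends (U ▹ x) π s
      (All.map (λ { (y∉U , x≢y) y∈ → [ y∉U , x≢y ∘ sym ∘ x∈⁅y⁆⇒x≡y x ]′ (x∈p∪q⁻ U ⁅ x ⁆ y∈) }) (All.zip (avoid , x≢)) ,
       distinct , eqs′)

orderingCount : Matroid n r → Vec (Fin 2) n → ℕ
orderingCount {n} M s = ∑[ π ← orderings n ] 𝟙 (rankSequence M π ≟ᵛ Vec.map toℕ s)

weight : Vec (Fin 2) n → Vec ℕ (suc r) → ℕ
weight s (z ∷ v) = completions z 0 v s

orderingCount≡flagSum : (M : Matroid n r) (s : Vec (Fin 2) n) → orderingCount M s ≡ flagSum M (weight s)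
orderingCount≡flagSum {n} {r} M s = begin
  orderingCount M s
    ≡⟨ ∑-filter distinct? (vectors (List.allFin n) n) _ ⟩
  (∑[ π ← vectors (List.allFin n) n ] 𝟙 (distinct? π) * 𝟙 (rankSequence M π ≟ᵛ Vec.map toℕ s))
    ≡⟨ (∑-cong (vectors (List.allFin n) n) λ π → trans
         (sym (𝟙-× (distinct? π) (rankSequence M π ≟ᵛ Vec.map toℕ s)))
         (𝟙-cong (distinct? π ×-dec (rankSequence M π ≟ᵛ Vec.map toℕ s)) (extends? ⊥ π s)
           (λ (d , eq) → ⇒extends ⊥ π s (All.universal (λ _ → ∉⊥) π , d , trans (sym (rankSequence≡ π)) eq))
           (λ ext → let _ , d , eq = extends⇒ ⊥ π s ext in d , trans (rankSequence≡ π) eq))) ⟩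
  extensionCount ⊥ s
    ≡⟨ extensionCount≡chainSum (cl ⊥) ⊥ s (cl-flat ⊥) (⊆cl ⊥) (sym (rank-cl ⊥))
         (cong (_+ r) (trans (rank-cl ⊥) rank-⊥)) (cong (_+ n) (∣⊥∣≡0 n)) ⟩
  chainSum (cl ⊥) r (λ v → completions (∣ cl ⊥ ∣) (∣ ⊥ {n} ∣) v s)
    ≡⟨ chainSum-cong (cl ⊥) r (λ v → cong (λ m → completions (∣ cl ⊥ ∣) m v s) (∣⊥∣≡0 n)) ⟩
  chainSum (cl ⊥) r (λ v → completions (∣ cl ⊥ ∣) 0 v s)
    ≡⟨ flagSum≡chainSum M (weight s) ⟨
  flagSum M (weight s) ∎
  where
  open ≡-Reasoning
  open MatroidProperties M
  open Chains M
  open Orderings M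
  distinct? : ∀ (π : Vec (Fin n) n) → Dec (AllPairs _≢_ π)
  distinct? = allPairs? λ x y → ¬? (x Fin.≟ y)

-- Recovering catenary data from rank sequences

staircase : (v : Vec ℕ t) → Vec (Fin 2) (Vec.sum v)
staircase []          = []
staircase (zero ∷ v)  = staircase v
staircase (suc c ∷ v) = suc zero ∷ Vec.replicate c zero Vec.++ staircase v

ones : Vec (Fin 2) l → ℕ
ones = Vec.count (Fin._≟ suc zero)

ones-replicate : ∀ c (s : Vec (Fin 2) l) → ones (Vec.replicate c zero Vec.++ s) ≡ ones s
ones-replicate zero    s = refl
ones-replicate (suc c) s = ones-replicate c s

ones-staircase : (v : Vec ℕ t) → (∀ j → 0 < lookup v j) → ones (staircase v) ≡ t
ones-staircase []          pos = refl
ones-staircase (zero ∷ v)  pos with pos zero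
... | ()
ones-staircase (suc c ∷ v) pos = cong suc (trans (ones-replicate c (staircase v)) (ones-staircase v (pos ∘ suc)))

0<*⁺ : ∀ {a b} → 0 < a → 0 < b → 0 < a * b
0<*⁺ {suc a} {suc b} _ _ = s≤s z≤n

0<*⁻ : ∀ a {b} → 0 < a * b → 0 < a × 0 < b
0<*⁻ (suc a) {zero}  pos = ⊥-elim (ℕ.<-irrefl (sym (ℕ.*-zeroʳ a)) pos)
0<*⁻ (suc a) {suc b} pos = s≤s z≤n , s≤s z≤n

-- The current flat has exactly `d` free places, one for each of the next `d` zeros. A following 1
-- uses one of the `suc c` new elements and leaves `c` free places.
completions-staircase-positive : ∀ {z} m d (v : Vec ℕ t) → z ≡ m + d → (∀ j → 0 < lookup v j) →
  0 < completions z m v (Vec.replicate d zero Vec.++ staircase v)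
completions-staircase-positive {z = z} m (suc d) v eq pos = 0<*⁺
  (ℕ.m<n⇒0<n∸m (subst (m <_) (sym eq) (ℕ.m<m+n m (s≤s z≤n))))
  (completions-staircase-positive (suc m) d v (trans eq (ℕ.+-suc m d)) pos)
completions-staircase-positive m zero []          eq pos = s≤s z≤n
completions-staircase-positive m zero (zero ∷ v)  eq pos with pos zero
... | ()
completions-staircase-positive {z = z} m zero (suc c ∷ v) eq pos = 0<*⁺ {suc c} (s≤s z≤n)
  (completions-staircase-positive (suc m) c v
    (trans (cong (_+ suc c) (trans eq (ℕ.+-identityʳ m))) (ℕ.+-suc m c)) (pos ∘ suc))

-- Dominance order: partial sums are compared.
Dominated : ℕ → Vec ℕ t → ℕ → Vec ℕ t → Set
Dominated z []      z′ []        = z ≤ z′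
Dominated z (c ∷ v) z′ (c′ ∷ v′) = z ≤ z′ × Dominated (z + c) v (z′ + c′) v′

-- Each zero needs a free place, so the `m` elements placed and the `d` zeros to come must fit into
-- the `z′` elements of the current flat; a 1 needs a further step of `v′`.
completions-dominated : ∀ m d (v : Vec ℕ t) z′ v′ → (∀ j → 0 < lookup v j) → m ≤ z′ →
  0 < completions z′ m v′ (Vec.replicate d zero Vec.++ staircase v) → Dominated (m + d) v z′ v′
completions-dominated m (suc d) v z′ v′ pos m≤z′ nz =
  let m<z′ , nz′ = 0<*⁻ (z′ ∸ m) nz in
  subst (λ z → Dominated z v z′ v′) (sym (ℕ.+-suc m d))
    (completions-dominated (suc m) d v z′ v′ pos (ℕ.m∸n≢0⇒n<m (ℕ.>⇒≢ m<z′)) nz′)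
completions-dominated m zero []          z′ []        pos m≤z′ nz = subst (_≤ z′) (sym (ℕ.+-identityʳ m)) m≤z′
completions-dominated m zero (zero ∷ v)  z′ (c′ ∷ v′) pos m≤z′ nz with pos zero
... | ()
completions-dominated m zero (suc c ∷ v) z′ (c′ ∷ v′) pos m≤z′ nz =
  let 0<c′ , nz′ = 0<*⁻ c′ nz in
  subst (_≤ z′) (sym (ℕ.+-identityʳ m)) m≤z′ ,
  subst (λ z → Dominated z v (z′ + c′) v′) (trans (sym (ℕ.+-suc m c)) (cong (_+ suc c) (sym (ℕ.+-identityʳ m))))
    (completions-dominated (suc m) c v (z′ + c′) v′ (pos ∘ suc)
      (ℕ.≤-trans (ℕ.≤-reflexive (ℕ.+-comm 1 m)) (ℕ.+-mono-≤ m≤z′ 0<c′)) nz′)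

-- The sum of all partial sums is strictly monotone for the dominance order, so it can stand in for
-- that order in an induction.
partialSums : ℕ → Vec ℕ t → ℕ
partialSums z []      = z
partialSums z (c ∷ v) = z + partialSums (z + c) v

dominated⇒≤ : ∀ z (v : Vec ℕ t) z′ v′ → Dominated z v z′ v′ → partialSums z v ≤ partialSums z′ v′
dominated⇒≤ z []      z′ []        dom        = dom
dominated⇒≤ z (c ∷ v) z′ (c′ ∷ v′) (le , dom) = ℕ.+-mono-≤ le (dominated⇒≤ (z + c) v (z′ + c′) v′ dom)

+-≤-≡ : ∀ {a b c d} → a ≤ c → b ≤ d → a + b ≡ c + d → a ≡ c × b ≡ d
+-≤-≡ {a} {b} {c} {d} a≤c b≤d eq with a ℕ.≟ c
... | yes refl = refl , ℕ.+-cancelˡ-≡ a b d eq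
... | no a≢c   = ⊥-elim (ℕ.<-irrefl eq (ℕ.+-mono-<-≤ (ℕ.≤∧≢⇒< a≤c a≢c) b≤d))

dominated-≡ : ∀ z (v : Vec ℕ t) z′ v′ → Dominated z v z′ v′ → partialSums z v ≡ partialSums z′ v′ →
  z ≡ z′ × v ≡ v′
dominated-≡ z []      z′ []        dom        eq = eq , refl
dominated-≡ z (c ∷ v) z′ (c′ ∷ v′) (le , dom) eq
  with +-≤-≡ le (dominated⇒≤ (z + c) v (z′ + c′) v′ dom) eq
... | refl , eq′ with dominated-≡ (z + c) v (z′ + c′) v′ dom eq′
... | eqc , refl = refl , cong (_∷ v) (ℕ.+-cancelˡ-≡ z c c′ eqc)

partialSums-bound : ∀ z (v : Vec ℕ t) → partialSums z v ≤ suc t * (z + Vec.sum v)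
partialSums-bound z []          = ℕ.≤-trans (ℕ.m≤m+n z 0) (ℕ.m≤m+n (z + 0) 0)
partialSums-bound {suc t} z (c ∷ v) = ℕ.+-mono-≤ (ℕ.m≤m+n z _)
  (ℕ.≤-trans (partialSums-bound (z + c) v) (ℕ.≤-reflexive (cong (suc t *_) (ℕ.+-assoc z c _))))

totalPartialSums : Vec ℕ (suc r) → ℕ
totalPartialSums (z ∷ v) = partialSums z v

-- Over all compositions `a` these symbols give a triangular linear system with positive diagonal,
-- ordered by `totalPartialSums`.
triangular : (a : Vec ℕ (suc r)) → IsComposition n a → ∃ λ (s : Symbol n r) → 0 < weight (proj₁ s) a ×
  (∀ b → 0 < weight (proj₁ s) b → b ≢ a → totalPartialSums a < totalPartialSums b)
triangular (z ∷ v) (pos , refl) =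
  (Vec.replicate z zero Vec.++ staircase v , trans (ones-replicate z (staircase v)) (ones-staircase v pos)) ,
  completions-staircase-positive 0 z v refl pos ,
  λ { (z′ ∷ v′) nz b≢a → let dom = completions-dominated 0 z v z′ v′ pos z≤n nz in
      ℕ.≤∧≢⇒< (dominated⇒≤ z v z′ v′ dom) λ eq → b≢a (sym (case dominated-≡ z v z′ v′ dom eq of λ { (refl , refl) → refl })) }

lookup≤sum : (v : Vec ℕ k) (i : Fin k) → lookup v i ≤ Vec.sum v
lookup≤sum (c ∷ v) zero    = ℕ.m≤m+n c _
lookup≤sum (c ∷ v) (suc i) = ℕ.≤-trans (lookup≤sum v i) (ℕ.m≤n+m _ c)

-- Back substitution in the triangular system, from large values of `totalPartialSums` downwards: in
-- the equation for the symbol of `a` the terms at other vectors already agree, and the positive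
-- weight at `a` cancels.
weights-separate : (f g : Vec ℕ (suc r) → ℕ) →
  (∀ a → ¬ IsComposition n a → f a ≡ 0) → (∀ a → ¬ IsComposition n a → g a ≡ 0) →
  (∀ (s : Symbol n r) → (∑[ a ← candidates n r ] f a * weight (proj₁ s) a) ≡ (∑[ a ← candidates n r ] g a * weight (proj₁ s) a)) →
  ∀ a → IsComposition n a → f a ≡ g a
weights-separate {r} {n} f g f0 g0 eqs a comp = go (suc (suc r * n)) a comp (ℕ.m≤n+m _ _)
  where
  as = candidates n r

  -- `k` is fuel. No composition exceeds (r + 1)n in `totalPartialSums`, so the bound is
  -- contradictory once `k` is 0.
  go : ∀ k a → IsComposition n a → suc r * n < totalPartialSums a + k → f a ≡ g a
  go zero    a@(z ∷ v) (pos , refl) bound = ⊥-elim (ℕ.<⇒≱ bound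
    (ℕ.≤-trans (ℕ.≤-reflexive (ℕ.+-identityʳ _)) (partialSums-bound z v)))
  go (suc k) a comp bound with triangular a comp
  ... | s , 0<w , above = ℕ.*-cancelʳ-≡ (f a) (g a) (w a) {{>-nonZero 0<w}}
        (ℕ.+-cancelʳ-≡ (other f) (f a * w a) (g a * w a) (trans (sym (split f)) (trans (eqs s) (trans (split g)
          (cong (g a * w a +_) (sym others))))))
    where
    w = weight (proj₁ s)
    other : (Vec ℕ (suc r) → ℕ) → ℕ
    other h = ∑[ b ← as ] 𝟙 (¬? (b ≟ᵛ a)) * (h b * w b)
    once : OccursOnce _≟ᵛ_ as a
    once = vectors-once ℕ._≟_ (numbers (suc n)) a λ j →
      numbers-once (s≤s (ℕ.≤-trans (lookup≤sum a j) (ℕ.≤-reflexive (proj₂ comp))))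
    split : ∀ h → (∑[ b ← as ] h b * w b) ≡ h a * w a + other h
    split h = trans (∑-cong as λ b → 𝟙-split (b ≟ᵛ a) (h b * w b))
      (trans (∑-+ as (λ b → 𝟙 (b ≟ᵛ a) * (h b * w b)) _)
        (cong (_+ other h) (∑-only _≟ᵛ_ as once (_≟ᵛ a) refl (λ _ eq → eq) (λ b → h b * w b))))
    others : other f ≡ other g
    others = ∑-cong as λ b → 𝟙-guard (¬? (b ≟ᵛ a)) λ b≢a → summand b b≢a
      where
      summand : ∀ b → b ≢ a → f b * w b ≡ g b * w b
      -- A term away from `a` agrees for one of three reasons: both functions vanish at `b`, the
      -- weight vanishes there, or `b` lies higher and is settled with less fuel.
      summand b b≢a with isComposition? n b | w b in eqw
      ... | no ¬comp | _     = cong (_* _) (trans (f0 b ¬comp) (sym (g0 b ¬comp)))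
      ... | yes _    | zero  = trans (ℕ.*-zeroʳ (f b)) (sym (ℕ.*-zeroʳ (g b)))
      ... | yes comp′ | suc x = cong (_* suc x) (go k b comp′ (ℕ.<-≤-trans bound
              (ℕ.≤-trans (ℕ.≤-reflexive (ℕ.+-suc _ k)) (ℕ.+-monoˡ-≤ k (above b (subst (0 <_) (sym eqw) (s≤s z≤n)) b≢a)))))

catenary⇒orderingCount : (M N : Matroid n r) → (∀ a → catenaryData M a ≡ catenaryData N a) →
  ∀ s → orderingCount M s ≡ orderingCount N s
catenary⇒orderingCount {n} {r} M N eq s = begin
  orderingCount M s    ≡⟨ orderingCount≡flagSum M s ⟩
  flagSum M (weight s) ≡⟨ flagSum-expand M (weight s) ⟩
  (∑[ a ← candidates n r ] ν M a * weight s a)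
    ≡⟨ (∑-cong (candidates n r) λ a → cong (_* weight s a) (trans (sym (extend-catenaryData M a))
         (trans (extend-cong eq a) (extend-catenaryData N a)))) ⟩
  (∑[ a ← candidates n r ] ν N a * weight s a) ≡⟨ flagSum-expand N (weight s) ⟨
  flagSum N (weight s) ≡⟨ orderingCount≡flagSum N s ⟨
  orderingCount N s    ∎
  where open ≡-Reasoning

orderingCount⇒catenary : (M N : Matroid n r) →
  (∀ (s : Symbol n r) → orderingCount M (proj₁ s) ≡ orderingCount N (proj₁ s)) →
  ∀ a → catenaryData M a ≡ catenaryData N a
orderingCount⇒catenary M N eq a = weights-separate (ν M) (ν N) (ν-nonComposition M) (ν-nonComposition N)
  (λ s → trans (sym (expand M s)) (trans (eq s) (expand N s))) (parts a) (positive a , total a)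
  where
  expand : ∀ M s → orderingCount M (proj₁ s) ≡ (∑[ a ← candidates _ _ ] ν M a * weight (proj₁ s) a)
  expand M s = trans (orderingCount≡flagSum M (proj₁ s)) (flagSum-expand M (weight (proj₁ s)))

-- From counts of orderings to coefficients in a field

module _ {c ℓ₁ ℓ₂} (K : HeytingField c ℓ₁ ℓ₂) where
  open HeytingField K using (_≈_; 0#; 1#; heytingCommutativeRing)
    renaming (_+_ to _+ₖ_; refl to ≈-refl; sym to ≈-sym; trans to ≈-trans; reflexive to ≈-reflexive)
  open CommutativeRing (HeytingCommutativeRing.commutativeRing heytingCommutativeRing)
    using (+-monoid; +-group; +-identityˡ; +-identityʳ; +-cong; +-congʳ)
  open MonoidMult +-monoid using (×-homo-+) renaming (_×_ to _·_)

  𝟙·1# : ∀ {p} {P : Set p} (P? : Dec P) → (if does P? then 1# else 0#) ≈ 𝟙 P? · 1#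
  𝟙·1# P? with does P?
  ... | true  = ≈-sym (+-identityʳ 1#)
  ... | false = ≈-refl

  𝒢-invariant≈ : (M : Matroid n r) (t : Symbol n r) →
    𝒢-invariant K M t ≈ orderingCount M (proj₁ t) · 1#
  𝒢-invariant≈ {n} M t = go (orderings n)
    where
    matches? : ∀ π → Dec (rankSequence M π ≡ Vec.map toℕ (proj₁ t))
    matches? π = rankSequence M π ≟ᵛ Vec.map toℕ (proj₁ t)
    go : ∀ πs → List.foldr (λ π v t → basis K (rankSequence M π) t +ₖ v t) (λ _ → 0#) πs t ≈
      (∑[ π ← πs ] 𝟙 (matches? π)) · 1#
    go []       = ≈-refl
    go (π ∷ πs) = ≈-trans (+-cong (𝟙·1# (matches? π)) (go πs)) (≈-sym (×-homo-+ 1# (𝟙 (matches? π)) _))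

  module _ (char0 : CharacteristicZero K) where

    -- If m′ were m + suc d, cancelling `m · 1#` would leave `suc d · 1# ≈ 0#`, against
    -- characteristic zero.
    ·1#-cancel-≤ : ∀ {m m′} → m ≤ m′ → m · 1# ≈ m′ · 1# → m ≡ m′
    ·1#-cancel-≤ {m} {m′} m≤m′ eq with m′ ∸ m in diff
    ... | zero  = ℕ.≤-antisym m≤m′ (ℕ.m∸n≡0⇒m≤n diff)
    ... | suc d = ⊥-elim (char0 d (GroupProperties.∙-cancelˡ +-group (m · 1#) _ _ (≈-trans
      (≈-sym (×-homo-+ 1# m (suc d)))
      (≈-trans (≈-reflexive (cong (_· 1#) (trans (cong (m +_) (sym diff)) (ℕ.m+[n∸m]≡n m≤m′))))
        (≈-trans (≈-sym eq) (≈-sym (+-identityʳ (m · 1#))))))))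

    ·1#-injective : ∀ m m′ → m · 1# ≈ m′ · 1# → m ≡ m′
    ·1#-injective m m′ eq = [ (λ le → ·1#-cancel-≤ le eq) , (λ le → sym (·1#-cancel-≤ le (≈-sym eq))) ]′ (ℕ.≤-total m m′)

    sameVector⇒catenary : (M N : Matroid n r) → (∀ t → 𝒢-invariant K M t ≈ 𝒢-invariant K N t) →
      ∀ a → catenaryData M a ≡ catenaryData N a
    sameVector⇒catenary M N eq = orderingCount⇒catenary M N λ t → ·1#-injective _ _
      (≈-trans (≈-sym (𝒢-invariant≈ M t)) (≈-trans (eq t) (𝒢-invariant≈ N t)))

  catenary⇒sameVector : (M N : Matroid n r) → (∀ a → catenaryData M a ≡ catenaryData N a) →
    ∀ t → 𝒢-invariant K M t ≈ 𝒢-invariant K N t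
  catenary⇒sameVector M N eq t = ≈-trans (𝒢-invariant≈ M t)
    (≈-trans (≈-reflexive (cong (_· 1#) (catenary⇒orderingCount M N eq (proj₁ t)))) (≈-sym (𝒢-invariant≈ N t)))

-- Flags of a cone

∑-const : ∀ n c → (∑[ _ ← List.allFin n ] c) ≡ n * c
∑-const zero    c = refl
∑-const (suc n) c = trans (∑-allFin n (λ _ → c)) (cong (c +_) (∑-const n c))

-- Insert the determined sum over y = `to x`, exchange the sums, and collapse x = `from y`. The maps
-- need to be mutually inverse on solutions only.
∑-reindex : {A B : Set} (xs : List A) (ys : List B) →
  (_≟_ : DecidableEquality A) → (∀ x → OccursOnce _≟_ xs x) → (_≟′_ : DecidableEquality B) → (∀ y → OccursOnce _≟′_ ys y) →
  {P : Pred A 0ℓ} {Q : Pred B 0ℓ} (P? : Decidable P) (Q? : Decidable Q) (to : A → B) (from : B → A) →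
  (∀ {x} → P x → Q (to x) × from (to x) ≡ x) → (∀ {y} → Q y → P (from y) × to (from y) ≡ y) → (f : A → ℕ) →
  (∑[ x ← xs ] 𝟙 (P? x) * f x) ≡ (∑[ y ← ys ] 𝟙 (Q? y) * f (from y))
∑-reindex xs ys _≟_ once _≟′_ once′ P? Q? to from to-prop from-prop f = begin
  (∑[ x ← xs ] 𝟙 (P? x) * f x)
    ≡⟨ (∑-cong xs λ x → sym (∑-only _≟′_ ys (once′ (to x)) (_≟′ to x) refl (λ _ eq → eq) (λ _ → 𝟙 (P? x) * f x))) ⟩
  (∑[ x ← xs ] ∑[ y ← ys ] 𝟙 (y ≟′ to x) * (𝟙 (P? x) * f x))
    ≡⟨ (∑-cong xs λ x → ∑-cong ys λ y → summand x y) ⟩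
  (∑[ x ← xs ] ∑[ y ← ys ] 𝟙 (x ≟ from y) * (𝟙 (Q? y) * f (from y)))
    ≡⟨ ∑-swap xs ys _ ⟩
  (∑[ y ← ys ] ∑[ x ← xs ] 𝟙 (x ≟ from y) * (𝟙 (Q? y) * f (from y)))
    ≡⟨ (∑-cong ys λ y → ∑-only _≟_ xs (once (from y)) (_≟ from y) refl (λ _ eq → eq) (λ _ → 𝟙 (Q? y) * f (from y))) ⟩
  (∑[ y ← ys ] 𝟙 (Q? y) * f (from y)) ∎
  where
  open ≡-Reasoning
  summand : ∀ x y → 𝟙 (y ≟′ to x) * (𝟙 (P? x) * f x) ≡ 𝟙 (x ≟ from y) * (𝟙 (Q? y) * f (from y))
  summand x y = trans (𝟙-×-* (y ≟′ to x) (P? x) (f x)) (trans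
    (𝟙-cong-* ((y ≟′ to x) ×-dec P? x) ((x ≟ from y) ×-dec Q? y)
      (λ { (refl , p) → sym (proj₂ (to-prop p)) , proj₁ (to-prop p) })
      (λ { (refl , q) → sym (proj₂ (from-prop q)) , proj₁ (from-prop q) })
      (λ { (refl , p) → cong f (sym (proj₂ (to-prop p))) }))
    (sym (𝟙-×-* (x ≟ from y) (Q? y) (f (from y)))))

-- The sum of h over the increments of all chains in the q-cone that start at a given flat of
-- size m avoiding the apex and project onto a given chain with increments v.
coneWeight : (q m : ℕ) → (Vec ℕ (suc t) → ℕ) → Vec ℕ t → ℕ
coneWeight q m h []      = h (suc (q * m) ∸ m ∷ [])
coneWeight q m h (c ∷ v) =
  h (suc (q * m) ∸ m ∷ Vec.map (q *_) (c ∷ v)) + q * coneWeight q (m + c) (λ w → h (c ∷ w)) v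

-- e p c, for c : Fin q, are the points other than the apex α on the line through α
-- and the base point p.
record ConePoints (q n n′ : ℕ) : Set where
  field
    α      : Fin n′
    e      : Fin n → Fin q → Fin n′
    origin : Fin q

  InCone : Subset n → Fin n′ → Set
  InCone Y x = x ≡ α ⊎ ∃ λ p → p ∈ Y × ∃ λ c → x ≡ e p c

  inCone? : ∀ Y x → Dec (InCone Y x)
  inCone? Y x = (x Fin.≟ α) ⊎-dec Fin.any? λ p → (p ∈? Y) ×-dec Fin.any? λ c → x Fin.≟ e p c

  cone : Subset n → Subset n′
  cone Y = ⟪ inCone? Y ⟫

  ∈cone⁺ : ∀ {Y x} → InCone Y x → x ∈ cone Y
  ∈cone⁺ {Y} = ∈⟪⟫⁺ (inCone? Y)

  ∈cone⁻ : ∀ {Y x} → x ∈ cone Y → InCone Y x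
  ∈cone⁻ {Y} = ∈⟪⟫⁻ (inCone? Y)

  α∈cone : ∀ {Y} → α ∈ cone Y
  α∈cone = ∈cone⁺ (inj₁ refl)

  e∈cone⁺ : ∀ {Y p} c → p ∈ Y → e p c ∈ cone Y
  e∈cone⁺ c p∈Y = ∈cone⁺ (inj₂ (_ , p∈Y , c , refl))

-- All that counting flags takes from the geometry. The reason for `meets` is that a flat avoiding
-- `α` spans a hyperplane of its join with `α`, so every line through `α` in that join crosses it;
-- the crossing point is in the cone, which contains its lines through `α` entirely.
record ConeStructure (q : ℕ) (M : Matroid n r) (M′ : Matroid n′ r′) : Set where
  field
    conePoints : ConePoints q n n′

  open ConePoints conePoints public

  field
    e≢α         : ∀ p c → e p c ≢ α
    e-injective : ∀ {p c p′ c′} → e p c ≡ e p′ c′ → p ≡ p′ × c ≡ c′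
    decompose   : ∀ x → x ≡ α ⊎ ∃₂ λ p c → x ≡ e p c
    line        : ∀ {X p c} → IsFlat M′ X → α ∈ X → e p c ∈ X → ∀ c′ → e p c′ ∈ X
    secant      : ∀ {X p c c′} → IsFlat M′ X → c ≢ c′ → e p c ∈ X → e p c′ ∈ X → α ∈ X
    meets       : ∀ {X p c} → IsFlat M′ X → α ∉ X → e p c ∈ MatroidProperties.cl M′ (X ∪ ⁅ α ⁆) →
                  ∃ λ c′ → e p c′ ∈ X
    rank-cone   : ∀ Y → rank M′ (cone Y) ≡ suc (rank M Y)

module ConeProperties {q n r n′ r′ : ℕ} (M : Matroid n r) (M′ : Matroid n′ r′) (S : ConeStructure q M M′) where
  open ConeStructure S
  private
    module B = MatroidProperties M
    module B′ = MatroidProperties M′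
    module C = Chains M
    module C′ = Chains M′

  infixl 6 _▹′_
  _▹′_ : Subset n′ → Fin n′ → Subset n′
  X ▹′ x = X ∪ ⁅ x ⁆

  e∈cone⁻ : ∀ {Y p c} → e p c ∈ cone Y → p ∈ Y
  e∈cone⁻ {Y} {p} {c} e∈ with ∈cone⁻ e∈
  ... | inj₁ eq = ⊥-elim (e≢α p c eq)
  ... | inj₂ (p′ , p′∈Y , c′ , eq) = subst (_∈ Y) (sym (proj₁ (e-injective eq))) p′∈Y

  cone-least : ∀ {X Y} → IsFlat M′ X → α ∈ X → (∀ {p} → p ∈ Y → ∃ λ c → e p c ∈ X) → cone Y ⊆ X
  cone-least flat α∈X meet x∈ with ∈cone⁻ x∈
  ... | inj₁ refl = α∈X
  ... | inj₂ (p , p∈Y , c , refl) = line flat α∈X (proj₂ (meet p∈Y)) c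

  cone-mono : ∀ {Y Y′} → Y ⊆ Y′ → cone Y ⊆ cone Y′
  cone-mono Y⊆Y′ x∈ with ∈cone⁻ x∈
  ... | inj₁ refl = α∈cone
  ... | inj₂ (p , p∈Y , c , refl) = e∈cone⁺ c (Y⊆Y′ p∈Y)

  cone-full : cone full ≡ full
  cone-full = ⊆-antisym (λ _ → ∈⊤) λ {x} _ → case decompose x of λ
    { (inj₁ refl) → α∈cone ; (inj₂ (p , c , refl)) → e∈cone⁺ c ∈⊤ }

  meets? : ∀ X p → Dec (∃ λ c → e p c ∈ X)
  meets? X p = Fin.any? λ c → e p c ∈? X

  -- Projection from `α`; inverse to `cone` on flats through `α`.
  base : Subset n′ → Subset n
  base X = ⟪ meets? X ⟫

  ∈base⁺ : ∀ {X p c} → e p c ∈ X → p ∈ base X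
  ∈base⁺ {X} e∈ = ∈⟪⟫⁺ (meets? X) (_ , e∈)

  ∈base⁻ : ∀ {X p} → p ∈ base X → ∃ λ c → e p c ∈ X
  ∈base⁻ {X} = ∈⟪⟫⁻ (meets? X)

  base-mono : ∀ {X X′} → X ⊆ X′ → base X ⊆ base X′
  base-mono X⊆X′ p∈ = ∈base⁺ (X⊆X′ (proj₂ (∈base⁻ p∈)))

  base-cone : ∀ Y → base (cone Y) ≡ Y
  base-cone Y = ⊆-antisym (λ p∈ → e∈cone⁻ (proj₂ (∈base⁻ p∈))) (λ p∈ → ∈base⁺ (e∈cone⁺ origin p∈))

  ⊆cone-base : ∀ X → X ⊆ cone (base X)
  ⊆cone-base X {x} x∈ with decompose x
  ... | inj₁ refl = α∈cone
  ... | inj₂ (p , c , refl) = e∈cone⁺ c (∈base⁺ x∈)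

  cone-base : ∀ {X} → IsFlat M′ X → α ∈ X → cone (base X) ≡ X
  cone-base flat α∈X = ⊆-antisym (cone-least flat α∈X ∈base⁻) (⊆cone-base _)

  -- Adjoining a point `e p c` outside the cone generates, by `line`, the whole cone over
  -- `Y ∪ ⁅ p ⁆`, whose rank is larger because `Y` is flat.
  cone-flat : ∀ {Y} → IsFlat M Y → IsFlat M′ (cone Y)
  cone-flat {Y} flat x x∉ with decompose x
  ... | inj₁ refl = ⊥-elim (x∉ α∈cone)
  ... | inj₂ (p , c , refl) = begin-strict
    rank M′ (cone Y)          ≡⟨ rank-cone Y ⟩
    suc (rank M Y)            <⟨ s≤s (flat p λ p∈ → x∉ (e∈cone⁺ c p∈)) ⟩
    suc (rank M (Y ∪ ⁅ p ⁆))  ≡⟨ rank-cone (Y ∪ ⁅ p ⁆) ⟨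
    rank M′ (cone (Y ∪ ⁅ p ⁆)) ≤⟨ B′.rank-mono (cone-least (B′.cl-flat (cone Y ▹′ e p c))
                                    (B′.⊆cl (cone Y ▹′ e p c) (p⊆p∪q ⁅ e p c ⁆ α∈cone)) (incl c)) ⟩
    rank M′ (B′.cl (cone Y ▹′ e p c)) ≡⟨ B′.rank-cl (cone Y ▹′ e p c) ⟩
    rank M′ (cone Y ▹′ e p c) ∎
    where
    open ℕ.≤-Reasoning
    incl : ∀ c {p′} → p′ ∈ Y ∪ ⁅ p ⁆ → ∃ λ c′ → e p′ c′ ∈ B′.cl (cone Y ▹′ e p c)
    incl c p′∈ with x∈p∪q⁻ Y ⁅ p ⁆ p′∈
    ... | inj₁ p′∈Y = c , B′.⊆cl (cone Y ▹′ e p c) (p⊆p∪q ⁅ e p c ⁆ (e∈cone⁺ c p′∈Y))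
    ... | inj₂ p′∈p rewrite x∈⁅y⁆⇒x≡y p p′∈p = c , B′.⊆cl (cone Y ▹′ e p c) (x∈X∪⁅x⁆ (cone Y) (e p c))

  base-flat-∋ : ∀ {X} → IsFlat M′ X → α ∈ X → IsFlat M (base X)
  base-flat-∋ {X} flat α∈X p p∉ = s<s⁻¹ (begin-strict
    suc (rank M (base X))            ≡⟨ rank-cone (base X) ⟨
    rank M′ (cone (base X))          ≡⟨ cong (rank M′) (cone-base flat α∈X) ⟩
    rank M′ X                        <⟨ flat (e p origin) (p∉ ∘ ∈base⁺) ⟩
    rank M′ (X ▹′ e p origin)        ≤⟨ B′.rank-mono (∪⁅⁆-least (cone-mono (p⊆p∪q ⁅ p ⁆) ∘ ⊆cone-base X)
                                          (e∈cone⁺ origin (x∈X∪⁅x⁆ (base X) p))) ⟩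
    rank M′ (cone (base X ∪ ⁅ p ⁆))  ≡⟨ rank-cone _ ⟩
    suc (rank M (base X ∪ ⁅ p ⁆))    ∎)
    where open ℕ.≤-Reasoning

  module _ {X : Subset n′} (flat : IsFlat M′ X) (α∉X : α ∉ X) where

    -- A flat through `α` is the cone over its projection, and by `meets` the join of `X` with `α`
    -- projects to nothing new.
    cl-▹α : B′.cl (X ▹′ α) ≡ cone (base X)
    cl-▹α = trans (sym (cone-base (B′.cl-flat _) α∈)) (cong cone (⊆-antisym
      (λ p∈ → ∈base⁺ (proj₂ (meets flat α∉X (proj₂ (∈base⁻ p∈)))))
      (base-mono (B′.⊆cl _ ∘ p⊆p∪q ⁅ α ⁆))))
      where
      α∈ : α ∈ B′.cl (X ▹′ α)
      α∈ = B′.⊆cl _ (x∈X∪⁅x⁆ X α)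

    base-flat : IsFlat M (base X)
    base-flat = subst (IsFlat M) (trans (cong base cl-▹α) (base-cone (base X)))
      (base-flat-∋ (B′.cl-flat (X ▹′ α)) (B′.⊆cl _ (x∈X∪⁅x⁆ X α)))

    -- `cone (base X)` is the join of `X` with `α`, hence one above `X` in rank, and by `rank-cone`
    -- it is also one above `base X`.
    rank-base : rank M′ X ≡ rank M (base X)
    rank-base = ℕ.suc-injective (begin
      suc (rank M′ X)            ≡⟨ proj₁ (proj₂ (B′.covers-cl flat α∉X)) ⟨
      rank M′ (B′.cl (X ▹′ α))   ≡⟨ cong (rank M′) cl-▹α ⟩
      rank M′ (cone (base X))    ≡⟨ rank-cone (base X) ⟩
      suc (rank M (base X))      ∎)
      where open ≡-Reasoning

    covers-cone : B′.Covers X (cone (base X))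
    covers-cone = subst (B′.Covers X) cl-▹α (B′.covers-cl flat α∉X)

    covers-∋α : ∀ {X′} → B′.Covers X X′ → α ∈ X′ → X′ ≡ cone (base X)
    covers-∋α covers α∈X′ = trans (B′.covers-unique flat covers α∈X′ α∉X) cl-▹α

  covers-base : ∀ {X X′} → IsFlat M′ X → α ∉ X → B′.Covers X X′ → α ∉ X′ → B.Covers (base X) (base X′)
  covers-base flat α∉X (flat′ , rank′ , X⊆X′) α∉X′ =
    base-flat flat′ α∉X′ ,
    trans (sym (rank-base flat′ α∉X′)) (trans rank′ (cong suc (rank-base flat α∉X))) ,
    base-mono X⊆X′

  ∑-points : (f : Fin n′ → ℕ) →
    ∑ (List.allFin n′) f ≡ f α + (∑[ p ← List.allFin n ] ∑[ c ← List.allFin q ] f (e p c))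
  ∑-points f = begin
    ∑ xs f
      ≡⟨ (∑-cong xs λ x → trans (sym (ℕ.*-identityˡ (f x))) (trans (cong (_* f x) (sym (one x)))
           (trans (ℕ.*-distribʳ-+ (f x) (𝟙 (x Fin.≟ α)) _) (cong (𝟙 (x Fin.≟ α) * f x +_) (distrib x))))) ⟩
    (∑[ x ← xs ] (𝟙 (x Fin.≟ α) * f x + (∑[ p ← ps ] ∑[ c ← cs ] 𝟙 (x Fin.≟ e p c) * f x)))
      ≡⟨ ∑-+ xs (λ x → 𝟙 (x Fin.≟ α) * f x) _ ⟩
    (∑[ x ← xs ] 𝟙 (x Fin.≟ α) * f x) + (∑[ x ← xs ] ∑[ p ← ps ] ∑[ c ← cs ] 𝟙 (x Fin.≟ e p c) * f x)
      ≡⟨ cong₂ _+_ (pick α) (trans (∑-swap xs ps _) (∑-cong ps λ p → trans (∑-swap xs cs _) (∑-cong cs λ c → pick (e p c)))) ⟩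
    f α + (∑[ p ← ps ] ∑[ c ← cs ] f (e p c)) ∎
    where
    open ≡-Reasoning
    xs = List.allFin n′
    ps = List.allFin n
    cs = List.allFin q
    pick : ∀ y → (∑[ x ← xs ] 𝟙 (x Fin.≟ y) * f x) ≡ f y
    pick y = ∑-only Fin._≟_ xs (allFin-once n′ y) (Fin._≟ y) refl (λ _ eq → eq) f
    distrib : ∀ x → (∑[ p ← ps ] ∑[ c ← cs ] 𝟙 (x Fin.≟ e p c)) * f x ≡ (∑[ p ← ps ] ∑[ c ← cs ] 𝟙 (x Fin.≟ e p c) * f x)
    distrib x = trans (sym (∑-*ʳ ps (f x) _)) (∑-cong ps λ p → sym (∑-*ʳ cs (f x) _))
    one : ∀ x → 𝟙 (x Fin.≟ α) + (∑[ p ← ps ] ∑[ c ← cs ] 𝟙 (x Fin.≟ e p c)) ≡ 1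
    one x with decompose x
    ... | inj₁ refl = cong₂ _+_ (𝟙-yes (α Fin.≟ α) refl)
      (∑-zero ps λ p → ∑-zero cs λ c → 𝟙-no (α Fin.≟ e p c) (e≢α p c ∘ sym))
    ... | inj₂ (p₀ , c₀ , refl) = cong₂ _+_ (𝟙-no (e p₀ c₀ Fin.≟ α) (e≢α p₀ c₀)) (begin
      (∑[ p ← ps ] ∑[ c ← cs ] 𝟙 (e p₀ c₀ Fin.≟ e p c))
        ≡⟨ (∑-cong ps λ p → ∑-cong cs λ c → trans
             (𝟙-cong (e p₀ c₀ Fin.≟ e p c) ((p Fin.≟ p₀) ×-dec (c Fin.≟ c₀))
               (λ eq → let eqp , eqc = e-injective eq in sym eqp , sym eqc) (λ { (refl , refl) → refl }))
             (𝟙-× (p Fin.≟ p₀) (c Fin.≟ c₀))) ⟩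
      (∑[ p ← ps ] ∑[ c ← cs ] 𝟙 (p Fin.≟ p₀) * 𝟙 (c Fin.≟ c₀))
        ≡⟨ (∑-cong ps λ p → trans (∑-*ˡ cs (𝟙 (p Fin.≟ p₀)) _) (cong (𝟙 (p Fin.≟ p₀) *_) (allFin-once q c₀))) ⟩
      (∑[ p ← ps ] 𝟙 (p Fin.≟ p₀) * 1)
        ≡⟨ ∑-only Fin._≟_ ps (allFin-once n p₀) (Fin._≟ p₀) refl (λ _ eq → eq) (λ _ → 1) ⟩
      1 ∎)

  ∣cone∣ : ∀ Y → ∣ cone Y ∣ ≡ suc (q * ∣ Y ∣)
  ∣cone∣ Y = begin
    ∣ cone Y ∣
      ≡⟨ ∣X∣≡∑ (cone Y) ⟩
    (∑[ x ← List.allFin n′ ] 𝟙 (x ∈? cone Y))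
      ≡⟨ ∑-points _ ⟩
    𝟙 (α ∈? cone Y) + (∑[ p ← List.allFin n ] ∑[ c ← List.allFin q ] 𝟙 (e p c ∈? cone Y))
      ≡⟨ cong₂ _+_ (𝟙-yes (α ∈? cone Y) α∈cone) (∑-cong (List.allFin n) λ p → trans
           (∑-cong (List.allFin q) λ c → 𝟙-cong (e p c ∈? cone Y) (p ∈? Y) e∈cone⁻ (e∈cone⁺ c))
           (∑-const q (𝟙 (p ∈? Y)))) ⟩
    suc (∑[ p ← List.allFin n ] q * 𝟙 (p ∈? Y))
      ≡⟨ cong suc (trans (∑-*ˡ (List.allFin n) q _) (cong (q *_) (sym (∣X∣≡∑ Y)))) ⟩
    suc (q * ∣ Y ∣) ∎
    where open ≡-Reasoning

  -- By `secant` a flat avoiding `α` has at most one point on each line through `α`, so projection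
  -- identifies no two points.
  ∣base∣ : ∀ {X} → IsFlat M′ X → α ∉ X → ∣ X ∣ ≡ ∣ base X ∣
  ∣base∣ {X} flat α∉X = begin
    ∣ X ∣
      ≡⟨ ∣X∣≡∑ X ⟩
    (∑[ x ← List.allFin n′ ] 𝟙 (x ∈? X))
      ≡⟨ ∑-points _ ⟩
    𝟙 (α ∈? X) + (∑[ p ← List.allFin n ] ∑[ c ← List.allFin q ] 𝟙 (e p c ∈? X))
      ≡⟨ cong₂ _+_ (𝟙-no (α ∈? X) α∉X) (∑-cong (List.allFin n) onLine) ⟩
    (∑[ p ← List.allFin n ] 𝟙 (p ∈? base X))
      ≡⟨ ∣X∣≡∑ (base X) ⟨
    ∣ base X ∣ ∎
    where
    open ≡-Reasoning
    onLine : ∀ p → (∑[ c ← List.allFin q ] 𝟙 (e p c ∈? X)) ≡ 𝟙 (p ∈? base X)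
    onLine p with p ∈? base X
    ... | no p∉  = ∑-zero (List.allFin q) λ c → 𝟙-no (e p c ∈? X) (p∉ ∘ ∈base⁺)
    ... | yes p∈ with ∈base⁻ p∈
    ... | c₀ , e∈ = ∑-count-one Fin._≟_ (List.allFin q) (allFin-once q c₀) (λ c → e p c ∈? X) e∈
      λ c ec∈ → decidable-stable (c Fin.≟ c₀) λ c≢c₀ → α∉X (secant flat c≢c₀ ec∈ e∈)

  ∣cone─cone∣ : ∀ {Y Y′} → Y ⊆ Y′ → ∣ cone Y′ ─ cone Y ∣ ≡ q * ∣ Y′ ─ Y ∣
  ∣cone─cone∣ {Y} {Y′} Y⊆Y′ = ℕ.+-cancelˡ-≡ (∣ cone Y ∣) _ _ (begin
    ∣ cone Y ∣ + ∣ cone Y′ ─ cone Y ∣   ≡⟨ ∣Y∣+∣X─Y∣ (cone-mono Y⊆Y′) ⟩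
    ∣ cone Y′ ∣                         ≡⟨ ∣cone∣ Y′ ⟩
    suc (q * ∣ Y′ ∣)                    ≡⟨ cong (λ m → suc (q * m)) (∣Y∣+∣X─Y∣ Y⊆Y′) ⟨
    suc (q * (∣ Y ∣ + ∣ Y′ ─ Y ∣))      ≡⟨ cong suc (ℕ.*-distribˡ-+ q (∣ Y ∣) (∣ Y′ ─ Y ∣)) ⟩
    suc (q * ∣ Y ∣) + q * ∣ Y′ ─ Y ∣    ≡⟨ cong (_+ q * ∣ Y′ ─ Y ∣) (∣cone∣ Y) ⟨
    ∣ cone Y ∣ + q * ∣ Y′ ─ Y ∣         ∎)
    where open ≡-Reasoning

  cover-increment : ∀ {X X′} → IsFlat M′ X → α ∉ X → B′.Covers X X′ → α ∉ X′ → ∣ X′ ─ X ∣ ≡ ∣ base X′ ─ base X ∣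
  cover-increment {X} {X′} flat α∉X (flat′ , _ , X⊆X′) α∉X′ = ℕ.+-cancelˡ-≡ (∣ X ∣) _ _ (begin
    ∣ X ∣ + ∣ X′ ─ X ∣              ≡⟨ ∣Y∣+∣X─Y∣ X⊆X′ ⟩
    ∣ X′ ∣                          ≡⟨ ∣base∣ flat′ α∉X′ ⟩
    ∣ base X′ ∣                     ≡⟨ ∣Y∣+∣X─Y∣ (base-mono X⊆X′) ⟨
    ∣ base X ∣ + ∣ base X′ ─ base X ∣ ≡⟨ cong (_+ ∣ base X′ ─ base X ∣) (∣base∣ flat α∉X) ⟨
    ∣ X ∣ + ∣ base X′ ─ base X ∣    ∎)
    where open ≡-Reasoning

  covers-cone⇒ : ∀ {Y X′} → B′.Covers (cone Y) X′ → B.Covers Y (base X′) × cone (base X′) ≡ X′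
  covers-cone⇒ {Y} {X′} (flat , rank′ , incl) =
    (base-flat-∋ flat (incl α∈cone) ,
     ℕ.suc-injective (trans (sym (rank-cone (base X′))) (trans (cong (rank M′) eq) (trans rank′ (cong suc (rank-cone Y))))) ,
     λ p∈ → ∈base⁺ (incl (e∈cone⁺ origin p∈))) ,
    eq
    where
    eq = cone-base flat (incl α∈cone)

  covers⇒cone : ∀ {Y Y′} → B.Covers Y Y′ → B′.Covers (cone Y) (cone Y′) × base (cone Y′) ≡ Y′
  covers⇒cone {Y} {Y′} (flat , rank′ , incl) =
    (cone-flat flat , trans (rank-cone Y′) (cong suc (trans rank′ (sym (rank-cone Y)))) , cone-mono incl) , base-cone Y′

  -- Every flat above a cone contains `α` and is a cone itself, so `base` and `cone` match the
  -- chains above `cone Y` with those above `Y`.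
  chainSum-cone : ∀ Y t h → C′.chainSum (cone Y) t h ≡ C.chainSum Y t (λ v → h (Vec.map (q *_) v))
  chainSum-cone Y zero    h = refl
  chainSum-cone Y (suc t) h = trans
    (∑-reindex (subsets n′) (subsets n) _≟ˢ_ subsets-once _≟ˢ_ subsets-once (B′.covers? (cone Y)) (B.covers? Y) base cone
      covers-cone⇒ covers⇒cone (λ X′ → C′.chainSum X′ t (λ v → h (∣ X′ ─ cone Y ∣ ∷ v))))
    (∑-cong (subsets n) λ Y′ → 𝟙-guard (B.covers? Y Y′) λ (_ , _ , Y⊆Y′) → trans
      (chainSum-cone Y′ t (λ v → h (∣ cone Y′ ─ cone Y ∣ ∷ v)))
      (C.chainSum-cong Y′ t λ v → cong (λ c → h (c ∷ Vec.map (q *_) v)) (∣cone─cone∣ Y⊆Y′)))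

  module Lifts {X : Subset n′} (flat : IsFlat M′ X) (α∉X : α ∉ X) where

    Lift : Subset n → Subset n′ → Set
    Lift Y′ X′ = (B′.Covers X X′ × α ∉ X′) × base X′ ≡ Y′

    lift? : ∀ Y′ X′ → Dec (Lift Y′ X′)
    lift? Y′ X′ = (B′.covers? X X′ ×-dec ¬? (α ∈? X′)) ×-dec (base X′ ≟ˢ Y′)

    lifts : Subset n → ℕ
    lifts Y′ = ∑[ X′ ← subsets n′ ] 𝟙 (lift? Y′ X′)

    -- The lifts of Y′ partition the difference of the cones over Y′ and over base X.
    lift-through : ∀ {Y′ x} → B.Covers (base X) Y′ →
      (x ∉ X × (α ∉ B′.cl (X ▹′ x) × base (B′.cl (X ▹′ x)) ≡ Y′) → x ∈ cone Y′ ─ cone (base X)) ×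
      (x ∈ cone Y′ ─ cone (base X) → x ∉ X × (α ∉ B′.cl (X ▹′ x) × base (B′.cl (X ▹′ x)) ≡ Y′))
    lift-through {Y′} {x} (flatY′ , rankY′ , Y⊆Y′) = to , from
      where
      X′ = B′.cl (X ▹′ x)
      x∈X′ : x ∈ X′
      x∈X′ = B′.⊆cl _ (x∈X∪⁅x⁆ X x)
      to : x ∉ X × (α ∉ X′ × base X′ ≡ Y′) → x ∈ cone Y′ ─ cone (base X)
      to (x∉X , α∉X′ , refl) = x∈p∧x∉q⇒x∈p─q (⊆cone-base X′ x∈X′) λ x∈cone →
        α∉X′ (subst (α ∈_) (trans (B′.covers-unique flat (covers-cone flat α∉X) x∈cone x∉X) refl) α∈cone)
      from : x ∈ cone Y′ ─ cone (base X) → x ∉ X × (α ∉ X′ × base X′ ≡ Y′)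
      from x∈ = x∉X , α∉X′ , B.flat-⊆-rank≡⇒≡ (base-flat (B′.cl-flat _) α∉X′) base⊆
          (trans (sym (rank-base (B′.cl-flat _) α∉X′)) (trans (proj₁ (proj₂ covers))
            (trans (cong suc (rank-base flat α∉X)) (sym rankY′))))
        where
        x∉cone = ∈─⁻ (cone Y′) (cone (base X)) x∈
        x∉X : x ∉ X
        x∉X = x∉cone ∘ ⊆cone-base X
        covers = B′.covers-cl flat x∉X
        α∉X′ : α ∉ X′
        α∉X′ α∈X′ = x∉cone (subst (x ∈_) (covers-∋α flat α∉X covers α∈X′) x∈X′)
        base⊆ : base X′ ⊆ Y′
        base⊆ p∈ = e∈cone⁻ (B′.cl-least (cone-flat flatY′)
          (∪⁅⁆-least (cone-mono Y⊆Y′ ∘ ⊆cone-base X) (p─q⊆p (cone Y′) _ x∈)) (proj₂ (∈base⁻ p∈)))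

    -- Double counting: each lift of `Y′` adds `d` elements to `X`, and together the lifts fill a
    -- difference of cones with `q * d` elements. As `d` is positive, it cancels.
    lifts-covering : ∀ {Y′} → B.Covers (base X) Y′ → lifts Y′ ≡ q
    lifts-covering {Y′} covers = ℕ.*-cancelˡ-≡ (lifts Y′) q d {{>-nonZero (⊂⇒∣─∣-positive (C.covers⇒⊂ covers))}} (begin
      d * lifts Y′
        ≡⟨ ∑-*ˡ (subsets n′) d _ ⟨
      (∑[ X′ ← subsets n′ ] d * 𝟙 (lift? Y′ X′))
        ≡⟨ (∑-cong (subsets n′) summand) ⟩
      (∑[ X′ ← subsets n′ ] 𝟙 (B′.covers? X X′) * (∣ X′ ─ X ∣ * 𝟙 (over? X′)))
        -- Pairs of a lift and a point of it outside `X` are now counted by the point, which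
        -- determines the lift as a closure.
        ≡⟨ B′.covers-partition flat (𝟙 ∘ over?) ⟨
      (∑[ x ← List.allFin n′ ] 𝟙 (¬? (x ∈? X)) * 𝟙 (over? (B′.cl (X ▹′ x))))
        ≡⟨ (∑-cong (List.allFin n′) λ x → trans (sym (𝟙-× (¬? (x ∈? X)) (over? (B′.cl (X ▹′ x)))))
             (𝟙-cong (¬? (x ∈? X) ×-dec over? (B′.cl (X ▹′ x))) (x ∈? (cone Y′ ─ cone (base X)))
               (proj₁ (lift-through covers)) (proj₂ (lift-through covers)))) ⟩
      (∑[ x ← List.allFin n′ ] 𝟙 (x ∈? (cone Y′ ─ cone (base X))))
        ≡⟨ ∣X∣≡∑ (cone Y′ ─ cone (base X)) ⟨
      ∣ cone Y′ ─ cone (base X) ∣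
        ≡⟨ ∣cone─cone∣ (proj₂ (proj₂ covers)) ⟩
      q * d
        ≡⟨ ℕ.*-comm q d ⟩
      d * q ∎)
      where
      open ≡-Reasoning
      d = ∣ Y′ ─ base X ∣
      over? : ∀ X′ → Dec (α ∉ X′ × base X′ ≡ Y′)
      over? X′ = ¬? (α ∈? X′) ×-dec (base X′ ≟ˢ Y′)
      summand : ∀ X′ → d * 𝟙 (lift? Y′ X′) ≡ 𝟙 (B′.covers? X X′) * (∣ X′ ─ X ∣ * 𝟙 (over? X′))
      summand X′ = begin
        d * 𝟙 (lift? Y′ X′)
          ≡⟨ ℕ.*-comm d _ ⟩
        𝟙 (lift? Y′ X′) * d
          ≡⟨ 𝟙-cong-* (lift? Y′ X′) (B′.covers? X X′ ×-dec over? X′)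
               (λ ((c , α∉) , eq) → c , α∉ , eq) (λ (c , α∉ , eq) → (c , α∉) , eq)
               (λ { ((c , α∉) , refl) → sym (cover-increment flat α∉X c α∉) }) ⟩
        𝟙 (B′.covers? X X′ ×-dec over? X′) * ∣ X′ ─ X ∣
          ≡⟨ cong (_* ∣ X′ ─ X ∣) (𝟙-× (B′.covers? X X′) (over? X′)) ⟩
        𝟙 (B′.covers? X X′) * 𝟙 (over? X′) * ∣ X′ ─ X ∣
          ≡⟨ ℕ.*-assoc (𝟙 (B′.covers? X X′)) _ _ ⟩
        𝟙 (B′.covers? X X′) * (𝟙 (over? X′) * ∣ X′ ─ X ∣)
          ≡⟨ cong (𝟙 (B′.covers? X X′) *_) (ℕ.*-comm (𝟙 (over? X′)) _) ⟩
        𝟙 (B′.covers? X X′) * (∣ X′ ─ X ∣ * 𝟙 (over? X′)) ∎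

    lifts≡ : ∀ Y′ → lifts Y′ ≡ 𝟙 (B.covers? (base X) Y′) * q
    lifts≡ Y′ = helper (B.covers? (base X) Y′)
      where
      helper : (d : Dec (B.Covers (base X) Y′)) → lifts Y′ ≡ 𝟙 d * q
      helper (yes covers) = trans (lifts-covering covers) (sym (ℕ.*-identityˡ q))
      helper (no ¬covers) = ∑-zero (subsets n′) λ X′ → 𝟙-no (lift? Y′ X′)
        λ { ((c , α∉) , refl) → ¬covers (covers-base flat α∉X c α∉) }

    -- One cover of `X` contains `α`, the cone over its projection. The others are sorted by
    -- projection, and each cover of `base X` occurs `q` times; every step taken before the chain
    -- reaches `α` thus costs a factor `q`.
    covers-sum : (g : Subset n′ → ℕ) (G : Subset n → ℕ) →
      (∀ {X′} → B′.Covers X X′ → α ∉ X′ → g X′ ≡ G (base X′)) →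
      (∑[ X′ ← subsets n′ ] 𝟙 (B′.covers? X X′) * g X′) ≡
      g (cone (base X)) + q * (∑[ Y′ ← subsets n ] 𝟙 (B.covers? (base X) Y′) * G Y′)
    covers-sum g G eq = begin
      (∑[ X′ ← subsets n′ ] 𝟙 (B′.covers? X X′) * g X′)
        ≡⟨ (∑-cong (subsets n′) λ X′ → trans (𝟙-split (α ∈? X′) (𝟙 (B′.covers? X X′) * g X′))
             (cong₂ _+_ (𝟙-×-* (α ∈? X′) (B′.covers? X X′) (g X′)) (avoiding X′))) ⟩
      (∑[ X′ ← subsets n′ ] (𝟙 ((α ∈? X′) ×-dec B′.covers? X X′) * g X′ + (∑[ Y′ ← subsets n ] 𝟙 (lift? Y′ X′) * G Y′)))
        ≡⟨ ∑-+ (subsets n′) (λ X′ → 𝟙 ((α ∈? X′) ×-dec B′.covers? X X′) * g X′) _ ⟩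
      (∑[ X′ ← subsets n′ ] 𝟙 ((α ∈? X′) ×-dec B′.covers? X X′) * g X′) +
      (∑[ X′ ← subsets n′ ] ∑[ Y′ ← subsets n ] 𝟙 (lift? Y′ X′) * G Y′)
        ≡⟨ cong₂ _+_
             (∑-only _≟ˢ_ (subsets n′) (subsets-once (cone (base X))) (λ X′ → (α ∈? X′) ×-dec B′.covers? X X′)
               (α∈cone , covers-cone flat α∉X) (λ X′ (α∈ , c) → covers-∋α flat α∉X c α∈) g)
             (trans (∑-swap (subsets n′) (subsets n) _) (trans
               (∑-cong (subsets n) λ Y′ → trans (∑-*ʳ (subsets n′) (G Y′) _)
                 (trans (cong (_* G Y′) (trans (lifts≡ Y′) (ℕ.*-comm (𝟙 (B.covers? (base X) Y′)) q)))
                   (ℕ.*-assoc q (𝟙 (B.covers? (base X) Y′)) (G Y′))))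
               (∑-*ˡ (subsets n) q _))) ⟩
      g (cone (base X)) + q * (∑[ Y′ ← subsets n ] 𝟙 (B.covers? (base X) Y′) * G Y′) ∎
      where
      open ≡-Reasoning
      avoiding : ∀ X′ → 𝟙 (¬? (α ∈? X′)) * (𝟙 (B′.covers? X X′) * g X′) ≡ (∑[ Y′ ← subsets n ] 𝟙 (lift? Y′ X′) * G Y′)
      avoiding X′ = begin
        𝟙 (¬? (α ∈? X′)) * (𝟙 (B′.covers? X X′) * g X′)
          ≡⟨ 𝟙-×-* (¬? (α ∈? X′)) (B′.covers? X X′) (g X′) ⟩
        𝟙 (¬? (α ∈? X′) ×-dec B′.covers? X X′) * g X′
          ≡⟨ 𝟙-cong-* (¬? (α ∈? X′) ×-dec B′.covers? X X′) (B′.covers? X X′ ×-dec ¬? (α ∈? X′))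
               (λ (α∉ , c) → c , α∉) (λ (c , α∉) → α∉ , c) (λ (α∉ , c) → eq c α∉) ⟩
        𝟙 (B′.covers? X X′ ×-dec ¬? (α ∈? X′)) * G (base X′)
          ≡⟨ cong (𝟙 (B′.covers? X X′ ×-dec ¬? (α ∈? X′)) *_)
               (∑-only _≟ˢ_ (subsets n) (subsets-once (base X′)) (λ Y′ → base X′ ≟ˢ Y′) refl (λ _ eq → sym eq) G) ⟨
        𝟙 (B′.covers? X X′ ×-dec ¬? (α ∈? X′)) * (∑[ Y′ ← subsets n ] 𝟙 (base X′ ≟ˢ Y′) * G Y′)
          ≡⟨ ∑-*ˡ (subsets n) (𝟙 (B′.covers? X X′ ×-dec ¬? (α ∈? X′))) _ ⟨
        (∑[ Y′ ← subsets n ] 𝟙 (B′.covers? X X′ ×-dec ¬? (α ∈? X′)) * (𝟙 (base X′ ≟ˢ Y′) * G Y′))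
          ≡⟨ (∑-cong (subsets n) λ Y′ → 𝟙-×-* (B′.covers? X X′ ×-dec ¬? (α ∈? X′)) (base X′ ≟ˢ Y′) (G Y′)) ⟩
        (∑[ Y′ ← subsets n ] 𝟙 (lift? Y′ X′) * G Y′) ∎

    ∣cone─∣ : ∣ cone (base X) ─ X ∣ ≡ suc (q * ∣ base X ∣) ∸ ∣ base X ∣
    ∣cone─∣ = trans (sym (ℕ.m+n∸m≡n (∣ X ∣) _)) (cong₂ _∸_
      (trans (∣Y∣+∣X─Y∣ (⊆cone-base X)) (∣cone∣ (base X))) (∣base∣ flat α∉X))

  -- The next flat is either the cone over `base X`, after which only cones follow, or a lift, to
  -- which the induction applies; these are the two terms of `coneWeight`. The rank equation makes
  -- the chain end at the full set.
  chainSum-avoiding : ∀ {X} t h → IsFlat M′ X → α ∉ X → rank M′ X + suc t ≡ r′ →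
    C′.chainSum X (suc t) h ≡ C.chainSum (base X) t (coneWeight q (∣ base X ∣) h)
  chainSum-avoiding {X} zero h flat α∉X rank+t = begin
    C′.chainSum X 1 h
      ≡⟨ covers-sum (λ X′ → h (∣ X′ ─ X ∣ ∷ [])) (λ _ → 0)
           -- No cover avoids `α` here: its rank is `r′`, so it is the full set. The term for the
           -- lifts may therefore be taken as 0.
           (λ {X′} (flat′ , rank′ , _) α∉X′ → ⊥-elim (α∉X′ (subst (α ∈_)
             (sym (B′.flat-of-rank-r flat′ (trans rank′ (trans (ℕ.+-comm 1 (rank M′ X)) rank+t)))) ∈⊤))) ⟩
    h (∣ cone (base X) ─ X ∣ ∷ []) + q * (∑[ Y′ ← subsets n ] 𝟙 (B.covers? (base X) Y′) * 0)
      ≡⟨ cong₂ _+_ (cong (λ c → h (c ∷ [])) ∣cone─∣)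
           (trans (cong (q *_) (∑-zero (subsets n) λ Y′ → ℕ.*-zeroʳ (𝟙 (B.covers? (base X) Y′)))) (ℕ.*-zeroʳ q)) ⟩
    h (suc (q * ∣ base X ∣) ∸ ∣ base X ∣ ∷ []) + 0
      ≡⟨ ℕ.+-identityʳ _ ⟩
    h (suc (q * ∣ base X ∣) ∸ ∣ base X ∣ ∷ []) ∎
    where
    open ≡-Reasoning
    open Lifts flat α∉X
  chainSum-avoiding {X} (suc t) h flat α∉X rank+t = begin
    C′.chainSum X (suc (suc t)) h
      ≡⟨ covers-sum (λ X′ → C′.chainSum X′ (suc t) (λ v → h (∣ X′ ─ X ∣ ∷ v))) G
           (λ {X′} c@(flat′ , rank′ , _) α∉X′ → trans
             (chainSum-avoiding t (λ v → h (∣ X′ ─ X ∣ ∷ v)) flat′ α∉X′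
               (trans (cong (_+ suc t) rank′) (trans (sym (ℕ.+-suc (rank M′ X) (suc t))) rank+t)))
             (cong₂ (λ m c → C.chainSum (base X′) t (coneWeight q m (λ w → h (c ∷ w))))
               (sym (∣Y∣+∣X─Y∣ (base-mono (proj₂ (proj₂ c))))) (cover-increment flat α∉X c α∉X′))) ⟩
    C′.chainSum (cone Y) (suc t) (λ v → h (∣ cone Y ─ X ∣ ∷ v)) + q * C.chainSum Y (suc t) rest
      ≡⟨ cong₂ _+_
           (trans (chainSum-cone Y (suc t) (λ v → h (∣ cone Y ─ X ∣ ∷ v)))
             (C.chainSum-cong Y (suc t) λ v → cong (λ c → h (c ∷ Vec.map (q *_) v)) ∣cone─∣))
           (sym (C.chainSum-*ˡ Y (suc t) q rest)) ⟩
    C.chainSum Y (suc t) (λ v → h (gap ∷ Vec.map (q *_) v)) + C.chainSum Y (suc t) (λ v → q * rest v)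
      ≡⟨ C.chainSum-+ Y (suc t) (λ v → h (gap ∷ Vec.map (q *_) v)) (λ v → q * rest v) ⟨
    C.chainSum Y (suc t) (λ v → h (gap ∷ Vec.map (q *_) v) + q * rest v)
      -- `coneWeight` and `rest` are defined by cases on the vector, so the two weights agree
      -- definitionally only after it is split.
      ≡⟨ C.chainSum-cong Y (suc t) {λ v → h (gap ∷ Vec.map (q *_) v) + q * rest v} {coneWeight q (∣ Y ∣) h} (λ { (c ∷ v) → refl }) ⟩
    C.chainSum Y (suc t) (coneWeight q (∣ Y ∣) h) ∎
    where
    open ≡-Reasoning
    open Lifts flat α∉X
    Y = base X
    gap = suc (q * ∣ Y ∣) ∸ ∣ Y ∣
    rest : Vec ℕ (suc t) → ℕ
    rest (c ∷ v) = coneWeight q (∣ Y ∣ + c) (λ w → h (c ∷ w)) v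
    G : Subset n → ℕ
    G Y′ = C.chainSum Y′ t (λ v → rest (∣ Y′ ─ Y ∣ ∷ v))

  rank-whole : r′ ≡ suc r
  rank-whole = trans (sym (rank-full M′)) (trans (cong (rank M′) (sym cone-full))
    (trans (rank-cone full) (cong suc (rank-full M))))

  size-whole : n′ ≡ suc (q * n)
  size-whole = trans (sym (∣⊤∣≡n n′)) (trans (cong ∣_∣ (sym cone-full))
    (trans (∣cone∣ full) (cong (λ m → suc (q * m)) (∣⊤∣≡n n))))

coneFlagWeight : ℕ → (Vec ℕ (suc (suc r)) → ℕ) → Vec ℕ (suc r) → ℕ
coneFlagWeight q h (z ∷ v) = coneWeight q z (λ w → h (z ∷ w)) v

flagSum-cone : ∀ {q} (M : Matroid n r) (M′ : Matroid n′ (suc r)) → ConeStructure q M M′ →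
  ∀ h → flagSum M′ h ≡ flagSum M (coneFlagWeight q h)
flagSum-cone {r = r} {q = q} M M′ S h = begin
  flagSum M′ h
    ≡⟨ flagSum≡chainSum M′ h ⟩
  C′.chainSum X₀ (suc r) (λ v → h (∣ X₀ ∣ ∷ v))
    ≡⟨ chainSum-avoiding r (λ v → h (∣ X₀ ∣ ∷ v)) flat₀ α∉X₀ (cong (_+ suc r) rank₀) ⟩
  C.chainSum (base X₀) r (coneWeight q (∣ base X₀ ∣) (λ v → h (∣ X₀ ∣ ∷ v)))
    ≡⟨ cong (λ m → C.chainSum (base X₀) r (coneWeight q (∣ base X₀ ∣) (λ v → h (m ∷ v)))) (∣base∣ flat₀ α∉X₀) ⟩
  C.chainSum (base X₀) r (coneWeight q (∣ base X₀ ∣) (λ v → h (∣ base X₀ ∣ ∷ v)))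
    ≡⟨ cong (λ Y → C.chainSum Y r (coneWeight q (∣ Y ∣) (λ v → h (∣ Y ∣ ∷ v)))) base-X₀ ⟩
  C.chainSum (B.cl ⊥) r (coneWeight q (∣ B.cl ⊥ ∣) (λ v → h (∣ B.cl ⊥ ∣ ∷ v)))
    ≡⟨ flagSum≡chainSum M (coneFlagWeight q h) ⟨
  flagSum M (coneFlagWeight q h) ∎
  where
  open ≡-Reasoning
  open ConeStructure S
  open ConeProperties M M′ S
  module B = MatroidProperties M
  module B′ = MatroidProperties M′
  module C = Chains M
  module C′ = Chains M′
  X₀ = B′.cl ⊥
  flat₀ = B′.cl-flat ⊥
  rank₀ : rank M′ X₀ ≡ 0
  rank₀ = trans (B′.rank-cl ⊥) B′.rank-⊥
  -- A flat through `α` is a cone, and cones have positive rank.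
  α∉X₀ : α ∉ X₀
  α∉X₀ α∈ with trans (sym rank₀) (trans (cong (rank M′) (sym (cone-base flat₀ α∈))) (rank-cone (base X₀)))
  ... | ()
  base-X₀ : base X₀ ≡ B.cl ⊥
  base-X₀ = sym (B.cl-of-flat (base-flat flat₀ α∉X₀) (⊆-min _)
    (trans B.rank-⊥ (trans (sym rank₀) (rank-base flat₀ α∉X₀))))

-- The weight is now the indicator of `a`, which turns the flag sum of `M′` into `ν`; on the right
-- `M` enters through its catenary data only.
ν-cone : ∀ {q} (M : Matroid n r) (M′ : Matroid n′ (suc r)) → ConeStructure q M M′ → ∀ a →
  ν M′ a ≡ ∑[ b ← candidates n r ] extend (catenaryData M) b * coneFlagWeight q (λ w → 𝟙 (w ≟ᵛ a)) b
ν-cone {n} {r} {n′} {q} M M′ S a = begin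
  ν M′ a
    ≡⟨ ν≡∑ M′ a ⟩
  (∑[ X ← vectors (subsets n′) (suc (suc r)) ] 𝟙 (isFlag? M′ X ×-dec (flagComposition X ≟ᵛ a)))
    ≡⟨ (∑-cong (vectors (subsets n′) (suc (suc r))) λ X → 𝟙-× (isFlag? M′ X) (flagComposition X ≟ᵛ a)) ⟩
  flagSum M′ (λ w → 𝟙 (w ≟ᵛ a))
    ≡⟨ flagSum-cone M M′ S (λ w → 𝟙 (w ≟ᵛ a)) ⟩
  flagSum M (coneFlagWeight q (λ w → 𝟙 (w ≟ᵛ a)))
    ≡⟨ flagSum-expand M (coneFlagWeight q (λ w → 𝟙 (w ≟ᵛ a))) ⟩
  (∑[ b ← candidates n r ] ν M b * coneFlagWeight q (λ w → 𝟙 (w ≟ᵛ a)) b)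
    ≡⟨ (∑-cong (candidates n r) λ b → cong (_* coneFlagWeight q (λ w → 𝟙 (w ≟ᵛ a)) b) (sym (extend-catenaryData M b))) ⟩
  (∑[ b ← candidates n r ] extend (catenaryData M) b * coneFlagWeight q (λ w → 𝟙 (w ≟ᵛ a)) b) ∎
  where open ≡-Reasoning

-- Spans over a finite field

-- `Span` comes without a decision procedure, so spanning statements are derived under a double
-- negation. It is removed once the conclusion is decidable, such as membership in a `Subset`.
¬¬-map : ∀ {a b} {A : Set a} {B : Set b} → (A → B) → ¬ ¬ A → ¬ ¬ B
¬¬-map f ¬¬a ¬b = ¬¬a (¬b ∘ f)

module LinearAlgebra {q : ℕ} (F : GF q) where
  open GF F public using (_⊕_; ⊖_; 0#; 1#) renaming (_*_ to _⊛_)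
  open IsHeytingField (GF.isField F) public
    using (+-assoc; +-comm; +-identityˡ; +-identityʳ; -‿inverseˡ; -‿inverseʳ; *-assoc; *-comm; *-identityˡ;
           distribˡ; distribʳ; zeroˡ; zeroʳ; #⇒invertible; invertible⇒#; isCommutativeRing)

  commutativeRing : CommutativeRing 0ℓ 0ℓ
  commutativeRing = record { isCommutativeRing = isCommutativeRing }

  open RingProperties (CommutativeRing.ring commutativeRing) using (-0#≈0#)

  infixl 6 _⊞_
  infixl 7 _∙_

  _⊞_ : Space F dim → Space F dim → Space F dim
  _⊞_ = _+ᵛ_ F

  _∙_ : Fin q → Space F dim → Space F dim
  _∙_ = _·ᵛ_ F

  𝟎 : Space F dim
  𝟎 = 0ᵛ F

  inverse : ∀ {a} → a ≢ 0# → ∃ λ b → b ⊛ a ≡ 1#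
  inverse {a} a≢0 with #⇒invertible a≢0
  -- The field axiom inverts the difference of the two apart elements, `a ⊕ ⊖ 0#`, which is
  -- rewritten to `a`.
  ... | b , eq , _ = b , trans (cong (b ⊛_) (sym (trans (cong (a ⊕_) -0#≈0#) (+-identityʳ a)))) eq

  1≢0 : 1# ≢ 0#
  -- If `1#` were `0#`, it would invert `1# ⊕ ⊖ 1#`, making `1#` apart from itself.
  1≢0 eq = invertible⇒# {1#} {1#} (1# , trans (*-identityˡ _) (trans (-‿inverseʳ 1#) (sym eq)) ,
    trans (*-comm _ 1#) (trans (*-identityˡ _) (trans (-‿inverseʳ 1#) (sym eq)))) refl

  *-nonzero : ∀ {a b} → a ≢ 0# → b ≢ 0# → a ⊛ b ≢ 0#
  *-nonzero {a} {b} a≢0 b≢0 eq = let a⁻¹ , inv = inverse a≢0 in b≢0 (begin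
    b               ≡⟨ *-identityˡ b ⟨
    1# ⊛ b          ≡⟨ cong (_⊛ b) inv ⟨
    a⁻¹ ⊛ a ⊛ b     ≡⟨ *-assoc a⁻¹ a b ⟩
    a⁻¹ ⊛ (a ⊛ b)   ≡⟨ cong (a⁻¹ ⊛_) eq ⟩
    a⁻¹ ⊛ 0#        ≡⟨ zeroʳ a⁻¹ ⟩
    0#              ∎)
    where open ≡-Reasoning

  inverse-nonzero : ∀ {a b} → b ⊛ a ≡ 1# → b ≢ 0#
  inverse-nonzero {a} eq refl = 1≢0 (trans (sym eq) (zeroˡ a))

  difference : ∀ a b → ∃ λ c → a ⊕ c ≡ b
  difference a b = ⊖ a ⊕ b , trans (sym (+-assoc a (⊖ a) b)) (trans (cong (_⊕ b) (-‿inverseʳ a)) (+-identityˡ b))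

  ⊞-assoc : (u v w : Space F dim) → u ⊞ v ⊞ w ≡ u ⊞ (v ⊞ w)
  ⊞-assoc = Vec.zipWith-assoc +-assoc

  ⊞-comm : (u v : Space F dim) → u ⊞ v ≡ v ⊞ u
  ⊞-comm = Vec.zipWith-comm +-comm

  ⊞-identityˡ : (u : Space F dim) → 𝟎 ⊞ u ≡ u
  ⊞-identityˡ = Vec.zipWith-identityˡ +-identityˡ

  ⊞-identityʳ : (u : Space F dim) → u ⊞ 𝟎 ≡ u
  ⊞-identityʳ = Vec.zipWith-identityʳ +-identityʳ

  ∙-distribˡ : ∀ a (u v : Space F dim) → a ∙ (u ⊞ v) ≡ a ∙ u ⊞ a ∙ v
  ∙-distribˡ a []      []      = refl
  ∙-distribˡ a (x ∷ u) (y ∷ v) = cong₂ _∷_ (distribˡ a x y) (∙-distribˡ a u v)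

  ∙-distribʳ : ∀ a b (u : Space F dim) → (a ⊕ b) ∙ u ≡ a ∙ u ⊞ b ∙ u
  ∙-distribʳ a b []      = refl
  ∙-distribʳ a b (x ∷ u) = cong₂ _∷_ (distribʳ x a b) (∙-distribʳ a b u)

  ∙-assoc : ∀ a b (u : Space F dim) → (a ⊛ b) ∙ u ≡ a ∙ (b ∙ u)
  ∙-assoc a b []      = refl
  ∙-assoc a b (x ∷ u) = cong₂ _∷_ (*-assoc a b x) (∙-assoc a b u)

  ∙-identity : (u : Space F dim) → 1# ∙ u ≡ u
  ∙-identity []      = refl
  ∙-identity (x ∷ u) = cong₂ _∷_ (*-identityˡ x) (∙-identity u)

  ∙-zeroˡ : (u : Space F dim) → 0# ∙ u ≡ 𝟎
  ∙-zeroˡ []      = refl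
  ∙-zeroˡ (x ∷ u) = cong₂ _∷_ (zeroˡ x) (∙-zeroˡ u)

  ∙-zeroʳ : ∀ {d} a → a ∙ 𝟎 {d} ≡ 𝟎
  ∙-zeroʳ {zero}  a = refl
  ∙-zeroʳ {suc d} a = cong₂ _∷_ (zeroʳ a) (∙-zeroʳ a)

  ∙-inverse : ∀ {a b} → b ⊛ a ≡ 1# → (u : Space F dim) → b ∙ (a ∙ u) ≡ u
  ∙-inverse eq u = trans (sym (∙-assoc _ _ u)) (trans (cong (_∙ u) eq) (∙-identity u))

  neg : Space F dim → Space F dim
  neg u = (⊖ 1#) ∙ u

  neg-inverseˡ : (u : Space F dim) → neg u ⊞ u ≡ 𝟎
  neg-inverseˡ u = begin
    neg u ⊞ u           ≡⟨ cong (neg u ⊞_) (∙-identity u) ⟨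
    neg u ⊞ 1# ∙ u      ≡⟨ ∙-distribʳ (⊖ 1#) 1# u ⟨
    (⊖ 1# ⊕ 1#) ∙ u     ≡⟨ cong (_∙ u) (-‿inverseˡ 1#) ⟩
    0# ∙ u              ≡⟨ ∙-zeroˡ u ⟩
    𝟎                   ∎
    where open ≡-Reasoning

  neg-cancelˡ : (u v : Space F dim) → neg u ⊞ (u ⊞ v) ≡ v
  neg-cancelˡ u v = trans (sym (⊞-assoc (neg u) u v)) (trans (cong (_⊞ v) (neg-inverseˡ u)) (⊞-identityˡ v))

  ⊞-cancelˡ : (u : Space F dim) {v w : Space F dim} → u ⊞ v ≡ u ⊞ w → v ≡ w
  ⊞-cancelˡ u {v} {w} eq = trans (sym (neg-cancelˡ u v)) (trans (cong (neg u ⊞_) eq) (neg-cancelˡ u w))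

  ⊞-interchange : (u v w x : Space F dim) → (u ⊞ v) ⊞ (w ⊞ x) ≡ (u ⊞ w) ⊞ (v ⊞ x)
  ⊞-interchange u v w x = begin
    (u ⊞ v) ⊞ (w ⊞ x) ≡⟨ ⊞-assoc u v (w ⊞ x) ⟩
    u ⊞ (v ⊞ (w ⊞ x)) ≡⟨ cong (u ⊞_) (⊞-assoc v w x) ⟨
    u ⊞ ((v ⊞ w) ⊞ x) ≡⟨ cong (λ z → u ⊞ (z ⊞ x)) (⊞-comm v w) ⟩
    u ⊞ ((w ⊞ v) ⊞ x) ≡⟨ cong (u ⊞_) (⊞-assoc w v x) ⟩
    u ⊞ (w ⊞ (v ⊞ x)) ≡⟨ ⊞-assoc u w (v ⊞ x) ⟨
    (u ⊞ w) ⊞ (v ⊞ x) ∎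
    where open ≡-Reasoning

  ∙-injective : ∀ {a b} {u : Space F dim} → u ≢ 𝟎 → a ∙ u ≡ b ∙ u → a ≡ b
  ∙-injective {a = a} {b} {u} u≢0 eq with difference a b
  ... | c , refl = sym (trans (cong (a ⊕_) (decidable-stable (c Fin.≟ 0#) λ c≢0 →
    let c⁻¹ , inv = inverse c≢0 in
    u≢0 (trans (sym (∙-inverse inv u)) (trans (cong (c⁻¹ ∙_) c∙u≡0) (∙-zeroʳ c⁻¹))))) (+-identityʳ a))
    where
    c∙u≡0 : c ∙ u ≡ 𝟎
    c∙u≡0 = ⊞-cancelˡ (a ∙ u) (trans (sym (∙-distribʳ a c u)) (trans (sym eq) (sym (⊞-identityʳ _))))

  module _ {A : Pred (Point F dim) 0ℓ} where

    span-⊞ : ∀ {u v} → Span F A u → Span F A v → Span F A (u ⊞ v)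
    span-⊞ {v = v} 0∈ sv = subst (Span F A) (sym (⊞-identityˡ v)) sv
    span-⊞ (add a x∈ su) sv = subst (Span F A) (sym (⊞-assoc _ _ _)) (add a x∈ (span-⊞ su sv))

    span-∙ : ∀ c {u} → Span F A u → Span F A (c ∙ u)
    span-∙ c 0∈ = subst (Span F A) (sym (∙-zeroʳ c)) 0∈
    span-∙ c (add {x} {v} a x∈ su) = subst (Span F A)
      (trans (cong (_⊞ c ∙ v) (∙-assoc c a (vec x))) (sym (∙-distribˡ c (a ∙ vec x) v)))
      (add (c ⊛ a) x∈ (span-∙ c su))

    span-∙⁻ : ∀ {c} → c ≢ 0# → ∀ {u} → Span F A (c ∙ u) → Span F A u
    span-∙⁻ c≢0 {u} s = let c⁻¹ , inv = inverse c≢0 in subst (Span F A) (∙-inverse inv u) (span-∙ c⁻¹ s)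

    span-difference : ∀ {u v} → Span F A u → Span F A (u ⊞ v) → Span F A v
    span-difference {u} {v} su suv = subst (Span F A) (neg-cancelˡ u v) (span-⊞ (span-∙ (⊖ 1#) su) suv)

    span-generator : ∀ {x} → A x → Span F A (vec x)
    span-generator {x} x∈ = subst (Span F A) (trans (⊞-identityʳ _) (∙-identity (vec x))) (add 1# x∈ 0∈)

  span-bind : {A B : Pred (Point F dim) 0ℓ} → (∀ {x} → A x → Span F B (vec x)) → ∀ {u} → Span F A u → Span F B u
  span-bind f 0∈            = 0∈
  span-bind f (add a x∈ su) = span-⊞ (span-∙ a (f x∈)) (span-bind f su)

  span-bind-¬¬ : {A B : Pred (Point F dim) 0ℓ} → (∀ {x} → A x → ¬ ¬ Span F B (vec x)) →
    ∀ {u} → Span F A u → ¬ ¬ Span F B u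
  span-bind-¬¬ f 0∈            ¬s = ¬s 0∈
  span-bind-¬¬ f (add a x∈ su) ¬s = f x∈ λ s → span-bind-¬¬ f su λ s′ → ¬s (span-⊞ (span-∙ a s) s′)

  -- Linear algebra modulo the vector `a` without forming a quotient; with the apex vector for `a`
  -- this is projection from the apex.
  span-modulo : (a : Space F dim) {A B : Pred (Point F dim) 0ℓ} →
    (∀ {x} → A x → ∃ λ t → Span F B (vec x ⊞ t ∙ a)) → ∀ {u} → Span F A u → ∃ λ t → Span F B (u ⊞ t ∙ a)
  span-modulo a {B = B} f 0∈ = 0# , subst (Span F B) (sym (trans (⊞-identityˡ _) (∙-zeroˡ a))) 0∈
  span-modulo a {B = B} f (add {x} {v} b x∈ su) =
    let t , s = f x∈ ; t′ , s′ = span-modulo a f su in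
    b ⊛ t ⊕ t′ , subst (Span F B) (lemma t t′) (span-⊞ (span-∙ b s) s′)
    where
    open ≡-Reasoning
    lemma : ∀ t t′ → b ∙ (vec x ⊞ t ∙ a) ⊞ (v ⊞ t′ ∙ a) ≡ (b ∙ vec x ⊞ v) ⊞ (b ⊛ t ⊕ t′) ∙ a
    lemma t t′ = begin
      b ∙ (vec x ⊞ t ∙ a) ⊞ (v ⊞ t′ ∙ a)              ≡⟨ cong (_⊞ (v ⊞ t′ ∙ a)) (∙-distribˡ b (vec x) (t ∙ a)) ⟩
      (b ∙ vec x ⊞ b ∙ (t ∙ a)) ⊞ (v ⊞ t′ ∙ a)        ≡⟨ ⊞-interchange (b ∙ vec x) _ v _ ⟩
      (b ∙ vec x ⊞ v) ⊞ (b ∙ (t ∙ a) ⊞ t′ ∙ a)        ≡⟨ cong (λ z → (b ∙ vec x ⊞ v) ⊞ (z ⊞ t′ ∙ a)) (∙-assoc b t a) ⟨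
      (b ∙ vec x ⊞ v) ⊞ ((b ⊛ t) ∙ a ⊞ t′ ∙ a)        ≡⟨ cong ((b ∙ vec x ⊞ v) ⊞_) (∙-distribʳ (b ⊛ t) t′ a) ⟨
      (b ∙ vec x ⊞ v) ⊞ (b ⊛ t ⊕ t′) ∙ a              ∎

  ∼-refl : (x : Point F dim) → _∼_ F x x
  ∼-refl x = 1# , 1≢0 , sym (∙-identity (vec x))

  combine : (Fin n → Fin q) → (Fin n → Space F dim) → Space F dim
  combine = linearCombination F

  combine-cong : {a b : Fin n → Fin q} (v : Fin n → Space F dim) → (∀ i → a i ≡ b i) → combine a v ≡ combine b v
  combine-cong {zero}  v eq = refl
  combine-cong {suc n} v eq = cong₂ (λ a u → a ∙ v zero ⊞ u) (eq zero) (combine-cong (v ∘ suc) (eq ∘ suc))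

  combine-⊕ : (a b : Fin n → Fin q) (v : Fin n → Space F dim) →
    combine (λ i → a i ⊕ b i) v ≡ combine a v ⊞ combine b v
  combine-⊕ {zero}  a b v = sym (⊞-identityˡ _)
  combine-⊕ {suc n} a b v = trans
    (cong₂ _⊞_ (∙-distribʳ (a zero) (b zero) (v zero)) (combine-⊕ (a ∘ suc) (b ∘ suc) (v ∘ suc)))
    (⊞-interchange (a zero ∙ v zero) _ _ _)

  combine-0 : (v : Fin n → Space F dim) → combine (λ _ → 0#) v ≡ 𝟎
  combine-0 {zero}  v = refl
  combine-0 {suc n} v = trans (cong₂ _⊞_ (∙-zeroˡ (v zero)) (combine-0 (v ∘ suc))) (⊞-identityˡ _)

  δ : Fin n → Fin q → Fin n → Fin q
  δ i c j = if does (j Fin.≟ i) then c else 0#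

  δ-≡ : (i : Fin n) (c : Fin q) → δ i c i ≡ c
  δ-≡ i c with i Fin.≟ i
  ... | yes _  = refl
  ... | no i≢i = ⊥-elim (i≢i refl)

  δ-≢ : ∀ {i j : Fin n} (c : Fin q) → j ≢ i → δ i c j ≡ 0#
  δ-≢ {i = i} {j} c j≢i with j Fin.≟ i
  ... | yes j≡i = ⊥-elim (j≢i j≡i)
  ... | no _    = refl

  combine-δ : (i : Fin n) (c : Fin q) (v : Fin n → Space F dim) → combine (δ i c) v ≡ c ∙ v i
  combine-δ zero    c v = trans (cong (c ∙ v zero ⊞_) (combine-0 (v ∘ suc))) (⊞-identityʳ _)
  combine-δ (suc i) c v = trans (cong₂ _⊞_ (∙-zeroˡ (v zero)) (combine-δ i c (v ∘ suc))) (⊞-identityˡ _)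

  module Family (point : Fin n → Point F dim) where

    v : Fin n → Space F dim
    v = vec ∘ point

    Among : Subset n → Pred (Point F dim) 0ℓ
    Among X x = ∃ λ i → i ∈ X × x ≡ point i

    span-∈ : ∀ {X i} → i ∈ X → Span F (Among X) (v i)
    span-∈ i∈X = span-generator (_ , i∈X , refl)

    span-mono : ∀ {X Y} → X ⊆ Y → ∀ {u} → Span F (Among X) u → Span F (Among Y) u
    span-mono X⊆Y = span-bind λ { (i , i∈X , refl) → span-∈ (X⊆Y i∈X) }

    span-⊥ : ∀ {u} → Span F (Among ⊥) u → u ≡ 𝟎
    span-⊥ 0∈ = refl
    span-⊥ (add a (i , i∈⊥ , _) s) = ⊥-elim (∉⊥ i∈⊥)

    combine-span : ∀ {X} a → (∀ i → i ∉ X → a i ≡ 0#) → Span F (Among X) (combine a v)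
    combine-span {X} a supp = go point a λ i → case i ∈? X of λ
      { (yes i∈X) → inj₂ (i , i∈X , refl) ; (no i∉X) → inj₁ (supp i i∉X) }
      where
      go : ∀ {m} (pt : Fin m → Point F dim) (a : Fin m → Fin q) → (∀ i → a i ≡ 0# ⊎ Among X (pt i)) →
        Span F (Among X) (combine a (vec ∘ pt))
      go {zero}  pt a h = 0∈
      go {suc m} pt a h with h zero
      ... | inj₂ x∈ = add (a zero) x∈ (go (pt ∘ suc) (a ∘ suc) (h ∘ suc))
      ... | inj₁ eq = subst (Span F (Among X))
        (sym (trans (cong (_⊞ combine (a ∘ suc) (vec ∘ pt ∘ suc)) (trans (cong (_∙ vec (pt zero)) eq) (∙-zeroˡ _))) (⊞-identityˡ _)))
        (go (pt ∘ suc) (a ∘ suc) (h ∘ suc))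

    span-combine : ∀ {X u} → Span F (Among X) u → ∃ λ a → (∀ i → i ∉ X → a i ≡ 0#) × combine a v ≡ u
    span-combine 0∈ = (λ _ → 0#) , (λ _ _ → refl) , combine-0 v
    span-combine {X} (add c (i , i∈X , refl) s) =
      let a , supp , eq = span-combine s in
      (λ j → δ i c j ⊕ a j) ,
      (λ j j∉X → trans (cong₂ _⊕_ (δ-≢ {i = i} {j} c λ { refl → j∉X i∈X }) (supp j j∉X)) (+-identityˡ 0#)) ,
      trans (combine-⊕ (δ i c) a v) (cong₂ _⊞_ (combine-δ i c v) eq)

    -- A nonzero coefficient of `v i` in a dependence would express `v i` through `B`, so the
    -- dependence is supported on `B`.
    independent-▹ : ∀ {B i} → Independent F v B → ¬ Span F (Among B) (v i) → Independent F v (B ∪ ⁅ i ⁆)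
    independent-▹ {B} {i} indep ¬span a supp eq = indep a suppB eq
      where
      rest : Fin n → Fin q
      rest j = if does (j Fin.≟ i) then 0# else a j
      split : ∀ j → a j ≡ δ i (a i) j ⊕ rest j
      split j with j Fin.≟ i
      ... | yes refl = sym (+-identityʳ (a j))
      ... | no _     = sym (+-identityˡ (a j))
      rest-supp : ∀ j → j ∉ B → rest j ≡ 0#
      rest-supp j j∉B with j Fin.≟ i
      ... | yes _  = refl
      ... | no j≢i = supp j λ j∈ → [ j∉B , j≢i ∘ x∈⁅y⁆⇒x≡y i ]′ (x∈p∪q⁻ B ⁅ i ⁆ j∈)
      relation : a i ∙ v i ⊞ combine rest v ≡ 𝟎
      relation = trans (cong (_⊞ combine rest v) (sym (combine-δ i (a i) v)))
        (trans (sym (combine-⊕ (δ i (a i)) rest v)) (trans (sym (combine-cong v split)) eq))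
      ai≡0 : a i ≡ 0#
      ai≡0 = decidable-stable (a i Fin.≟ 0#) λ ai≢0 → ¬span (span-∙⁻ ai≢0
        (span-difference (combine-span rest rest-supp)
          (subst (Span F (Among B)) (trans (sym relation) (⊞-comm _ _)) 0∈)))
      suppB : ∀ j → j ∉ B → a j ≡ 0#
      suppB j j∉B with j Fin.≟ i
      ... | yes refl = ai≡0
      ... | no j≢i   = supp j λ j∈ → [ j∉B , j≢i ∘ x∈⁅y⁆⇒x≡y i ]′ (x∈p∪q⁻ B ⁅ i ⁆ j∈)

    -- Subtracting a combination over `D` from `v i` would give a dependence in `C` with coefficient
    -- `1#` at `i`.
    independent⇒¬span : ∀ {C D i} → Independent F v C → i ∈ C → D ⊆ C → i ∉ D → ¬ Span F (Among D) (v i)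
    independent⇒¬span {C} {D} {i} indep i∈C D⊆C i∉D s =
      let a , supp , eq = span-combine s in
      1≢0 (begin
        1#                          ≡⟨ δ-≡ i 1# ⟨
        δ i 1# i                    ≡⟨ +-identityʳ _ ⟨
        δ i 1# i ⊕ 0#               ≡⟨ cong (δ i 1# i ⊕_) (trans (cong (⊖ 1# ⊛_) (supp i i∉D)) (zeroʳ _)) ⟨
        δ i 1# i ⊕ ⊖ 1# ⊛ a i       ≡⟨ indep (λ j → δ i 1# j ⊕ ⊖ 1# ⊛ a j)
            (λ j j∉C → trans (cong₂ _⊕_ (δ-≢ {i = i} {j} 1# λ { refl → j∉C i∈C })
              (trans (cong (⊖ 1# ⊛_) (supp j (j∉C ∘ D⊆C))) (zeroʳ _))) (+-identityˡ 0#))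
            (trans (combine-⊕ (δ i 1#) (λ j → ⊖ 1# ⊛ a j) v)
              (trans (cong₂ _⊞_ (trans (combine-δ i 1# v) (∙-identity (v i))) (trans (combine-neg a) (cong neg eq)))
                (trans (⊞-comm _ _) (neg-inverseˡ (v i))))) i ⟩
        0#                          ∎)
      where
      open ≡-Reasoning
      combine-neg : ∀ a → combine (λ j → ⊖ 1# ⊛ a j) v ≡ neg (combine a v)
      combine-neg = scale v
        where
        scale : ∀ {m} (w : Fin m → Space F dim) a → combine (λ j → ⊖ 1# ⊛ a j) w ≡ neg (combine a w)
        scale {zero}  w a = sym (∙-zeroʳ (⊖ 1#))
        scale {suc m} w a = trans (cong₂ _⊞_ (∙-assoc (⊖ 1#) (a zero) (w zero)) (scale (w ∘ suc) (a ∘ suc)))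
          (sym (∙-distribˡ (⊖ 1#) _ _))

    independent-⊆ : ∀ {C D} → D ⊆ C → Independent F v C → Independent F v D
    independent-⊆ D⊆C indep a supp = indep a (λ j j∉C → supp j (j∉C ∘ D⊆C))

    module Represented {r} (M : Matroid n r) (ranks : ∀ X → HasRank F v X (rank M X)) where
      open MatroidProperties M

      -- Otherwise `B ▹ i` would be independent in `X ▹ i` and larger than its rank, which is that
      -- of `X`.
      maximal-spans : ∀ {X B i} → B ⊆ X → Independent F v B → ∣ B ∣ ≡ rank M X → i ∈ cl X →
        ¬ ¬ Span F (Among B) (v i)
      maximal-spans {X} {B} {i} B⊆X indep size i∈cl ¬span = ℕ.<-irrefl refl (begin-strict
        rank M X        ≡⟨ size ⟨
        ∣ B ∣           <⟨ ℕ.n<1+n _ ⟩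
        suc ∣ B ∣       ≡⟨ ∣X∪⁅x⁆∣ B i (¬span ∘ span-∈) ⟨
        ∣ B ▹ i ∣       ≤⟨ proj₂ (ranks (X ▹ i)) (B ▹ i) (∪⁅⁆-least (p⊆p∪q ⁅ i ⁆ ∘ B⊆X) (x∈X∪⁅x⁆ X i))
                             (independent-▹ indep ¬span) ⟩
        rank M (X ▹ i)  ≡⟨ ∈cl⁻ i∈cl ⟩
        rank M X        ∎)
        where open ℕ.≤-Reasoning

      cl⇒span : ∀ {X i} → i ∈ cl X → ¬ ¬ Span F (Among X) (v i)
      cl⇒span {X} i∈cl with ranks X
      ... | (B , B⊆X , indep , size) , _ = ¬¬-map (span-mono B⊆X) (maximal-spans B⊆X indep size i∈cl)

      -- If `i` were outside `cl X`, a maximal independent subset `C` of `X ▹ i` would be larger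
      -- than the rank of `X` and so contain `i`. Then `C` without `i` is maximal independent in
      -- `X`, hence spans `v i`, against the independence of `C`.
      span⇒cl : ∀ {X i} → Span F (Among X) (v i) → i ∈ cl X
      span⇒cl {X} {i} s = decidable-stable (i ∈? cl X) contra
        where
        contra : ¬ (i ∉ cl X)
        contra i∉cl with ranks (X ▹ i)
        ... | (C , C⊆ , indep , size) , _ = span-bind-¬¬
              (λ { (j , j∈X , refl) → maximal-spans D⊆X (independent-⊆ (p─q⊆p C ⁅ i ⁆) indep) ∣D∣ (⊆cl X j∈X) }) s
              (independent⇒¬span indep i∈C (p─q⊆p C ⁅ i ⁆) (λ i∈D → ∈─⁻ C ⁅ i ⁆ i∈D (x∈⁅x⁆ i)))
          where
          D = C ─ ⁅ i ⁆
          ∣C∣ : ∣ C ∣ ≡ suc (rank M X)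
          ∣C∣ = trans size (rank-▹-∉cl i∉cl)
          i∈C : i ∈ C
          i∈C = decidable-stable (i ∈? C) λ i∉C → ℕ.<⇒≱ (ℕ.≤-reflexive (sym ∣C∣))
            (proj₂ (ranks X) C (λ {j} j∈C → [ id , (λ j∈i → ⊥-elim (i∉C (subst (_∈ C) (x∈⁅y⁆⇒x≡y i j∈i) j∈C))) ]′
              (x∈p∪q⁻ X ⁅ i ⁆ (C⊆ j∈C))) indep)
          D⊆X : D ⊆ X
          D⊆X {j} j∈D = [ id , (λ j∈i → ⊥-elim (∈─⁻ C ⁅ i ⁆ j∈D j∈i)) ]′ (x∈p∪q⁻ X ⁅ i ⁆ (C⊆ (p─q⊆p C ⁅ i ⁆ j∈D)))
          ∣D∣ : ∣ D ∣ ≡ rank M X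
          ∣D∣ = ℕ.suc-injective (trans (cong (_+ ∣ D ∣) (sym (∣⁅x⁆∣≡1 i)))
            (trans (∣Y∣+∣X─Y∣ λ j∈i → subst (_∈ C) (sym (x∈⁅y⁆⇒x≡y i j∈i)) i∈C) ∣C∣))

      flat-span : ∀ {X i} → IsFlat M X → Span F (Among X) (v i) → i ∈ X
      flat-span flat s = cl-least flat id (span⇒cl s)

-- The lines through the apex of a q-cone

module QCone {q n r n′ r′ : ℕ} (F : GF q) {M : Matroid n r} {M′ : Matroid n′ r′} (Q : IsQCone F M M′) where
  open LinearAlgebra F
  open IsQCone Q using (E; apex) renaming (a to apexPoint)
  open IsRestriction (IsQCone.base Q) using () renaming (point to basePoint; injective to base-injective; image to base-image; ranks to base-ranks)
  open IsRestriction (IsQCone.cone Q) using () renaming (point to conePoint; injective to cone-injective; image to cone-image; ranks to cone-ranks)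

  private
    module B = Family basePoint
    module C = Family conePoint
    module BR = B.Represented M base-ranks
    module CR = C.Represented M′ cone-ranks
    module BM = MatroidProperties M
    module CM = MatroidProperties M′

  a : Space F (suc r)
  a = vec apexPoint

  base∈E : ∀ p → E (basePoint p)
  base∈E p = Equivalence.from (base-image (basePoint p)) (p , ∼-refl (basePoint p))

  span⇒E : ∀ {Y u} → Span F (B.Among Y) u → Span F E u
  span⇒E = span-bind λ { (p , _ , refl) → span-generator (base∈E p) }

  -- The apex is outside the span of `E`, so modulo that span the multiple of `a` in a vector is
  -- determined.
  apex-coefficient : ∀ {u t} → Span F E u → Span F E (u ⊞ t ∙ a) → t ≡ 0#
  apex-coefficient {u} {t} su suta = decidable-stable (t Fin.≟ 0#) λ t≢0 →
    apex (span-∙⁻ t≢0 (span-difference su suta))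

  -- A point other than the apex on the line through the apex and `p` has exactly one representative
  -- with coefficient `1#` at the base vector; this labels the points by scalars `c`.
  u : Fin n → Fin q → Space F (suc r)
  u p c = B.v p ⊞ c ∙ a

  u-0# : ∀ p → u p 0# ≡ B.v p
  u-0# p = trans (cong (B.v p ⊞_) (∙-zeroˡ a)) (⊞-identityʳ (B.v p))

  u-⊕ : ∀ p c d → u p c ⊞ d ∙ a ≡ u p (c ⊕ d)
  u-⊕ p c d = trans (⊞-assoc (B.v p) (c ∙ a) (d ∙ a)) (cong (B.v p ⊞_) (sym (∙-distribʳ c d a)))

  u≢𝟎 : ∀ p c → u p c ≢ 𝟎
  u≢𝟎 p c eq = nonzero (basePoint p) (trans (sym (u-0# p)) (subst (λ t → u p t ≡ 𝟎)
    (apex-coefficient (span-generator (base∈E p)) (subst (Span F E) (sym eq) 0∈)) eq))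

  uPoint : Fin n → Fin q → Point F (suc r)
  uPoint p c = record { vec = u p c ; nonzero = u≢𝟎 p c }

  u∈Cone : ∀ p c → Cone F E apexPoint (uPoint p c)
  u∈Cone p c = basePoint p , base∈E p , subst (Span F (Pair F apexPoint (basePoint p)))
    (cong₂ _⊞_ (∙-identity (B.v p)) (⊞-identityʳ (c ∙ a)))
    (add {x = basePoint p} 1# (inj₂ (∼-refl (basePoint p))) (add {x = apexPoint} c (inj₁ (∼-refl apexPoint)) 0∈))

  e : Fin n → Fin q → Fin n′
  e p c = proj₁ (Equivalence.to (cone-image (uPoint p c)) (u∈Cone p c))

  e∼u : ∀ p c → _∼_ F (conePoint (e p c)) (uPoint p c)
  e∼u p c = proj₂ (Equivalence.to (cone-image (uPoint p c)) (u∈Cone p c))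

  module _ {A : Pred (Point F (suc r)) 0ℓ} (x : Point F (suc r)) {y : Point F (suc r)} (x∼y : _∼_ F x y) where

    ∼-span⁺ : Span F A (vec x) → Span F A (vec y)
    ∼-span⁺ s = let k , _ , eq = x∼y in subst (Span F A) (sym eq) (span-∙ k s)

    ∼-span⁻ : Span F A (vec y) → Span F A (vec x)
    ∼-span⁻ s = let k , k≢0 , eq = x∼y in span-∙⁻ k≢0 (subst (Span F A) eq s)

  e-span⁺ : ∀ {A} p c → Span F A (C.v (e p c)) → Span F A (u p c)
  e-span⁺ p c = ∼-span⁺ (conePoint (e p c)) {uPoint p c} (e∼u p c)

  e-span⁻ : ∀ {A} p c → Span F A (u p c) → Span F A (C.v (e p c))
  e-span⁻ p c = ∼-span⁻ (conePoint (e p c)) {uPoint p c} (e∼u p c)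

  module _ (p₀ : Fin n) where

    -- The apex lies in the cone only as a point of some line to the base, so a base point `p₀` is
    -- required.
    apex∈Cone : Cone F E apexPoint apexPoint
    apex∈Cone = basePoint p₀ , base∈E p₀ , span-generator {x = apexPoint} (inj₁ (∼-refl apexPoint))

    α : Fin n′
    α = proj₁ (Equivalence.to (cone-image apexPoint) apex∈Cone)

    α∼a : _∼_ F (conePoint α) apexPoint
    α∼a = proj₂ (Equivalence.to (cone-image apexPoint) apex∈Cone)

    conePoints : ConePoints q n n′
    conePoints = record { α = α ; e = e ; origin = 0# }

    open ConePoints conePoints using (cone; ∈cone⁺; ∈cone⁻; α∈cone; e∈cone⁺)

    e≢α : ∀ p c → e p c ≢ α
    e≢α p c eq with e∼u p c | α∼a
    -- `m` is the factor with `u p c ≡ m ∙ a`, and `j` is its negative, chosen to push `u p c` along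
    -- the line to `𝟎`.
    ... | s , _ , u≡ | k , k≢0 , a≡ = let k⁻¹ , inv = inverse k≢0 ; m = s ⊛ k⁻¹ ; j , m+j≡0 = difference m 0# in
      u≢𝟎 p (c ⊕ j) (begin
        u p (c ⊕ j)                            ≡⟨ u-⊕ p c j ⟨
        u p c ⊞ j ∙ a                          ≡⟨ cong (_⊞ j ∙ a) (trans u≡ (cong (λ i → s ∙ C.v i) eq)) ⟩
        s ∙ C.v α ⊞ j ∙ a                      ≡⟨ cong (λ z → s ∙ z ⊞ j ∙ a) (trans (sym (∙-inverse inv (C.v α))) (cong (k⁻¹ ∙_) (sym a≡))) ⟩
        s ∙ (k⁻¹ ∙ a) ⊞ j ∙ a                  ≡⟨ cong (_⊞ j ∙ a) (∙-assoc s k⁻¹ a) ⟨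
        m ∙ a ⊞ j ∙ a                          ≡⟨ ∙-distribʳ m j a ⟨
        (m ⊕ j) ∙ a                            ≡⟨ cong (_∙ a) m+j≡0 ⟩
        0# ∙ a                                 ≡⟨ ∙-zeroˡ a ⟩
        𝟎                                      ∎)
      where open ≡-Reasoning

    -- The two representatives differ by a factor `κ`. Shifting by the multiple `j` of `a` that
    -- cancels `κ ⊛ c` puts them into the span of `E`. Then `apex-coefficient` separates the
    -- comparison in the base, which gives `p ≡ p′` and `κ ≡ 1#`, from the one along the apex, which
    -- gives `c ≡ c′`.
    e-injective : ∀ {p c p′ c′} → e p c ≡ e p′ c′ → p ≡ p′ × c ≡ c′
    e-injective {p} {c} {p′} {c′} eq with e∼u p c | e∼u p′ c′
    ... | s , s≢0 , u≡ | s′ , s′≢0 , u′≡ with inverse s≢0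
    ... | s⁻¹ , inv = p≡p′ , c≡c′
      where
      open ≡-Reasoning
      κ = s′ ⊛ s⁻¹
      proportional : u p′ c′ ≡ κ ∙ B.v p ⊞ (κ ⊛ c) ∙ a
      proportional = begin
        u p′ c′                     ≡⟨ u′≡ ⟩
        s′ ∙ C.v (e p′ c′)          ≡⟨ cong (λ i → s′ ∙ C.v i) eq ⟨
        s′ ∙ C.v (e p c)            ≡⟨ cong (s′ ∙_) (trans (cong (s⁻¹ ∙_) u≡) (∙-inverse inv _)) ⟨
        s′ ∙ (s⁻¹ ∙ u p c)          ≡⟨ ∙-assoc s′ s⁻¹ _ ⟨
        κ ∙ u p c                   ≡⟨ ∙-distribˡ κ (B.v p) (c ∙ a) ⟩
        κ ∙ B.v p ⊞ κ ∙ (c ∙ a)     ≡⟨ cong (κ ∙ B.v p ⊞_) (∙-assoc κ c a) ⟨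
        κ ∙ B.v p ⊞ (κ ⊛ c) ∙ a     ∎
      j = proj₁ (difference (κ ⊛ c) 0#)
      κc+j≡0 : κ ⊛ c ⊕ j ≡ 0#
      κc+j≡0 = proj₂ (difference (κ ⊛ c) 0#)
      u-shifted : u p′ (c′ ⊕ j) ≡ κ ∙ B.v p
      u-shifted = begin
        u p′ (c′ ⊕ j)                             ≡⟨ u-⊕ p′ c′ j ⟨
        u p′ c′ ⊞ j ∙ a                           ≡⟨ cong (_⊞ j ∙ a) proportional ⟩
        (κ ∙ B.v p ⊞ (κ ⊛ c) ∙ a) ⊞ j ∙ a         ≡⟨ ⊞-assoc (κ ∙ B.v p) _ _ ⟩
        κ ∙ B.v p ⊞ ((κ ⊛ c) ∙ a ⊞ j ∙ a)         ≡⟨ cong (κ ∙ B.v p ⊞_) (∙-distribʳ (κ ⊛ c) j a) ⟨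
        κ ∙ B.v p ⊞ (κ ⊛ c ⊕ j) ∙ a               ≡⟨ cong (λ t → κ ∙ B.v p ⊞ t ∙ a) κc+j≡0 ⟩
        κ ∙ B.v p ⊞ 0# ∙ a                        ≡⟨ cong (κ ∙ B.v p ⊞_) (∙-zeroˡ a) ⟩
        κ ∙ B.v p ⊞ 𝟎                             ≡⟨ ⊞-identityʳ _ ⟩
        κ ∙ B.v p                                 ∎
      c′+j≡0 : c′ ⊕ j ≡ 0#
      c′+j≡0 = apex-coefficient (span-generator (base∈E p′))
        (subst (Span F E) (sym u-shifted) (span-∙ κ (span-generator (base∈E p))))
      v′≡ : B.v p′ ≡ κ ∙ B.v p
      v′≡ = trans (sym (u-0# p′)) (trans (cong (u p′) (sym c′+j≡0)) u-shifted)
      p≡p′ : p ≡ p′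
      p≡p′ = base-injective p p′ (κ , *-nonzero s′≢0 (inverse-nonzero inv) , v′≡)
      κ≡1 : κ ≡ 1#
      κ≡1 = ∙-injective (nonzero (basePoint p)) (trans (sym v′≡) (trans (cong B.v (sym p≡p′)) (sym (∙-identity _))))
      c≡c′ : c ≡ c′
      c≡c′ = ∙-injective {u = a} (nonzero apexPoint) (⊞-cancelˡ (j ∙ a) (begin
        j ∙ a ⊞ c ∙ a     ≡⟨ trans (⊞-comm _ _) (sym (∙-distribʳ c j a)) ⟩
        (c ⊕ j) ∙ a       ≡⟨ cong (λ t → (t ⊕ j) ∙ a) (trans (cong (_⊛ c) κ≡1) (*-identityˡ c)) ⟨
        (κ ⊛ c ⊕ j) ∙ a   ≡⟨ cong (_∙ a) (trans κc+j≡0 (sym c′+j≡0)) ⟩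
        (c′ ⊕ j) ∙ a      ≡⟨ trans (∙-distribʳ c′ j a) (⊞-comm _ _) ⟩
        j ∙ a ⊞ c′ ∙ a    ∎))

    pair-span : ∀ {p} x → _∼_ F (basePoint p) x → ∀ {w} → Span F (Pair F apexPoint x) w →
      ∃₂ λ s t → w ≡ s ∙ B.v p ⊞ t ∙ a
    pair-span x p∼x 0∈ = 0# , 0# , sym (trans (cong₂ _⊞_ (∙-zeroˡ _) (∙-zeroˡ a)) (⊞-identityˡ _))
    pair-span {p} x p∼x (add {v = w} b (inj₁ (l , _ , eq)) sw) with pair-span x p∼x sw
    ... | s , t , w≡ = s , b ⊛ l ⊕ t , trans (cong₂ _⊞_ (trans (cong (b ∙_) eq) (sym (∙-assoc b l a))) w≡) (begin
        (b ⊛ l) ∙ a ⊞ (s ∙ B.v p ⊞ t ∙ a)   ≡⟨ ⊞-assoc _ _ _ ⟨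
        ((b ⊛ l) ∙ a ⊞ s ∙ B.v p) ⊞ t ∙ a   ≡⟨ cong (_⊞ t ∙ a) (⊞-comm _ _) ⟩
        (s ∙ B.v p ⊞ (b ⊛ l) ∙ a) ⊞ t ∙ a   ≡⟨ ⊞-assoc _ _ _ ⟩
        s ∙ B.v p ⊞ ((b ⊛ l) ∙ a ⊞ t ∙ a)   ≡⟨ cong (s ∙ B.v p ⊞_) (∙-distribʳ (b ⊛ l) t a) ⟨
        s ∙ B.v p ⊞ (b ⊛ l ⊕ t) ∙ a         ∎)
      where open ≡-Reasoning
    pair-span {p} x p∼x@(m , _ , x≡) (add {v = w} b (inj₂ (l , _ , eq)) sw) with pair-span x p∼x sw
    ... | s , t , w≡ = b ⊛ (l ⊛ m) ⊕ s , t , trans (cong₂ _⊞_ head w≡)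
        (trans (sym (⊞-assoc _ _ _)) (cong (_⊞ t ∙ a) (sym (∙-distribʳ (b ⊛ (l ⊛ m)) s (B.v p)))))
      where
      head = trans (cong (b ∙_) (trans eq (trans (cong (l ∙_) x≡) (sym (∙-assoc l m (B.v p))))))
        (sym (∙-assoc b (l ⊛ m) (B.v p)))

    ∼-trans : ∀ (x y : Point F dim) {w : Space F dim} {t} → _∼_ F x y → t ≢ 0# → w ≡ t ∙ vec y → ∃ λ k → k ≢ 0# × w ≡ k ∙ vec x
    ∼-trans x y {t = t} (k , k≢0 , eq) t≢0 w≡ = t ⊛ k , *-nonzero t≢0 k≢0 ,
      trans w≡ (trans (cong (t ∙_) eq) (sym (∙-assoc t k (vec x))))

    -- A point of the cone is `s` times a base vector plus `t` times the apex vector. It is the apex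
    -- if `s` is 0; otherwise scaling by the inverse of `s` gives the label t/s.
    decompose : ∀ x → x ≡ α ⊎ ∃₂ λ p c → x ≡ e p c
    decompose x with Equivalence.from (cone-image (conePoint x)) (x , ∼-refl (conePoint x))
    ... | z , Ez , w∈ with Equivalence.to (base-image z) Ez
    ... | p , p∼z with pair-span z p∼z w∈
    ... | s , t , w≡ with s Fin.≟ 0#
    ... | yes refl = inj₁ (sym (cone-injective α x (∼-trans (conePoint α) apexPoint α∼a t≢0 w≡t∙a)))
      where
      w≡t∙a : C.v x ≡ t ∙ a
      w≡t∙a = trans w≡ (trans (cong (_⊞ t ∙ a) (∙-zeroˡ (B.v p))) (⊞-identityˡ _))
      t≢0 : t ≢ 0#
      t≢0 refl = nonzero (conePoint x) (trans w≡t∙a (∙-zeroˡ a))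
    ... | no s≢0 with inverse s≢0
    ... | s⁻¹ , inv = inj₂ (p , s⁻¹ ⊛ t , sym (cone-injective (e p (s⁻¹ ⊛ t)) x (∼-trans (conePoint (e p (s⁻¹ ⊛ t))) (uPoint p (s⁻¹ ⊛ t)) (e∼u p (s⁻¹ ⊛ t)) s≢0 (begin
        C.v x                             ≡⟨ w≡ ⟩
        s ∙ B.v p ⊞ t ∙ a                 ≡⟨ cong (s ∙ B.v p ⊞_) (∙-inverse (trans (*-comm s s⁻¹) inv) (t ∙ a)) ⟨
        s ∙ B.v p ⊞ s ∙ (s⁻¹ ∙ (t ∙ a))   ≡⟨ ∙-distribˡ s _ _ ⟨
        s ∙ (B.v p ⊞ s⁻¹ ∙ (t ∙ a))       ≡⟨ cong (λ z → s ∙ (B.v p ⊞ z)) (∙-assoc s⁻¹ t a) ⟨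
        s ∙ u p (s⁻¹ ⊛ t)                 ∎))))
      where open ≡-Reasoning

    span-a : ∀ {X} → α ∈ X → Span F (C.Among X) a
    span-a α∈X = ∼-span⁺ (conePoint α) {apexPoint} α∼a (C.span-∈ α∈X)

    span-u : ∀ {X p c} → e p c ∈ X → Span F (C.Among X) (u p c)
    span-u {p = p} {c} e∈X = e-span⁺ p c (C.span-∈ e∈X)

    line : ∀ {X p c} → IsFlat M′ X → α ∈ X → e p c ∈ X → ∀ c′ → e p c′ ∈ X
    line {X} {p} {c} flat α∈X e∈X c′ = let j , c+j≡c′ = difference c c′ in
      CR.flat-span flat (e-span⁻ p c′ (subst (Span F (C.Among X)) (trans (u-⊕ p c j) (cong (u p) c+j≡c′))
        (span-⊞ (span-u e∈X) (span-∙ j (span-a α∈X)))))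

    -- The difference of `u p c` and `u p c′` is a nonzero multiple of the apex vector.
    secant : ∀ {X p c c′} → IsFlat M′ X → c ≢ c′ → e p c ∈ X → e p c′ ∈ X → α ∈ X
    secant {X} {p} {c} {c′} flat c≢c′ e∈X e′∈X = let j , c+j≡c′ = difference c c′ in
      CR.flat-span flat (∼-span⁻ (conePoint α) {apexPoint} α∼a (span-∙⁻ {c = j} (λ { refl → c≢c′ (trans (sym (+-identityʳ c)) c+j≡c′) })
        (span-difference (span-u e∈X)
          (subst (Span F (C.Among X)) (sym (trans (u-⊕ p c j) (cong (u p) c+j≡c′))) (span-u e′∈X)))))

    α-modulo : ∀ {A} → ∃ λ t → Span F A (C.v α ⊞ t ∙ a)
    α-modulo {A} with α∼a
    ... | k , k≢0 , a≡ with inverse k≢0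
    ... | k⁻¹ , inv = ⊖ 1# ⊛ k⁻¹ , subst (Span F A) (begin
        𝟎                            ≡⟨ neg-inverseˡ (C.v α) ⟨
        neg (C.v α) ⊞ C.v α          ≡⟨ ⊞-comm _ _ ⟩
        C.v α ⊞ neg (C.v α)          ≡⟨ cong (λ z → C.v α ⊞ neg z) (trans (cong (k⁻¹ ∙_) a≡) (∙-inverse inv (C.v α))) ⟨
        C.v α ⊞ neg (k⁻¹ ∙ a)        ≡⟨ cong (C.v α ⊞_) (∙-assoc (⊖ 1#) k⁻¹ a) ⟨
        C.v α ⊞ (⊖ 1# ⊛ k⁻¹) ∙ a     ∎) 0∈
      where open ≡-Reasoning

    -- Modulo the apex vector the generator `α` disappears, so `u p c` plus some multiple `t` of `a`
    -- lies in the span of `X`; that vector is `u p (c ⊕ t)`, on the same line.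
    meets : ∀ {X p c} → IsFlat M′ X → α ∉ X → e p c ∈ CM.cl (X ∪ ⁅ α ⁆) → ∃ λ c′ → e p c′ ∈ X
    meets {X} {p} {c} flat α∉X e∈cl = decidable-stable (Fin.any? λ c′ → e p c′ ∈? X)
      (¬¬-map meet (CR.cl⇒span e∈cl))
      where
      modulo : ∀ {x} → C.Among (X ∪ ⁅ α ⁆) x → ∃ λ t → Span F (C.Among X) (vec x ⊞ t ∙ a)
      modulo (i , i∈ , refl) with x∈p∪q⁻ X ⁅ α ⁆ i∈
      ... | inj₁ i∈X = 0# , subst (Span F (C.Among X)) (sym (trans (cong (C.v i ⊞_) (∙-zeroˡ a)) (⊞-identityʳ _))) (C.span-∈ i∈X)
      ... | inj₂ i∈α with x∈⁅y⁆⇒x≡y α i∈α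
      ... | refl = α-modulo
      meet : Span F (C.Among (X ∪ ⁅ α ⁆)) (C.v (e p c)) → ∃ λ c′ → e p c′ ∈ X
      meet s = let t , s′ = span-modulo a modulo (e-span⁺ p c s) in
        c ⊕ t , CR.flat-span flat (e-span⁻ p (c ⊕ t) (subst (Span F (C.Among X)) (u-⊕ p c t) s′))

    cone-⊥ : cone ⊥ ≡ ⊥ ∪ ⁅ α ⁆
    cone-⊥ = ⊆-antisym
      (λ x∈ → case ∈cone⁻ x∈ of λ { (inj₁ refl) → x∈X∪⁅x⁆ ⊥ α ; (inj₂ (_ , p∈⊥ , _)) → ⊥-elim (∉⊥ p∈⊥) })
      (∪⁅⁆-least (λ x∈⊥ → ⊥-elim (∉⊥ x∈⊥)) α∈cone)

    cone-▹⊇ : ∀ Y p → cone Y ∪ ⁅ e p 0# ⁆ ⊆ cone (Y ∪ ⁅ p ⁆)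
    cone-▹⊇ Y p = ∪⁅⁆-least
      (λ x∈ → case ∈cone⁻ x∈ of λ { (inj₁ refl) → α∈cone ; (inj₂ (p′ , p′∈ , c , refl)) → e∈cone⁺ c (p⊆p∪q ⁅ p ⁆ p′∈) })
      (e∈cone⁺ 0# (x∈X∪⁅x⁆ Y p))

    cone-▹⊆ : ∀ Y p → cone (Y ∪ ⁅ p ⁆) ⊆ CM.cl (cone Y ∪ ⁅ e p 0# ⁆)
    cone-▹⊆ Y p x∈ with ∈cone⁻ x∈
    ... | inj₁ refl = CM.⊆cl _ (p⊆p∪q ⁅ e p 0# ⁆ α∈cone)
    ... | inj₂ (p′ , p′∈ , c , refl) with x∈p∪q⁻ Y ⁅ p ⁆ p′∈
    ... | inj₁ p′∈Y = CM.⊆cl _ (p⊆p∪q ⁅ e p 0# ⁆ (e∈cone⁺ c p′∈Y))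
    ... | inj₂ p′∈p with x∈⁅y⁆⇒x≡y p p′∈p
    ... | refl = line (CM.cl-flat _) (CM.⊆cl _ (p⊆p∪q ⁅ e p 0# ⁆ α∈cone)) (CM.⊆cl _ (x∈X∪⁅x⁆ (cone Y) (e p 0#))) c

    cl⇒cl-cone : ∀ {Y p} → p ∈ BM.cl Y → e p 0# ∈ CM.cl (cone Y)
    cl⇒cl-cone {Y} {p} p∈cl = decidable-stable (e p 0# ∈? CM.cl (cone Y)) (¬¬-map
      (λ s → CR.span⇒cl (e-span⁻ p 0# (subst (Span F (C.Among (cone Y))) (sym (u-0# p)) (span-bind
        (λ { (p′ , p′∈Y , refl) → subst (Span F (C.Among (cone Y))) (u-0# p′) (span-u (e∈cone⁺ 0# p′∈Y)) }) s))))
      (BR.cl⇒span p∈cl))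

    -- Modulo the apex vector every point of the cone over `Y` becomes `𝟎` or a multiple of a vector
    -- of `Y`. The leftover multiple of `a` vanishes by `apex-coefficient`.
    cl-cone⇒cl : ∀ {Y p} → e p 0# ∈ CM.cl (cone Y) → p ∈ BM.cl Y
    cl-cone⇒cl {Y} {p} e∈cl = decidable-stable (p ∈? BM.cl Y) (¬¬-map descend (CR.cl⇒span e∈cl))
      where
      modulo : ∀ {x} → C.Among (cone Y) x → ∃ λ t → Span F (B.Among Y) (vec x ⊞ t ∙ a)
      modulo (i , i∈ , refl) with ∈cone⁻ i∈
      ... | inj₁ refl = α-modulo
      ... | inj₂ (p′ , p′∈Y , c , refl) with e∼u p′ c
      ... | k , k≢0 , u≡ with inverse k≢0
      ... | k⁻¹ , inv = k⁻¹ ⊛ j , subst (Span F (B.Among Y)) (begin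
          k⁻¹ ∙ B.v p′                           ≡⟨ cong (k⁻¹ ∙_) (u-0# p′) ⟨
          k⁻¹ ∙ u p′ 0#                          ≡⟨ cong (λ t → k⁻¹ ∙ u p′ t) c+j≡0 ⟨
          k⁻¹ ∙ u p′ (c ⊕ j)                     ≡⟨ cong (k⁻¹ ∙_) (u-⊕ p′ c j) ⟨
          k⁻¹ ∙ (u p′ c ⊞ j ∙ a)                 ≡⟨ ∙-distribˡ k⁻¹ _ _ ⟩
          k⁻¹ ∙ u p′ c ⊞ k⁻¹ ∙ (j ∙ a)           ≡⟨ cong₂ _⊞_ (trans (cong (k⁻¹ ∙_) u≡) (∙-inverse inv _)) (sym (∙-assoc k⁻¹ j a)) ⟩
          C.v (e p′ c) ⊞ (k⁻¹ ⊛ j) ∙ a           ∎) (span-∙ k⁻¹ (B.span-∈ p′∈Y))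
        where
        open ≡-Reasoning
        j = proj₁ (difference c 0#)
        c+j≡0 = proj₂ (difference c 0#)
      descend : Span F (C.Among (cone Y)) (C.v (e p 0#)) → p ∈ BM.cl Y
      descend s with span-modulo a modulo (e-span⁺ p 0# s)
      ... | t , s′ = BR.span⇒cl (subst (Span F (B.Among Y)) (trans (cong (u p) 0+t≡0) (u-0# p)) s″)
        where
        s″ : Span F (B.Among Y) (u p (0# ⊕ t))
        s″ = subst (Span F (B.Among Y)) (u-⊕ p 0# t) s′
        0+t≡0 : 0# ⊕ t ≡ 0#
        0+t≡0 = apex-coefficient (span-generator (base∈E p)) (span⇒E s″)

    -- The cone over `⊥` is one nonzero vector, of rank 1. Since `e p 0#` represents the base point
    -- `p` and, with `α`, generates its line, adjoining `p` raises the rank of `Y` exactly when it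
    -- raises that of the cone.
    rank-cone : ∀ Y → rank M′ (cone Y) ≡ suc (rank M Y)
    rank-cone = subset-induction (λ Y → rank M′ (cone Y) ≡ suc (rank M Y))
      (trans (cong (rank M′) cone-⊥) (trans (CM.rank-▹-∉cl α∉cl⊥) (cong suc (trans CM.rank-⊥ (sym BM.rank-⊥)))))
      λ Y p _ IH → trans (ℕ.≤-antisym
        (ℕ.≤-trans (CM.rank-mono (cone-▹⊆ Y p)) (ℕ.≤-reflexive (CM.rank-cl _)))
        (CM.rank-mono (cone-▹⊇ Y p))) (step Y p IH)
      where
      α∉cl⊥ : α ∉ CM.cl ⊥
      α∉cl⊥ α∈ = CR.cl⇒span α∈ λ s → nonzero (conePoint α) (C.span-⊥ s)
      step : ∀ Y p → rank M′ (cone Y) ≡ suc (rank M Y) → rank M′ (cone Y ∪ ⁅ e p 0# ⁆) ≡ suc (rank M (Y ∪ ⁅ p ⁆))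
      step Y p IH with p ∈? BM.cl Y
      ... | yes p∈cl = trans (CM.∈cl⁻ (cl⇒cl-cone p∈cl)) (trans IH (cong suc (sym (BM.∈cl⁻ p∈cl))))
      ... | no p∉cl  = trans (CM.rank-▹-∉cl (p∉cl ∘ cl-cone⇒cl)) (cong suc (trans IH (sym (BM.rank-▹-∉cl p∉cl))))

    coneStructure : ConeStructure q M M′
    coneStructure = record
      { conePoints  = conePoints
      ; e≢α         = e≢α
      ; e-injective = e-injective
      ; decompose   = decompose
      ; line        = line
      ; secant      = secant
      ; meets       = meets
      ; rank-cone   = rank-cone
      }

-- Catenary data of q-cones

≈ᶜ-sym : {v : CatenaryData n r} {w : CatenaryData n′ r′} → v ≈ᶜ w → w ≈ᶜ v
≈ᶜ-sym (pointwise eq) = pointwise λ a → sym (eq a)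

≈ᶜ-trans : {u : CatenaryData n r} {v : CatenaryData n′ r′} {w : CatenaryData n″ r″} → u ≈ᶜ v → v ≈ᶜ w → u ≈ᶜ w
≈ᶜ-trans (pointwise eq) (pointwise eq′) = pointwise λ a → trans (eq a) (eq′ a)

-- The q-cone of the empty matroid is empty: there is no line through the apex.
coneData : ℕ → ∀ {n r} → CatenaryData n r → ∃₂ CatenaryData
coneData q {n} {zero}  v = 0 , 0 , λ _ → 1
coneData q {n} {suc r} v = suc (q * n) , suc (suc r) ,
  λ a → ∑[ b ← candidates n (suc r) ] extend v b * coneFlagWeight q (λ w → 𝟙 (w ≟ᵛ parts a)) b

coneData-cong : ∀ q {v : CatenaryData n r} {w : CatenaryData n′ r′} → v ≈ᶜ w →
  proj₂ (proj₂ (coneData q v)) ≈ᶜ proj₂ (proj₂ (coneData q w))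
coneData-cong {r = zero}      q (pointwise eq) = pointwise λ _ → refl
coneData-cong {n} {suc r} q (pointwise eq) = pointwise λ a → ∑-cong (candidates n (suc r)) λ b →
  cong (_* coneFlagWeight q (λ w → 𝟙 (w ≟ᵛ parts a)) b) (extend-cong eq b)

catenaryData-empty : n ≡ 0 → r ≡ 0 → (M : Matroid n r) → catenaryData M ≈ᶜ (λ (_ : Composition 0 0) → 1)
catenaryData-empty refl refl M = pointwise λ a → lemma (parts a) (total a)
  where
  lemma : (a : Vec ℕ 1) → Vec.sum a ≡ 0 → ν M a ≡ 1
  lemma (zero ∷ []) _ = trans (ν≡∑ M (0 ∷ [])) (cong (_+ 0)
    (𝟙-yes (isFlag? M ([] ∷ []) ×-dec (flagComposition {r = 0} ([] ∷ []) ≟ᵛ (0 ∷ [])))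
      (((λ { zero () }) , (λ { zero → rank-full M }) , (λ ()) , refl) , refl)))

catenaryData-cone : (F : GF q) (M : Matroid n r) (M′ : Matroid n′ r′) → Simple M → IsQCone F M M′ →
  catenaryData M′ ≈ᶜ proj₂ (proj₂ (coneData q (catenaryData M)))
catenaryData-cone {r = zero} F M M′ simple Q = catenaryData-empty n′≡0 r′≡0 M′
  where
  open IsRestriction (IsQCone.cone Q)
  -- In rank 0 every element is a loop, so the simple `M` is empty, and a cone over no points has no
  -- points.
  noElement : ∀ x → 1 ≤ 0
  noElement x = ℕ.≤-trans (ℕ.≤-reflexive (sym (Simple.noLoops simple x))) (MatroidProperties.rank≤r M ⁅ x ⁆)
  noPoint : ∀ {m} → (Fin m → 1 ≤ 0) → m ≡ 0
  noPoint {zero}  f = refl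
  noPoint {suc m} f with f zero
  ... | ()
  n′≡0 = noPoint λ x →
    let _ , Ez , _ = Equivalence.from (image (point x)) (x , LinearAlgebra.∼-refl F (point x)) in
    noElement (proj₁ (Equivalence.to (IsRestriction.image (IsQCone.base Q) _) Ez))
  r′≡0 = ℕ.n≤0⇒n≡0 (subst₂ _≤_ (rank-full M′) (trans (∣⊤∣≡n _) n′≡0) (rank≤size M′ full))
catenaryData-cone {q} {n} {suc r} F M M′ simple Q =
  conclude (ConeProperties.size-whole M M′ S) (ConeProperties.rank-whole M M′ S) M′ S
  where
  S : ConeStructure q M M′
  -- The base point that puts the apex into the cone exists because the size of `M` is at least its
  -- rank, which is positive.
  S = QCone.coneStructure F Q (fromℕ< {0} (ℕ.≤-trans (s≤s z≤n)
    (subst₂ _≤_ (rank-full M) (∣⊤∣≡n n) (rank≤size M full))))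
  -- Size and rank are generalised along with `M′` and `S`, so that the two equations can be matched
  -- by `refl`.
  conclude : ∀ {n′ r′} → n′ ≡ suc (q * n) → r′ ≡ suc (suc r) → (M′ : Matroid n′ r′) → ConeStructure q M M′ →
    catenaryData M′ ≈ᶜ proj₂ (proj₂ (coneData q (catenaryData M)))
  conclude refl refl M′ S = pointwise λ a → ν-cone M M′ S (parts a)

module _ {c ℓ₁ ℓ₂} (K : HeytingField c ℓ₁ ℓ₂) where

  ≈ᶜ⇒sameVector : (M : Matroid n r) (N : Matroid n′ r′) → catenaryData M ≈ᶜ catenaryData N →
    SameVector K (𝒢-invariant K M) (𝒢-invariant K N)
  ≈ᶜ⇒sameVector M N (pointwise eq) = pointwise (catenary⇒sameVector K M N eq)

  sameVector⇒≈ᶜ : CharacteristicZero K → (M : Matroid n r) (N : Matroid n′ r′) →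
    SameVector K (𝒢-invariant K M) (𝒢-invariant K N) → catenaryData M ≈ᶜ catenaryData N
  sameVector⇒≈ᶜ char0 M N (pointwise eq) = pointwise (sameVector⇒catenary K char0 M N eq)

proposition4p14 : ∀ {c ℓ₁ ℓ₂} →
    (Σ (ℕ → ∀ {n r} → CatenaryData n r → ∃₂ CatenaryData) λ Φ →
    ∀ {q} → IsPrimePower q → (F : GF q) →
    ∀ {n r n′ r′} (M : Matroid n r) (M′ : Matroid n′ r′) →
    Simple M → Representable F M → IsQCone F M M′ →
    catenaryData M′ ≈ᶜ proj₂ (proj₂ (Φ q (catenaryData M))))
    ×
    (∀ {q} → IsPrimePower q → (F : GF q) →
    (K : HeytingField c ℓ₁ ℓ₂) → CharacteristicZero K →
    ∀ {n₁ r₁ n₂ r₂ n₁′ r₁′ n₂′ r₂′}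
    (M : Matroid n₁ r₁) (N : Matroid n₂ r₂) (M′ : Matroid n₁′ r₁′) (N′ : Matroid n₂′ r₂′) →
    Simple M → Representable F M → Simple N → Representable F N →
    IsQCone F M M′ → IsQCone F N N′ →
    catenaryData M ≈ᶜ catenaryData N ⊎ SameVector K (𝒢-invariant K M) (𝒢-invariant K N) →
    catenaryData M′ ≈ᶜ catenaryData N′ × SameVector K (𝒢-invariant K M′) (𝒢-invariant K N′))
proposition4p14 =
  (coneData , λ _ F M M′ simple _ Q → catenaryData-cone F M M′ simple Q) ,
  λ {q} _ F K char0 M N M′ N′ simpleM _ simpleN _ QM QN same →
    -- Either hypothesis is brought to catenary data, the terms of the cone formula; characteristic
    -- zero serves to read counts off the coefficients.
    let catM≈catN = [ id , sameVector⇒≈ᶜ K char0 M N ]′ same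
        catM′≈catN′ = ≈ᶜ-trans (catenaryData-cone F M M′ simpleM QM)
          (≈ᶜ-trans (coneData-cong q catM≈catN) (≈ᶜ-sym (catenaryData-cone F N N′ simpleN QN)))
    in catM′≈catN′ , ≈ᶜ⇒sameVector K M′ N′ catM′≈catN′
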